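{- Let $\mathbb{K}$ be a field and let $G$ be a finite simple graph with vertex set $\{v_1,\dots,v_\ell\}$. The graphic arrangement $\mathcal{A}_G=\{\ker(x_i-x_j) \mid \{v_i,v_j\}\in E_G\}$ in $\mathbb{K}^\ell$ is MAT-free if and only if $G$ is strongly chordal.
   Context: An arrangement is a finite set of linear hyperplanes in $V=\mathbb{K}^\ell$. For a subset $\mathcal{B}\subseteq\mathcal{A}$, $\operatorname{rank}(\mathcal{B})$ is the codimension of $\bigcap_{H\in\mathcal{B}}H$ (with the empty intersection equal to $V$). For $H\in\mathcal{A}$, the restriction is $\mathcal{A}^H=\{K\cap H\mid K\in\mathcal{A}\setminus\{H\}\}$ (an arrangement in $H$). A partition $\pi=(\pi_1,\dots,\pi_n)$ of a nonempty arrangement $\mathcal{A}$ into nonempty blocks is an MAT-partition if for every $k\in[n]$, writing $\mathcal{A}_{k-1}=\pi_1\sqcup\dots\sqcup\pi_{k-1}$ ($\mathcal{A}_0=\varnothing$): (MP1) $\operatorname{rank}(\pi_k)=|\pi_k|$; (MP2) there is no $H'\in\mathcal{A}_{k-1}$ with $\bigcap_{H\in\pi_k}H\subseteq H'$; (MP3) for each $H\in\pi_k$, $|\mathcal{A}_{k-1}|-|(\mathcal{A}_{k-1}\cup\{H\})^H|=k-1$. An arrangement is MAT-free if it is empty or admits an MAT-partition. A graph is chordal if it has no induced cycle of length greater than three. For $n\ge3$, the $n$-sun $S_n$ is the graph on $\{u_1,\dots,u_n\}\cup\{w_1,\dots,w_n\}$ with edges $\{u_i,u_j\}$ for all $i<j$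 and $\{w_i,u_i\},\{w_i,u_{i+1}\}$ for all $i$ (indices mod $n$, $u_{n+1}=u_1$). A graph is strongly chordal if it is chordal and contains no induced subgraph isomorphic to $S_n$ for any $n\ge3$. -}

module Defs where

open import Level using (Level; _⊔_; suc)
open import Algebra.Bundles using (CommutativeRing)
open import Data.Nat as ℕ using (ℕ; zero; _∸_; _<_)
open import Data.Fin using (Fin; toℕ) renaming (_<_ to _<ᶠ_)
open import Data.Fin.Properties using () renaming (_≟_ to _≟ᶠ_)
open import Data.Bool using (Bool; true; false)
open import Data.Product using (Σ; ∃; _×_; _,_; proj₁; proj₂)
open import Data.Product.Properties using (≡-dec)
open import Data.Sum using (_⊎_)
open import Data.Empty using (⊥)
open import Data.Unit using (⊤)
open import Data.List using (List; []; _∷_; length; _++_; filter; concat; allFin; map; concatMap)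
open import Data.List.Membership.Propositional using (_∈_)
open import Data.List.Relation.Unary.All using (All)
open import Data.List.Relation.Unary.AllPairs using (AllPairs)
open import Data.List.Relation.Binary.Permutation.Propositional using (_↭_)
open import Relation.Binary.PropositionalEquality using (_≡_; _≢_)
open import Relation.Nullary using (¬_; Dec; yes; no)
open import Relation.Nullary.Decidable using (¬?)
open import Function.Definitions using (Injective)

record Field (c ℓ : Level) : Set (suc (c ⊔ ℓ)) where
  field
    commutativeRing : CommutativeRing c ℓ
  open CommutativeRing commutativeRing public
  field
    1≉0     : ¬ (1# ≈ 0#)
    inverse : ∀ x → ¬ (x ≈ 0#) → Σ Carrier λ y → x * y ≈ 1#

record SimpleGraph (n : ℕ) : Set where
  field
    Adj     : Fin n → Fin n → Bool
    sym     : ∀ i j → Adj i j ≡ Adj j i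
    irrefl  : ∀ i → Adj i i ≡ false
open SimpleGraph public

csuc : ∀ {n} → Fin n → Fin n
csuc {ℕ.suc n} i with toℕ i ℕ.<? n
... | yes p = Data.Fin.suc (Data.Fin.fromℕ< p)
  where import Data.Fin
... | no _ = Data.Fin.zero
  where import Data.Fin

CycAdj : ∀ {n} → Fin n → Fin n → Set
CycAdj i j = (j ≡ csuc i) ⊎ (i ≡ csuc j)

InducedCycle : ∀ {ℓ} → SimpleGraph ℓ → ℕ → Set
InducedCycle {ℓ} G n =
  Σ (Fin n → Fin ℓ) λ c → Injective _≡_ _≡_ c ×
    (∀ i j → (Adj G (c i) (c j) ≡ true → CycAdj i j) × (CycAdj i j → Adj G (c i) (c j) ≡ true))

Chordal : ∀ {ℓ} → SimpleGraph ℓ → Set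
Chordal G = ∀ n → 3 < n → ¬ InducedCycle G n

-- adjacency in the n-sun S_n : vertices inj₁ i = u_i, inj₂ i = w_i
SunAdj : ∀ {n} → Fin n ⊎ Fin n → Fin n ⊎ Fin n → Set
SunAdj (Data.Sum.inj₁ i) (Data.Sum.inj₁ j) = i ≢ j
SunAdj (Data.Sum.inj₁ i) (Data.Sum.inj₂ j) = (i ≡ j) ⊎ (i ≡ csuc j)
SunAdj (Data.Sum.inj₂ i) (Data.Sum.inj₁ j) = (j ≡ i) ⊎ (j ≡ csuc i)
SunAdj (Data.Sum.inj₂ i) (Data.Sum.inj₂ j) = ⊥

InducedSun : ∀ {ℓ} → SimpleGraph ℓ → ℕ → Set
InducedSun {ℓ} G n =
  Σ (Fin n ⊎ Fin n → Fin ℓ) λ f → Injective _≡_ _≡_ f ×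
    (∀ a b → (Adj G (f a) (f b) ≡ true → SunAdj a b) × (SunAdj a b → Adj G (f a) (f b) ≡ true))

StronglyChordal : ∀ {ℓ} → SimpleGraph ℓ → Set
StronglyChordal G = Chordal G × (∀ n → 2 < n → ¬ InducedSun G n)

Edge : ℕ → Set
Edge ℓ = Fin ℓ × Fin ℓ

_≟ₑ_ : ∀ {ℓ} (e f : Edge ℓ) → Dec (e ≡ f)
_≟ₑ_ = ≡-dec _≟ᶠ_ _≟ᶠ_

edges : ∀ {ℓ} → SimpleGraph ℓ → List (Edge ℓ)
edges {ℓ} G = filter (λ e → isEdge (proj₁ e) (proj₂ e))
                (concatMap (λ i → map (λ j → (i , j)) (allFin ℓ)) (allFin ℓ))
  where
  isEdge : (i j : Fin ℓ) → Dec ((i <ᶠ j) × (Adj G i j ≡ true))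
  isEdge i j = Relation.Nullary.Decidable._×-dec_ (i Data.Fin.<? j)
                 (Data.Bool._≟_ (Adj G i j) true)
    where import Data.Fin; import Data.Bool; import Relation.Nullary.Decidable

module LinAlg {c ℓ′ : Level} (K : Field c ℓ′) (ℓ : ℕ) where
  open Field K

  Vec : Set c
  Vec = Fin ℓ → Carrier

  sumF : ∀ d → (Fin d → Carrier) → Carrier
  sumF zero f = 0#
  sumF (ℕ.suc d) f = f Data.Fin.zero + sumF d (λ k → f (Data.Fin.suc k))
    where import Data.Fin

  lincomb : ∀ d → (Fin d → Carrier) → (Fin d → Vec) → Vec
  lincomb d a v i = sumF d (λ k → a k * v k i)

  Subset : Set (suc (c ⊔ ℓ′))
  Subset = Vec → Set (c ⊔ ℓ′)

  HasDim : Subset → ℕ → Set (c ⊔ ℓ′)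
  HasDim W d = Σ (Fin d → Vec) λ v →
      (∀ k → W (v k))
    × (∀ a → (∀ i → lincomb d a v i ≈ 0#) → ∀ k → a k ≈ 0#)
    × (∀ w → W w → Σ (Fin d → Carrier) λ a → ∀ i → w i ≈ lincomb d a v i)

  _∈H_ : Vec → Edge ℓ → Set ℓ′
  x ∈H (i , j) = x i - x j ≈ 0#

  Inter : List (Edge ℓ) → Subset
  Inter B x = All (λ e → Level.Lift c (x ∈H e)) B
  HasRank : List (Edge ℓ) → ℕ → Set (c ⊔ ℓ′)
  HasRank B r = (r ℕ.≤ ℓ) × HasDim (Inter B) (ℓ ∸ r)

  SameRestr : Edge ℓ → Edge ℓ → Edge ℓ → Set (c ⊔ ℓ′)
  SameRestr H K K′ = ∀ x → ((x ∈H K × x ∈H H) → (x ∈H K′ × x ∈H H))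
                         × ((x ∈H K′ × x ∈H H) → (x ∈H K × x ∈H H))

  -- |A^H| = m : the hyperplanes of A other than H give exactly m
  -- distinct subspaces K ∩ H (witnessed by m pairwise distinct representatives)
  RestrSize : List (Edge ℓ) → Edge ℓ → ℕ → Set (c ⊔ ℓ′)
  RestrSize A H m = Σ (List (Edge ℓ)) λ reps →
      (length reps ≡ m)
    × All (_∈ A′) reps
    × AllPairs (λ K K′ → ¬ SameRestr H K K′) reps
    × (∀ K → K ∈ A′ → Σ (Edge ℓ) λ K′ → (K′ ∈ reps) × SameRestr H K K′)
    where A′ = filter (λ K → ¬? (K ≟ₑ H)) A

  MP1 : List (Edge ℓ) → Set (c ⊔ ℓ′)
  MP1 b = HasRank b (length b)

  MP2 : List (Edge ℓ) → List (Edge ℓ) → Set (c ⊔ ℓ′)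
  MP2 prev b = ¬ (Σ (Edge ℓ) λ H′ → (H′ ∈ prev) × (∀ x → Inter b x → x ∈H H′))

  MP3 : List (Edge ℓ) → List (Edge ℓ) → ℕ → Set (c ⊔ ℓ′)
  MP3 prev b k-1 = ∀ H → H ∈ b →
    Σ ℕ λ m → RestrSize (prev ++ (H ∷ [])) H m × (length prev ∸ m ≡ k-1)

  MATConds : List (Edge ℓ) → ℕ → List (List (Edge ℓ)) → Set (c ⊔ ℓ′)
  MATConds prev k-1 [] = Data.Unit.Polymorphic.⊤
    where import Data.Unit.Polymorphic
  MATConds prev k-1 (b ∷ bs) =
    MP1 b × MP2 prev b × MP3 prev b k-1 × MATConds (prev ++ b) (ℕ.suc k-1) bs

  IsPartition : List (List (Edge ℓ)) → List (Edge ℓ) → Set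
  IsPartition π A = All (λ b → b ≢ []) π × (concat π ↭ A)

  IsMATPartition : List (List (Edge ℓ)) → List (Edge ℓ) → Set (c ⊔ ℓ′)
  IsMATPartition π A = Level.Lift (c ⊔ ℓ′) (IsPartition π A) × MATConds [] 0 π

  MATFree : List (Edge ℓ) → Set (c ⊔ ℓ′)
  MATFree A = Level.Lift (c ⊔ ℓ′) (A ≡ []) ⊎ Σ (List (List (Edge ℓ))) λ π → IsMATPartition π A

GraphicMATFree : ∀ {c ℓ′} (K : Field c ℓ′) {ℓ} → SimpleGraph ℓ → Set (c ⊔ ℓ′)
GraphicMATFree K {ℓ} G = LinAlg.MATFree K ℓ (edges G)

{-# OPTIONS --safe #-}
module Submission where

-- For a graphic arrangement, (MP1) and (MP2) say that every block is a forest whose closure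
-- contains no earlier edge, and (MP3) says that an edge of the k-th block lies in exactly k - 1
-- triangles whose other two edges are earlier.  So an MAT-partition is an edge labelling in which
-- every triangle has a unique largest label, every edge with label k (counted from 0) is the
-- largest one of exactly k triangles, and the label classes satisfy the forest condition.
--
-- Labelled graphs are strongly chordal.  By induction on k, the graph H k of the edges with label
-- below k is chordal and its cliques have at most k + 1 vertices.  If uv has label k, its k lower
-- neighbours form a clique N, and a component of H k - N has at most one vertex complete to N
-- (otherwise there is a clique with k + 2 vertices); together with the forest condition, this makes
-- every path around uv meet N.  Moreover N(ab) is contained in N(e) + e for every edge ab in N(e) + e.
-- In a sun, the edge u_i u_{i+1} of largest label on the central cycle has some u_j in N(u_i u_{i+1}), so w_i
-- is adjacent to u_j.
--
-- Conversely, a strongly chordal graph has no special cycle in its family of maximal cliques, hence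
-- a doubly lexical ordering of the vertex-clique incidence matrix is Γ-free.  Adding the vertices
-- from last to first, one labels the edges from v to its later neighbours by 0, 1, 2, ... along a
-- full flag of sets X whose largest label is |X| - 2; by Γ-freeness the cliques through v form a
-- chain, and the flag can be chosen through all of them, which keeps the induction going.

open import Defs
open import Level using (Level)
open import Function.Base using (_∘_; id; case_of_)
open import Function.Bundles using (_⇔_; mk⇔)
open import Data.Nat as ℕ using (ℕ; zero; suc; _+_; _*_; _∸_; _≤_; _<_; z≤n; s≤s)
open import Data.Nat.Properties as ℕₚ using (≤-refl; ≤-trans; ≤-antisym; <-trans; <-irrefl; <⇒≤; n≤1+n; ≤-reflexive)
open import Data.Nat.Induction using (Acc; acc; <-wellFounded)
open import Data.Nat.Tactic.RingSolver using (solve-∀)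
open import Data.Fin as Fin using (Fin; zero; suc; toℕ)
open import Data.Fin.Properties as Finₚ using (any?; all?; toℕ-injective) renaming (_≟_ to _≟ᶠ_)
open import Data.Bool as Bool using (Bool; true; false; _∧_; _∨_; not; if_then_else_)
open import Data.Unit using (⊤; tt)
open import Data.Empty using (⊥; ⊥-elim)
open import Data.Product using (Σ; ∃; _×_; _,_; proj₁; proj₂)
open import Data.Sum as Sum using (_⊎_; inj₁; inj₂)
open import Data.List using (List; []; _∷_; length; lookup; allFin; filter; map; tabulate; _++_; concat; concatMap; cartesianProduct)
import Data.List.Properties as Listₚ
open import Data.List.Membership.Propositional using (_∈_; _∉_)
open import Data.List.Membership.Propositional.Properties using (∈-lookup; ∈-allFin; ∈-filter⁺; ∈-filter⁻; ∈-∃++; ∈-++⁺ˡ; ∈-++⁺ʳ; ∈-++⁻; ∈-map⁺; ∈-map⁻; ∈-cartesianProduct⁺)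
open import Data.List.Relation.Unary.Any as Any using (here; there)
open import Data.List.Relation.Unary.Any.Properties using (lookup-index)
open import Data.List.Relation.Unary.All as All using (All; []; _∷_)
open import Data.List.Relation.Unary.AllPairs as AllPairs using (AllPairs; []; _∷_)
import Data.List.Relation.Unary.AllPairs.Properties as AllPairsₚ
open import Data.List.Relation.Unary.Unique.Propositional using (Unique)
open import Data.List.Relation.Unary.Unique.Propositional.Properties using (allFin⁺; filter⁺; map⁺; cartesianProduct⁺)
open import Data.List.Relation.Binary.Permutation.Propositional using (_↭_; ↭-refl; ↭-sym; ↭-trans; ↭⇒↭ₛ; prep; swap)
open import Data.List.Relation.Binary.Permutation.Propositional.Properties using (↭-length; ∈-resp-↭; shift; ++⁺ʳ)
import Data.List.Relation.Binary.Permutation.Setoid.Properties as Permₛ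
open import Relation.Binary.Definitions using (tri<; tri≈; tri>)
open import Relation.Binary.PropositionalEquality using (_≡_; _≢_; refl; trans; cong; cong₂; subst; subst₂; setoid) renaming (sym to ≡-sym)
open import Relation.Binary.Structures using (IsEquivalence)
open import Relation.Nullary using (¬_; Dec; yes; no; does)
open import Relation.Nullary.Decidable using (¬?; _×-dec_; _⊎-dec_; _→-dec_; dec-true; dec-false)
open import Relation.Unary using (Decidable)

-- Finite sets as Boolean predicates

-- Two-colourings carry the forest conditions because a `Bool`-valued colouring can be read in two
-- ways: it shows that two vertices lie in different components, and over every field it is a 0/1
-- vector. Constancy on a block puts the vector into the intersection of the block; a change of
-- colour along an edge keeps it off that hyperplane. Hence the field does not matter, and equality
-- of scalars never has to be decided.
--
-- Chordality is used as `ChordProperty`, with an arbitrary vertex set `S` in place of an induced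
-- cycle. In this form it can be carried through the addition of a single edge, and the walks need
-- be neither shortest nor simple.
--
-- For the converse the obstacle is to keep the counts of (MP3) exact while vertices are added. A
-- new vertex adds no lower neighbour to an old edge ab provided that, in the triangle formed with
-- it, some edge at the new vertex has a label above that of ab. This is why its labels follow a
-- flag of sets with bounded labels, and why the induction must carry that bound for all members of
-- the clique family. Since blocks are nonempty, the labels must also leave no gap.

true≢false : true ≢ false
true≢false ()

absurd-bool : ∀ {a} {A : Set a} {b : Bool} → b ≡ true → b ≡ false → A
absurd-bool {b = true} _ ()

¬true⇒false : ∀ {b} → b ≢ true → b ≡ false
¬true⇒false {true} h = ⊥-elim (h refl)
¬true⇒false {false} h = refl

∧-true⁻ : ∀ {a b} → a ∧ b ≡ true → a ≡ true × b ≡ true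
∧-true⁻ {true} {true} _ = refl , refl

∧-true⁺ : ∀ {a b} → a ≡ true → b ≡ true → a ∧ b ≡ true
∧-true⁺ refl refl = refl

∨-true⁻ : ∀ {a b} → a ∨ b ≡ true → a ≡ true ⊎ b ≡ true
∨-true⁻ {true} _ = inj₁ refl
∨-true⁻ {false} h = inj₂ h

∨-trueʳ : ∀ {a b} → b ≡ true → a ∨ b ≡ true
∨-trueʳ {true} _ = refl
∨-trueʳ {false} h = h

does⁻ : ∀ {a} {A : Set a} (d : Dec A) → does d ≡ true → A
does⁻ (yes a) _ = a

does⁺ : ∀ {a} {A : Set a} (d : Dec A) → A → does d ≡ true
does⁺ = dec-true

infix 4 _⊆_
_⊆_ : ∀ {n} → (Fin n → Bool) → (Fin n → Bool) → Set
P ⊆ Q = ∀ x → P x ≡ true → Q x ≡ true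

_⊆?_ : ∀ {n} (P Q : Fin n → Bool) → Dec (P ⊆ Q)
P ⊆? Q = all? λ x → (P x Bool.≟ true) →-dec (Q x Bool.≟ true)

⊈-witness : ∀ {n} {P Q : Fin n → Bool} → ¬ (P ⊆ Q) → ∃ λ x → P x ≡ true × Q x ≡ false
⊈-witness {n} {P} {Q} h with any? (λ x → (P x Bool.≟ true) ×-dec (Q x Bool.≟ false))
... | yes w = w
... | no ¬w = ⊥-elim (h λ x px → case Q x Bool.≟ true of λ
  { (yes q) → q ; (no q) → ⊥-elim (¬w (x , px , ¬true⇒false q)) })

bit : Bool → ℕ
bit true = 1
bit false = 0

bit≤1 : ∀ b → bit b ≤ 1
bit≤1 true = s≤s z≤n
bit≤1 false = z≤n

# : ∀ {n} → (Fin n → Bool) → ℕ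
# {zero} P = 0
# {suc n} P = bit (P zero) + # (P ∘ suc)

insert : ∀ {n} → Fin n → (Fin n → Bool) → Fin n → Bool
insert x P y = does (y ≟ᶠ x) ∨ P y

remove : ∀ {n} → Fin n → (Fin n → Bool) → Fin n → Bool
remove x P y = not (does (y ≟ᶠ x)) ∧ P y

bit-mono : ∀ {a b} → (a ≡ true → b ≡ true) → bit a ≤ bit b
bit-mono {true} h rewrite h refl = ≤-refl
bit-mono {false} h = z≤n

#-mono : ∀ {n} {P Q : Fin n → Bool} → P ⊆ Q → # P ≤ # Q
#-mono {zero} h = z≤n
#-mono {suc n} h = ℕₚ.+-mono-≤ (bit-mono (h zero)) (#-mono (h ∘ suc))

#-ext : ∀ {n} {P Q : Fin n → Bool} → P ⊆ Q → Q ⊆ P → # P ≡ # Q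
#-ext h g = ≤-antisym (#-mono h) (#-mono g)

#-empty : ∀ {n} {P : Fin n → Bool} → (∀ x → P x ≡ false) → # P ≡ 0
#-empty {zero} h = refl
#-empty {suc n} h rewrite h zero = #-empty (h ∘ suc)

#-insert : ∀ {n} (P : Fin n → Bool) x → P x ≡ false → # (insert x P) ≡ suc (# P)
#-insert P zero h rewrite h = refl
#-insert P (suc x) h =
  trans (cong (bit (P zero) +_) (#-insert (P ∘ suc) x h)) (ℕₚ.+-suc (bit (P zero)) _)

insert-self : ∀ {n} (P : Fin n → Bool) x → insert x P x ≡ true
insert-self P x rewrite dec-true (x ≟ᶠ x) refl = refl

⊆-insert : ∀ {n} (P : Fin n → Bool) x → P ⊆ insert x P
⊆-insert P x y h = ∨-trueʳ h

insert⁻ : ∀ {n} (P : Fin n → Bool) x y → insert x P y ≡ true → y ≡ x ⊎ P y ≡ true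
insert⁻ P x y h with ∨-true⁻ h
... | inj₁ e = inj₁ (does⁻ (y ≟ᶠ x) e)
... | inj₂ p = inj₂ p

insert-⊆ : ∀ {n} {P Q : Fin n → Bool} {x} → P ⊆ Q → Q x ≡ true → insert x P ⊆ Q
insert-⊆ {P = P} {x = x} h q y i with insert⁻ P x y i
... | inj₁ refl = q
... | inj₂ p = h y p

remove⁻ : ∀ {n} (P : Fin n → Bool) x y → remove x P y ≡ true → y ≢ x × P y ≡ true
remove⁻ P x y h with y ≟ᶠ x
... | no ne = ne , h

remove⁺ : ∀ {n} (P : Fin n → Bool) {x y} → y ≢ x → P y ≡ true → remove x P y ≡ true
remove⁺ P {x} {y} ne p rewrite dec-false (y ≟ᶠ x) ne = p

remove-self : ∀ {n} (P : Fin n → Bool) x → remove x P x ≡ false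
remove-self P x = ¬true⇒false λ h → proj₁ (remove⁻ P x x h) refl

#-remove : ∀ {n} (P : Fin n → Bool) x → P x ≡ true → suc (# (remove x P)) ≡ # P
#-remove P x px = trans (≡-sym (#-insert (remove x P) x (remove-self P x)))
  (#-ext (insert-⊆ (λ y h → proj₂ (remove⁻ P x y h)) px)
         (λ y py → case y ≟ᶠ x of λ { (yes refl) → insert-self (remove x P) x
                                    ; (no ne) → ⊆-insert (remove x P) x y (remove⁺ P ne py) }))

#-mono-< : ∀ {n} {P Q : Fin n → Bool} {x} → P ⊆ Q → Q x ≡ true → P x ≡ false → # P < # Q
#-mono-< {P = P} {x = x} h q p = subst (_≤ _) (#-insert P x p) (#-mono (insert-⊆ h q))

#-⊆-antisym : ∀ {n} {P Q : Fin n → Bool} → P ⊆ Q → # Q ≤ # P → Q ⊆ P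
#-⊆-antisym {P = P} h le x q with P x in eq
... | true = refl
... | false = ⊥-elim (<-irrefl refl (≤-trans (#-mono-< h q eq) le))

#-inject : ∀ {n m} {P : Fin n → Bool} {Q : Fin m → Bool} (h : Fin n → Fin m) →
  (∀ {x y} → h x ≡ h y → x ≡ y) → (∀ x → P x ≡ true → Q (h x) ≡ true) → # P ≤ # Q
#-inject {zero} h inj hq = z≤n
#-inject {suc n} {P = P} {Q} h inj hq with P zero in eq
... | false = #-inject (h ∘ suc) (λ e → Finₚ.suc-injective (inj e)) (hq ∘ suc)
... | true = subst (_ ≤_) (#-remove Q (h zero) (hq zero eq))
  (s≤s (#-inject (h ∘ suc) (λ e → Finₚ.suc-injective (inj e))
    (λ x px → remove⁺ Q (λ e → case inj e of λ ()) (hq (suc x) px))))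

argmax : ∀ {n} {P : Fin n → Set} (P? : Decidable P) (f : Fin n → ℕ) →
  (∀ x → ¬ P x) ⊎ (∃ λ x → P x × (∀ y → P y → f y ≤ f x))
argmax {zero} P? f = inj₁ λ ()
argmax {suc n} P? f with P? zero | argmax (P? ∘ suc) (f ∘ suc)
... | no ¬p | inj₁ h = inj₁ λ { zero → ¬p ; (suc x) → h x }
... | no ¬p | inj₂ (x , p , m) = inj₂ (suc x , p , λ { zero q → ⊥-elim (¬p q) ; (suc y) → m y })
... | yes p | inj₁ h = inj₂ (zero , p , λ { zero _ → ≤-refl ; (suc y) q → ⊥-elim (h y q) })
... | yes p | inj₂ (x , q , m) with ℕₚ.≤-total (f zero) (f (suc x))
... | inj₁ le = inj₂ (suc x , q , λ { zero _ → le ; (suc y) → m y })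
... | inj₂ ge = inj₂ (zero , p , λ { zero _ → ≤-refl ; (suc y) r → ≤-trans (m y r) ge })

least : ∀ {n} (P : Fin n → Bool) {w} → P w ≡ true →
  ∃ λ v → P v ≡ true × (∀ y → P y ≡ true → y ≢ v → v Fin.< y)
least {suc n} P {w} pw with P zero in eq
... | true = zero , eq , λ { zero _ ne → ⊥-elim (ne refl) ; (suc y) _ _ → s≤s z≤n }
least {suc n} P {zero} pw | false = ⊥-elim (absurd-bool pw eq)
least {suc n} P {suc w} pw | false with least (P ∘ suc) {w} pw
... | v , pv , m = suc v , pv , λ { zero p0 _ → absurd-bool p0 eq
                                  ; (suc y) py ne → s≤s (m y py (ne ∘ cong suc)) }

-- Walks and chordality

data Walk {V : Set} (E : V → V → Set) (S : V → Set) : V → V → Set where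
  here : ∀ {a} → S a → Walk E S a a
  step : ∀ {a b c} → S a → E a b → Walk E S b c → Walk E S a c

-- Every edge of a cycle lies in a triangle whose third vertex is on the cycle.
ChordProperty : {V : Set} (E : V → V → Set) → Set₁
ChordProperty {V} E = ∀ {u v} (S : V → Set) → ¬ S u → ¬ S v → E u v →
  ∀ {a b} → E u a → Walk E S a b → E b v → ∃ λ z → S z × E z u × E z v

module _ {V : Set} where
  walk-map : ∀ {E F : V → V → Set} {S T : V → Set} → (∀ {a b} → E a b → F a b) →
    (∀ {a} → S a → T a) → ∀ {a b} → Walk E S a b → Walk F T a b
  walk-map f g (here s) = here (g s)
  walk-map f g (step s e w) = step (g s) (f e) (walk-map f g w)

  walk-snoc : ∀ {E : V → V → Set} {S : V → Set} {a b c} → Walk E S a b → E b c → S c → Walk E S a c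
  walk-snoc (here s) e t = step s e (here t)
  walk-snoc (step s f w) e t = step s f (walk-snoc w e t)

  walk-++ : ∀ {E : V → V → Set} {S : V → Set} {a b c} → Walk E S a b → Walk E S b c → Walk E S a c
  walk-++ (here _) w = w
  walk-++ (step s e v) w = step s e (walk-++ v w)

  walk-start : ∀ {E : V → V → Set} {S : V → Set} {a b} → Walk E S a b → S a
  walk-start (here s) = s
  walk-start (step s _ _) = s

  walk-end : ∀ {E : V → V → Set} {S : V → Set} {a b} → Walk E S a b → S b
  walk-end (here s) = s
  walk-end (step _ _ w) = walk-end w

  walk-rev : ∀ {E : V → V → Set} {S : V → Set} → (∀ {a b} → E a b → E b a) →
    ∀ {a b} → Walk E S a b → Walk E S b a
  walk-rev sy (here s) = here s
  walk-rev sy (step s e w) = walk-snoc (walk-rev sy w) (sy e) s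

  segment-walk : ∀ {E : V → V → Set} {S : V → Set} (p : ℕ → V) a d →
    (∀ t → a ≤ t → t < d + a → E (p t) (p (suc t))) →
    (∀ t → a ≤ t → t ≤ d + a → S (p t)) → Walk E S (p a) (p (d + a))
  segment-walk p a zero he hs = here (hs a ≤-refl ≤-refl)
  segment-walk p a (suc d) he hs = walk-snoc
    (segment-walk p a d (λ t l g → he t l (≤-trans g (n≤1+n _))) (λ t l g → hs t l (≤-trans g (n≤1+n _))))
    (he (d + a) (ℕₚ.m≤n+m a d) ≤-refl) (hs (suc d + a) (ℕₚ.m≤n+m a (suc d)) ≤-refl)

  -- With `S` the set {c, d}, the third vertex of the triangle over ab is c or d, and the edge from
  -- it to the opposite end is a diagonal.
  four-cycle : ∀ {E : V → V → Set} → ChordProperty E → (∀ {a b} → E a b → E b a) →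
    (∀ {a} → ¬ E a a) → ∀ {a b c d} → a ≢ c → b ≢ d →
    E a b → E b c → E c d → E d a → E a c ⊎ E b d
  four-cycle {E} ch sy irr {a} {b} {c} {d} ac bd ab bc cd da
    with ch {a} {b} (λ z → z ≡ c ⊎ z ≡ d)
         (λ { (inj₁ e) → ac e ; (inj₂ refl) → irr da })
         (λ { (inj₁ refl) → irr bc ; (inj₂ e) → bd e })
         ab (sy da) (step (inj₂ refl) (sy cd) (here (inj₁ refl))) (sy bc)
  ... | z , inj₁ refl , za , zb = inj₁ (sy za)
  ... | z , inj₂ refl , za , zb = inj₂ (sy zb)

-- The cyclic successor

-- Cycles are handled as sequences indexed by ℕ, so that arcs can be cut and shifted; only arguments
-- up to m matter.
clamp : ∀ m → ℕ → Fin (suc m)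
clamp m zero = zero
clamp zero (suc t) = zero
clamp (suc m) (suc t) = suc (clamp m t)

toℕ-clamp : ∀ {m t} → t ≤ m → toℕ (clamp m t) ≡ t
toℕ-clamp {m} {zero} _ = refl
toℕ-clamp {suc m} {suc t} (s≤s le) = cong suc (toℕ-clamp le)

clamp-toℕ : ∀ {m} (i : Fin (suc m)) → clamp m (toℕ i) ≡ i
clamp-toℕ i = toℕ-injective (toℕ-clamp (ℕ.s≤s⁻¹ (Finₚ.toℕ<n i)))

csuc-spec : ∀ {m} (i : Fin (suc m)) →
  (toℕ i < m × toℕ (csuc i) ≡ suc (toℕ i)) ⊎ (toℕ i ≡ m × csuc i ≡ zero)
csuc-spec {m} i with toℕ i ℕ.<? m
... | yes p = inj₁ (p , cong suc (Finₚ.toℕ-fromℕ< p))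
... | no ¬p = inj₂ (≤-antisym (ℕ.s≤s⁻¹ (Finₚ.toℕ<n i)) (ℕₚ.≮⇒≥ ¬p) , refl)

csuc-clamp : ∀ {m t} → t < m → csuc (clamp m t) ≡ clamp m (suc t)
csuc-clamp {m} {t} lt with csuc-spec (clamp m t)
... | inj₁ (_ , e) = toℕ-injective (trans e (trans (cong suc (toℕ-clamp (<⇒≤ lt))) (≡-sym (toℕ-clamp lt))))
... | inj₂ (e , _) = ⊥-elim (<-irrefl (trans (≡-sym (toℕ-clamp (<⇒≤ lt))) e) lt)

csuc-clamp-last : ∀ m → csuc (clamp m m) ≡ zero
csuc-clamp-last m with csuc-spec (clamp m m)
... | inj₁ (l , _) = ⊥-elim (<-irrefl (toℕ-clamp ≤-refl) l)
... | inj₂ (_ , e) = e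

csuc-injective : ∀ {n} {i j : Fin n} → csuc i ≡ csuc j → i ≡ j
csuc-injective {suc m} {i} {j} e with csuc-spec i | csuc-spec j
... | inj₁ (_ , a) | inj₁ (_ , b) = toℕ-injective (ℕₚ.suc-injective (trans (≡-sym a) (trans (cong toℕ e) b)))
... | inj₁ (_ , a) | inj₂ (_ , b) = case trans (≡-sym a) (cong toℕ (trans e b)) of λ ()
... | inj₂ (_ , a) | inj₁ (_ , b) = case trans (≡-sym b) (cong toℕ (trans (≡-sym e) a)) of λ ()
... | inj₂ (a , _) | inj₂ (b , _) = toℕ-injective (trans a (≡-sym b))

csuc-fixfree : ∀ {n} → 1 < n → (i : Fin n) → csuc i ≢ i
csuc-fixfree {suc m} (s≤s l) i e with csuc-spec i
... | inj₁ (_ , a) = ℕₚ.1+n≢n (trans (≡-sym a) (cong toℕ e))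
... | inj₂ (a , b) = <-irrefl (trans (cong toℕ (trans (≡-sym b) e)) a) l

csuc²-fixfree : ∀ {n} → 2 < n → (i : Fin n) → csuc (csuc i) ≢ i
csuc²-fixfree {suc m} (s≤s l) i e with csuc-spec i | csuc-spec (csuc i)
... | inj₁ (_ , a) | inj₁ (_ , b) = ℕₚ.m≢1+n+m (toℕ i) {1} (trans (cong toℕ (≡-sym e)) (trans b (cong suc a)))
... | inj₁ (_ , a) | inj₂ (b , c) = <-irrefl (trans (≡-sym (trans a (cong suc (cong toℕ (trans (≡-sym e) c))))) b) l
... | inj₂ (a , b) | inj₁ (_ , c) = <-irrefl (trans (≡-sym (trans c (cong suc (cong toℕ b)))) (trans (cong toℕ e) a)) l
... | inj₂ (a , b) | inj₂ (c , _) = case trans (≡-sym c) (cong toℕ b) of λ { refl → case l of λ () }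

-- One full turn: from the successor of i up to the last index, across the wrap to `zero`, and up
-- again to i. The step is never taken at i, so the turn can end there.
cyclic-induction : ∀ {m} (i : Fin (suc m)) (P : Fin (suc m) → Set) → P (csuc i) →
  (∀ j → j ≢ i → P j → P (csuc j)) → P i
cyclic-induction {m} i P base stp = result
  where
  ascend : ∀ a d → d + a ≤ m → (∀ s → a ≤ s → s < d + a → s ≢ toℕ i) → P (clamp m a) → P (clamp m (d + a))
  ascend a zero _ _ p = p
  ascend a (suc d) le ne p = subst P (csuc-clamp le) (stp (clamp m (d + a))
    (λ e → ne (d + a) (ℕₚ.m≤n+m a d) ≤-refl (trans (≡-sym (toℕ-clamp (<⇒≤ le))) (cong toℕ e)))
    (ascend a d (<⇒≤ le) (λ s l g → ne s l (≤-trans g (n≤1+n _))) p))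
  from-zero : P zero → P i
  from-zero p = subst P (trans (cong (clamp m) (ℕₚ.+-identityʳ _)) (clamp-toℕ i))
    (ascend 0 (toℕ i) (subst (_≤ m) (≡-sym (ℕₚ.+-identityʳ _)) (ℕ.s≤s⁻¹ (Finₚ.toℕ<n i)))
      (λ s _ lt e → <-irrefl e (subst (s <_) (ℕₚ.+-identityʳ _) lt)) p)
  result : P i
  result with csuc-spec i
  ... | inj₂ (_ , e) = from-zero (subst P e base)
  ... | inj₁ (lt , e) = from-zero (subst P (csuc-clamp-last m) (stp (clamp m m)
    (λ e′ → <-irrefl (trans (cong toℕ (≡-sym e′)) (toℕ-clamp ≤-refl)) lt)
    (subst (P ∘ clamp m) (ℕₚ.m∸n+n≡m lt) (ascend (suc (toℕ i)) (m ∸ suc (toℕ i))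
      (≤-reflexive (ℕₚ.m∸n+n≡m lt)) (λ s l _ e′ → <-irrefl (≡-sym e′) l)
      (subst P (trans (≡-sym (clamp-toℕ (csuc i))) (cong (clamp m) e)) base)))))

-- Induced cycles and the chord property

EdgeRel : ∀ {ℓ} → SimpleGraph ℓ → Fin ℓ → Fin ℓ → Set
EdgeRel G a b = Adj G a b ≡ true

edge-sym : ∀ {ℓ} (G : SimpleGraph ℓ) {a b} → EdgeRel G a b → EdgeRel G b a
edge-sym G {a} {b} e = trans (sym G b a) e

edge-irrefl : ∀ {ℓ} (G : SimpleGraph ℓ) {a} → ¬ EdgeRel G a a
edge-irrefl G {a} e = absurd-bool e (irrefl G a)

edge-≢ : ∀ {ℓ} (G : SimpleGraph ℓ) {a b} → EdgeRel G a b → a ≢ b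
edge-≢ G e refl = edge-irrefl G e

clamp-injective : ∀ {m s t} → s ≤ m → t ≤ m → clamp m s ≡ clamp m t → s ≡ t
clamp-injective ls lt e = trans (≡-sym (toℕ-clamp ls)) (trans (cong toℕ e) (toℕ-clamp lt))

-- The closing edge plays uv and the remaining vertices form `S`. A vertex of `S` adjacent to both
-- ends would be the second vertex and the last but one at once, which leaves only a triangle.
chordProperty⇒chordal : ∀ {ℓ} (G : SimpleGraph ℓ) → ChordProperty (EdgeRel G) → Chordal G
chordProperty⇒chordal G ch (suc m) (s≤s m≥3) (c , inj , iff) =
  conclude (ch {p 0} {p m} S (notS 0 (inj₁ refl)) (notS m (inj₂ refl)) closing
    (stp 0 m≥1) (subst (λ t → Walk (EdgeRel G) S (p 1) (p t)) (ℕₚ.m∸n+n≡m m-1≥1)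
      (segment-walk p 1 (m ∸ 1 ∸ 1) (λ t _ l → stp t (≤-trans l (≤-trans (≤-reflexive (ℕₚ.m∸n+n≡m m-1≥1)) (ℕₚ.m∸n≤m m 1))))
        (λ t l g → t , l , ≤-trans (s≤s (≤-trans g (≤-reflexive (ℕₚ.m∸n+n≡m m-1≥1)))) (≤-reflexive sm) , refl)))
    (subst (λ t → EdgeRel G (p (m ∸ 1)) (p t)) sm (stp (m ∸ 1) (≤-reflexive sm))))
  where
  m≥1 : 1 ≤ m
  m≥1 = ≤-trans (s≤s z≤n) m≥3
  m-1≥1 : 1 ≤ m ∸ 1
  m-1≥1 = ≤-trans (s≤s z≤n) (ℕₚ.∸-monoˡ-≤ 1 m≥3)
  sm : suc (m ∸ 1) ≡ m
  sm = trans (ℕₚ.+-comm 1 (m ∸ 1)) (ℕₚ.m∸n+n≡m m≥1)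
  p : ℕ → _
  p t = c (clamp m t)
  S : _ → Set
  S z = ∃ λ t → 1 ≤ t × t < m × z ≡ p t
  notS : ∀ s → s ≡ 0 ⊎ s ≡ m → ¬ S (p s)
  notS s (inj₁ refl) (t , l , g , e) = <-irrefl (clamp-injective z≤n (<⇒≤ g) (inj e)) l
  notS s (inj₂ refl) (t , l , g , e) = <-irrefl (≡-sym (clamp-injective ≤-refl (<⇒≤ g) (inj e))) g
  stp : ∀ t → t < m → EdgeRel G (p t) (p (suc t))
  stp t l = proj₂ (iff (clamp m t) (clamp m (suc t))) (inj₁ (≡-sym (csuc-clamp l)))
  closing : EdgeRel G (p 0) (p m)
  closing = proj₂ (iff zero (clamp m m)) (inj₂ (≡-sym (csuc-clamp-last m)))
  conclude : (∃ λ z → S z × EdgeRel G z (p 0) × EdgeRel G z (p m)) → ⊥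
  conclude (_ , (t , l , g , refl) , e0 , em) =
    <-irrefl (trans (cong suc (≡-sym t≡1)) sucst) m≥3
    where
    t≡1 : t ≡ 1
    t≡1 with proj₁ (iff (clamp m t) zero) e0
    ... | inj₁ e = case clamp-injective z≤n g (trans e (csuc-clamp g)) of λ ()
    ... | inj₂ e = clamp-injective (<⇒≤ g) m≥1 (trans e (csuc-clamp {t = 0} m≥1))
    sucst : suc t ≡ m
    sucst with proj₁ (iff (clamp m t) (clamp m m)) em
    ... | inj₁ e = ≡-sym (clamp-injective ≤-refl g (trans e (csuc-clamp g)))
    ... | inj₂ e = ⊥-elim (<-irrefl (≡-sym (clamp-injective (<⇒≤ g) z≤n (trans e (csuc-clamp-last m)))) l)

walk-positions : ∀ {V : Set} {E : V → V → Set} {S : V → Set} {a b} → Walk E S a b →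
  ∃ λ d → Σ (ℕ → V) λ p → p 0 ≡ a × p d ≡ b × (∀ t → t < d → E (p t) (p (suc t))) × (∀ t → t ≤ d → S (p t))
walk-positions {a = a} (here s) = 0 , (λ _ → a) , refl , refl , (λ t ()) , (λ t _ → s)
walk-positions {V} {E} {S} {a} (step {b = b} s e w) with walk-positions w
... | d , p , p0 , pd , pe , ps = suc d , p′ , refl , pd , pe′ , ps′
  where
  p′ : ℕ → V
  p′ zero = a
  p′ (suc t) = p t
  pe′ : ∀ t → t < suc d → E (p′ t) (p′ (suc t))
  pe′ zero _ = subst (E a) (≡-sym p0) e
  pe′ (suc t) (s≤s l) = pe t l
  ps′ : ∀ t → t ≤ suc d → S (p′ t)
  ps′ zero _ = s
  ps′ (suc t) (s≤s l) = ps t l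

module Shortcut {V : Set} (p : ℕ → V) (i d : ℕ) where
  q : ℕ → V
  q t = if does (t ℕ.≤? i) then p t else p (t + d)
  low : ∀ {t} → t ≤ i → q t ≡ p t
  low {t} l rewrite dec-true (t ℕ.≤? i) l = refl
  high : ∀ {t} → i < t → q t ≡ p (t + d)
  high {t} l rewrite dec-false (t ℕ.≤? i) (ℕₚ.<⇒≱ l) = refl

  steps : ∀ {E : V → V → Set} {m} → (∀ t → t < m + d → E (p t) (p (suc t))) →
    E (p i) (p (suc i + d)) → ∀ t → t < m → E (q t) (q (suc t))
  steps {E} {m} pe ch t l with ℕₚ.<-cmp t i
  ... | tri< a _ _ = subst₂ E (≡-sym (low (<⇒≤ a))) (≡-sym (low a)) (pe t (ℕₚ.m≤n⇒m≤n+o d l))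
  ... | tri≈ _ refl _ = subst₂ E (≡-sym (low ≤-refl)) (≡-sym (high ≤-refl)) ch
  ... | tri> _ _ b = subst₂ E (≡-sym (high b)) (≡-sym (high (≤-trans b (n≤1+n t))))
    (pe (t + d) (ℕₚ.+-monoˡ-≤ d l))

-- A shortest counterexample to the chord property is an induced cycle.
chordal⇒chordProperty : ∀ {ℓ} (G : SimpleGraph ℓ) → Chordal G → ChordProperty (EdgeRel G)
chordal⇒chordProperty {ℓ} G chordal {u} {v} S ¬Su ¬Sv uv {a} {b} ua w bv with walk-positions w
... | d , p , p0 , pd , pe , ps =
  let (z , Sz , zu , zv) = search (suc (suc d)) (<-wellFounded _) P (s≤s (s≤s z≤n)) ¬Su
        (subst (λ x → ¬ S x) (≡-sym Pend) ¬Sv) Pe (subst (EdgeRel G u) (≡-sym Pend) uv) Ps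
  in z , Sz , zu , subst (EdgeRel G z) Pend zv
  where
  P : ℕ → Fin ℓ
  P zero = u
  P (suc t) = if does (t ℕ.≤? d) then p t else v
  Plow : ∀ {t} → t ≤ d → P (suc t) ≡ p t
  Plow {t} l rewrite dec-true (t ℕ.≤? d) l = refl
  Pend : P (suc (suc d)) ≡ v
  Pend rewrite dec-false (suc d ℕ.≤? d) (ℕₚ.<⇒≱ ≤-refl) = refl
  Pe : ∀ t → t < suc (suc d) → EdgeRel G (P t) (P (suc t))
  Pe zero _ = subst (EdgeRel G u) (≡-sym (trans (Plow z≤n) p0)) ua
  Pe (suc t) (s≤s (s≤s l)) with ℕₚ.m≤n⇒m<n∨m≡n l
  ... | inj₁ lt = subst₂ (EdgeRel G) (≡-sym (Plow l)) (≡-sym (Plow lt)) (pe t lt)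
  ... | inj₂ refl = subst₂ (EdgeRel G) (≡-sym (trans (Plow l) pd)) (≡-sym Pend) bv
  Ps : ∀ t → 0 < t → t < suc (suc d) → S (P t)
  Ps (suc t) _ (s≤s (s≤s l)) = subst S (≡-sym (Plow l)) (ps t l)

  -- Three outcomes: an inner vertex adjacent to both ends is the wanted one; a chord other than the
  -- closing edge gives a shorter sequence with the same ends; otherwise the sequence is an induced
  -- cycle with at least four vertices.
  search : ∀ m → Acc _<_ m → (q : ℕ → Fin ℓ) → 2 ≤ m → ¬ S (q 0) → ¬ S (q m) →
    (∀ t → t < m → EdgeRel G (q t) (q (suc t))) → EdgeRel G (q 0) (q m) →
    (∀ t → 0 < t → t < m → S (q t)) → ∃ λ z → S z × EdgeRel G z (q 0) × EdgeRel G z (q m)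
  search m (acc rs) q m≥2 ¬S0 ¬Sm qe qc qs
    with ℕₚ.anyUpTo? (λ t → (0 ℕ.<? t) ×-dec ((Adj G (q t) (q 0) Bool.≟ true) ×-dec (Adj G (q t) (q m) Bool.≟ true))) m
  ... | yes (t , t<m , 0<t , e0 , em) = q t , qs t 0<t t<m , e0 , em
  ... | no none with ℕₚ.anyUpTo? (λ i → ℕₚ.anyUpTo? (λ j → (suc i ℕ.<? j) ×-dec
      (¬? ((i ℕ.≟ 0) ×-dec (j ℕ.≟ m)) ×-dec (Adj G (q i) (q j) Bool.≟ true))) (suc m)) (suc m)
  ... | yes (i , _ , j , s≤s j≤m , i+1<j , ¬whole , ij) =
    let (z , Sz , z0 , zm) = search m′ (rs m′<m) SC.q m′≥2 (subst (λ x → ¬ S x) (≡-sym q0) ¬S0)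
          (subst (λ x → ¬ S x) (≡-sym qm) ¬Sm)
          (SC.steps {E = EdgeRel G} (λ t l → qe t (subst (t <_) m′+d l)) (subst (EdgeRel G (q i) ∘ q) (≡-sym j≡) ij))
          (subst₂ (EdgeRel G) (≡-sym q0) (≡-sym qm) qc) inner
    in z , Sz , subst (EdgeRel G z) q0 z0 , subst (EdgeRel G z) qm zm
    where
    δ = j ∸ suc i
    m′ = m ∸ δ
    module SC = Shortcut q i δ
    j≡ : suc i + δ ≡ j
    j≡ = ℕₚ.m+[n∸m]≡n (<⇒≤ i+1<j)
    δ≤m : δ ≤ m
    δ≤m = ≤-trans (ℕₚ.m∸n≤m j (suc i)) j≤m
    m′+d : m′ + δ ≡ m
    m′+d = ℕₚ.m∸n+n≡m δ≤m
    δ>0 : 0 < δ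
    δ>0 = ℕₚ.m<n⇒0<n∸m i+1<j
    m′<m : m′ < m
    m′<m = subst (m′ <_) m′+d (subst (_≤ m′ + δ) (ℕₚ.+-comm m′ 1) (ℕₚ.+-monoʳ-≤ m′ δ>0))
    i<m′ : i < m′
    i<m′ = ℕₚ.+-cancelʳ-≤ δ (suc i) m′ (subst₂ _≤_ (≡-sym j≡) (≡-sym m′+d) j≤m)
    -- If the shortcut left a single edge, the chord would have joined the two ends, which `¬whole`
    -- excludes.
    m′≥2 : 2 ≤ m′
    m′≥2 with m′ ℕ.<? 2
    ... | no ge = ℕₚ.≮⇒≥ ge
    ... | yes (s≤s le) = ⊥-elim (¬whole (i≡0 , trans (≡-sym j≡) (trans (cong (_+ δ) (trans (cong suc i≡0) (≡-sym m′≡1))) m′+d)))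
      where
      i≡0 : i ≡ 0
      i≡0 = ℕₚ.n≤0⇒n≡0 (ℕ.s≤s⁻¹ (≤-trans i<m′ le))
      m′≡1 : m′ ≡ 1
      m′≡1 = ≤-antisym le (≤-trans (s≤s z≤n) i<m′)
    q0 : SC.q 0 ≡ q 0
    q0 = SC.low z≤n
    qm : SC.q m′ ≡ q m
    qm = trans (SC.high i<m′) (cong q m′+d)
    inner : ∀ t → 0 < t → t < m′ → S (SC.q t)
    inner t 0<t t<m′ with t ℕ.≤? i
    ... | yes l = subst S (≡-sym (SC.low l)) (qs t 0<t (<-trans t<m′ m′<m))
    ... | no ¬l = subst S (≡-sym (SC.high (ℕₚ.≰⇒> ¬l)))
      (qs (t + δ) (ℕₚ.m≤n⇒m≤n+o δ 0<t) (subst (t + δ <_) m′+d (ℕₚ.+-monoˡ-≤ δ t<m′)))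
  ... | no chordless = ⊥-elim (chordal (suc m) (s≤s m≥3) (q ∘ toℕ , (λ {x} {y} → inj x y) , λ x y → to x y , from x y))
    where
    m≥3 : 3 ≤ m
    m≥3 with ℕₚ.m≤n⇒m<n∨m≡n m≥2
    ... | inj₁ l = l
    ... | inj₂ refl = ⊥-elim (none (1 , s≤s (s≤s z≤n) , s≤s z≤n , edge-sym G (qe 0 (s≤s z≤n)) , qe 1 (s≤s (s≤s z≤n))))
    chord : ∀ {i j} → i ≤ m → j ≤ m → suc i < j → EdgeRel G (q i) (q j) → i ≡ 0 × j ≡ m
    chord {i} {j} li lj l e with (i ℕ.≟ 0) ×-dec (j ℕ.≟ m)
    ... | yes h = h
    ... | no h = ⊥-elim (chordless (i , s≤s li , j , s≤s lj , l , h , e))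
    -- The walk may repeat vertices, so injectivity has to come from chordlessness: for j < m, q i =
    -- q j makes q i adjacent to q (j + 1). This is a chord unless i = 0 and j + 1 = m, and then q 0
    -- would lie in `S`.
    distinct : ∀ {i j} → i < j → j ≤ m → q i ≢ q j
    distinct {i} {j} i<j j≤m e with ℕₚ.m≤n⇒m<n∨m≡n j≤m
    ... | inj₂ refl with i
    ...   | zero = edge-≢ G qc e
    ...   | suc i′ = ¬Sm (subst S e (qs (suc i′) (s≤s z≤n) i<j))
    distinct {i} {j} i<j j≤m e | inj₁ j<m with
      chord (<⇒≤ (≤-trans i<j j≤m)) j<m (s≤s i<j) (subst (λ x → EdgeRel G x (q (suc j))) (≡-sym e) (qe j j<m))
    ... | refl , _ = ¬S0 (subst S (≡-sym e) (qs j i<j j<m))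
    bound : (x : Fin (suc m)) → toℕ x ≤ m
    bound x = ℕ.s≤s⁻¹ (Finₚ.toℕ<n x)
    inj : ∀ x y → q (toℕ x) ≡ q (toℕ y) → x ≡ y
    inj x y e with ℕₚ.<-cmp (toℕ x) (toℕ y)
    ... | tri< l _ _ = ⊥-elim (distinct l (bound y) e)
    ... | tri≈ _ h _ = toℕ-injective h
    ... | tri> _ _ l = ⊥-elim (distinct l (bound x) (≡-sym e))
    to< : ∀ (x y : Fin (suc m)) → toℕ x < toℕ y → EdgeRel G (q (toℕ x)) (q (toℕ y)) → CycAdj x y
    to< x y l e with ℕₚ.m≤n⇒m<n∨m≡n l | csuc-spec x | csuc-spec y
    ... | inj₂ eq | inj₁ (_ , s) | _ = inj₁ (toℕ-injective (trans (≡-sym eq) (≡-sym s)))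
    ... | inj₂ eq | inj₂ (s , _) | _ = ⊥-elim (<-irrefl s (≤-trans l (bound y)))
    ... | inj₁ lt | _ | cy with chord (bound x) (bound y) lt e | cy
    ...   | _ , ym | inj₁ (y<m , _) = ⊥-elim (<-irrefl ym y<m)
    ...   | x0 , _ | inj₂ (_ , s) = inj₂ (trans (toℕ-injective x0) (≡-sym s))
    cyc-sym : ∀ {x y : Fin (suc m)} → CycAdj x y → CycAdj y x
    cyc-sym (inj₁ e) = inj₂ e
    cyc-sym (inj₂ e) = inj₁ e
    to : ∀ x y → EdgeRel G (q (toℕ x)) (q (toℕ y)) → CycAdj x y
    to x y e with ℕₚ.<-cmp (toℕ x) (toℕ y)
    ... | tri< l _ _ = to< x y l e
    ... | tri≈ _ h _ = ⊥-elim (edge-≢ G e (cong q h))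
    ... | tri> _ _ l = cyc-sym (to< y x l (edge-sym G e))
    succ-edge : ∀ x → EdgeRel G (q (toℕ x)) (q (toℕ (csuc x)))
    succ-edge x with csuc-spec x
    ... | inj₁ (l , e) = subst (EdgeRel G (q (toℕ x)) ∘ q) (≡-sym e) (qe (toℕ x) l)
    ... | inj₂ (e , z) = subst₂ (λ s t → EdgeRel G (q s) (q t)) (≡-sym e) (≡-sym (cong toℕ z)) (edge-sym G qc)
    from : ∀ x y → CycAdj x y → EdgeRel G (q (toℕ x)) (q (toℕ y))
    from x y (inj₁ refl) = succ-edge x
    from x y (inj₂ refl) = edge-sym G (succ-edge y)

-- Edge labellings that encode MAT-partitions

module _ {ℓ : ℕ} (G : SimpleGraph ℓ) (lab : Fin ℓ → Fin ℓ → ℕ) where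

  -- For H = ab, the number of these vertices is |A_{k-1}| - |(A_{k-1} ∪ {H})^H| in (MP3).
  lower : Fin ℓ → Fin ℓ → Fin ℓ → Bool
  lower a b w = Adj G a w ∧ (Adj G b w ∧ (does (lab a w ℕ.<? lab a b) ∧ does (lab b w ℕ.<? lab a b)))

  lower⁻ : ∀ {a b w} → lower a b w ≡ true →
    EdgeRel G a w × EdgeRel G b w × lab a w < lab a b × lab b w < lab a b
  lower⁻ {a} {b} {w} h =
    let (p , h₁) = ∧-true⁻ {Adj G a w} h
        (q , h₂) = ∧-true⁻ {Adj G b w} h₁
        (r , s) = ∧-true⁻ {does (lab a w ℕ.<? lab a b)} h₂
    in p , q , does⁻ (lab a w ℕ.<? lab a b) r , does⁻ (lab b w ℕ.<? lab a b) s

  lower⁺ : ∀ {a b w} → EdgeRel G a w → EdgeRel G b w → lab a w < lab a b → lab b w < lab a b →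
    lower a b w ≡ true
  lower⁺ {a} {b} {w} p q r s = ∧-true⁺ p (∧-true⁺ q (∧-true⁺ (does⁺ (lab a w ℕ.<? lab a b) r) (does⁺ (lab b w ℕ.<? lab a b) s)))

  lower-sym : (∀ a b → lab a b ≡ lab b a) → ∀ a b → lower a b ⊆ lower b a
  lower-sym ls a b w h with lower⁻ h
  ... | aw , bw , l , l′ = lower⁺ bw aw (subst (lab b w <_) (ls a b) l′) (subst (lab a w <_) (ls a b) l)

-- The blocks of an MAT-partition are the label classes.  `separate` and `acyclic` express,
-- through two-colourings, that a class is a forest whose closure meets no smaller class.
record MATLabelling {ℓ : ℕ} (G : SimpleGraph ℓ) : Set where
  field
    lab : Fin ℓ → Fin ℓ → ℕ
    lab-sym : ∀ a b → lab a b ≡ lab b a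
    count : ∀ {a b} → EdgeRel G a b → # (lower G lab a b) ≡ lab a b
    separate : ∀ {c d a b} → EdgeRel G c d → EdgeRel G a b → lab a b < lab c d →
      Σ (Fin ℓ → Bool) λ f → (∀ x y → EdgeRel G x y → lab x y ≡ lab c d → f x ≡ f y) × f a ≢ f b
    acyclic : ∀ {a b} → EdgeRel G a b →
      Σ (Fin ℓ → Bool) λ f → (∀ x y → EdgeRel G x y → lab x y ≡ lab a b →
        ¬ (x ≡ a × y ≡ b) → ¬ (x ≡ b × y ≡ a) → f x ≡ f y) × f a ≢ f b

bounded : ∀ {n} (f : Fin n → ℕ) → ∃ λ K → ∀ x → f x < K
bounded {zero} f = 0 , λ ()
bounded {suc n} f with bounded (f ∘ suc)
... | K , h = suc (f zero) ℕ.⊔ K , λ { zero → ℕₚ.m≤m⊔n (suc (f zero)) K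
                                      ; (suc x) → ≤-trans (h x) (ℕₚ.m≤n⊔m (suc (f zero)) K) }

∅ : ∀ {n} → Fin n → Bool
∅ _ = false

#-insert-≤ : ∀ {n} (P : Fin n → Bool) x → # (insert x P) ≤ suc (# P)
#-insert-≤ P x with P x in eq
... | false = ≤-reflexive (#-insert P x eq)
... | true = ≤-trans (#-mono {P = insert x P} {Q = P} (insert-⊆ {P = P} (λ _ h → h) eq)) (n≤1+n _)

-- Adding an edge to a chordal graph

chordProperty-resp : ∀ {V : Set} {X Y : V → V → Set} → (∀ {a b} → X a b → Y a b) →
  (∀ {a b} → Y a b → X a b) → ChordProperty X → ChordProperty Y
chordProperty-resp f g ch S su sv uv ua w bv with ch S su sv (g uv) (g ua) (walk-map g id w) (g bv)
... | z , sz , zu , zv = z , sz , f zu , f zv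

module AddEdge {V : Set} (X : V → V → Set) (X-sym : ∀ {a b} → X a b → X b a) (x y : V) where
  X⁺ : V → V → Set
  X⁺ a b = X a b ⊎ ((a ≡ x × b ≡ y) ⊎ (a ≡ y × b ≡ x))

  decompose : ∀ {S a b} → Walk X⁺ S a b →
    Walk X S a b ⊎ ((Walk X S a x × Walk X S y b) ⊎ (Walk X S a y × Walk X S x b))
  decompose (here s) = inj₁ (here s)
  decompose (step s (inj₁ e) w) with decompose w
  ... | inj₁ v = inj₁ (step s e v)
  ... | inj₂ (inj₁ (v , v′)) = inj₂ (inj₁ (step s e v , v′))
  ... | inj₂ (inj₂ (v , v′)) = inj₂ (inj₂ (step s e v , v′))
  decompose (step s (inj₂ (inj₁ (refl , refl))) w) with decompose w
  ... | inj₁ v = inj₂ (inj₁ (here s , v))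
  ... | inj₂ (inj₁ (_ , v)) = inj₂ (inj₁ (here s , v))
  ... | inj₂ (inj₂ (_ , v)) = inj₁ v
  decompose (step s (inj₂ (inj₂ (refl , refl))) w) with decompose w
  ... | inj₁ v = inj₂ (inj₂ (here s , v))
  ... | inj₂ (inj₂ (_ , v)) = inj₂ (inj₂ (here s , v))
  ... | inj₂ (inj₁ (_ , v)) = inj₁ v

  -- The new edge may be uv itself, the first or last edge of the cycle, or an edge inside the walk.
  -- In each case the rest of the cycle is an old walk between x and y, so the second hypothesis
  -- yields z adjacent to both. If uv is new, z is the answer. Otherwise the detour through z
  -- restores an old cycle, except where z is an end of uv; then the cycle shortens or its vertex on
  -- the new edge is the answer.
  chordProperty⁺ : ChordProperty X →
    (∀ (S : V → Set) → Walk X S x y → ∃ λ z → S z × X z x × X z y) → x ≢ y → (∀ {a} → ¬ X a a) → ChordProperty X⁺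
  chordProperty⁺ ch star x≢y irr {u} {v} S ¬Su ¬Sv uv {a} {b} ua w bv = main uv ua (decompose w) bv
    where
    Goal : Set
    Goal = ∃ λ z → S z × X⁺ z u × X⁺ z v
    -- The rest of the cycle runs through u and v, so the hypothesis on x and y is applied to a set
    -- that contains them.
    S′ : V → Set
    S′ z = S z ⊎ (z ≡ u ⊎ z ≡ v)
    lift : ∀ {a b} → Walk X S a b → Walk X S′ a b
    lift = walk-map id inj₁
    old : X u v → ∀ {a b} → X u a → Walk X S a b → X b v → Goal
    old e ua w bv with ch S ¬Su ¬Sv e ua w bv
    ... | z , sz , zu , zv = z , sz , inj₁ zu , inj₁ zv
    star′ : ∀ {S} → Walk X S y x → ∃ λ z → S z × X z y × X z x
    star′ w with star _ (walk-rev X-sym w)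
    ... | z , sz , zx , zy = z , sz , zy , zx
    around : X u v → ∀ {p q a b} → X u a → Walk X S a p → Walk X S q b → X b v →
      (∃ λ z → S′ z × X z p × X z q) → Goal
    around e ua w w′ bv (z , inj₁ sz , zp , zq) = old e ua (walk-++ w (step (walk-end w) (X-sym zp) (step sz zq w′))) bv
    around e ua w w′ bv (z , inj₂ (inj₁ refl) , zp , zq) = old e zq w′ bv
    around e ua w w′ bv (z , inj₂ (inj₂ refl) , zp , zq) = old e ua w (X-sym zp)
    back : X u v → ∀ {p q a b} → X u a → Walk X S a p → Walk X S q b → X b v → Walk X S′ q p
    back e ua w w′ bv = walk-++ (walk-snoc (lift w′) bv (inj₂ (inj₂ refl)))
      (step (inj₂ (inj₂ refl)) (X-sym e) (step (inj₂ (inj₁ refl)) ua (lift w)))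
    -- The walk leaves u along the new edge ua.
    first : X u v → Walk X S a b → X b v → (∃ λ z → S′ z × X z u × X z a) → X⁺ a u → Goal
    first e w bv (z , inj₁ sz , zu , za) au = old e (X-sym zu) (step sz za w) bv
    first e w bv (z , inj₂ (inj₁ refl) , zu , za) au = ⊥-elim (irr zu)
    first e w bv (z , inj₂ (inj₂ refl) , zu , za) au = a , walk-start w , au , inj₁ (X-sym za)
    last : X u v → X u a → Walk X S a b → (∃ λ z → S′ z × X z b × X z v) → X⁺ b v → Goal
    last e ua w (z , inj₁ sz , zb , zv) bv = old e ua (walk-snoc w (X-sym zb) sz) zv
    last e ua w (z , inj₂ (inj₁ refl) , zb , zv) bv = b , walk-end w , inj₁ (X-sym zb) , bv
    last e ua w (z , inj₂ (inj₂ refl) , zb , zv) bv = ⊥-elim (irr zv)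
    loop : X u v → Walk X S a b → X b v → Walk X S′ a u
    loop e w bv = walk-snoc (walk-snoc (lift w) bv (inj₂ (inj₂ refl))) (X-sym e) (inj₂ (inj₁ refl))
    loop′ : X u v → X u a → Walk X S a b → Walk X S′ v b
    loop′ e ua w = step (inj₂ (inj₂ refl)) (X-sym e) (step (inj₂ (inj₁ refl)) ua (lift w))
    main : X⁺ u v → X⁺ u a → Walk X S a b ⊎ ((Walk X S a x × Walk X S y b) ⊎ (Walk X S a y × Walk X S x b)) →
      X⁺ b v → Goal
    main (inj₁ e) (inj₁ ua) (inj₁ w) (inj₁ bv) = old e ua w bv
    main (inj₁ e) (inj₁ ua) (inj₂ (inj₁ (w , w′))) (inj₁ bv) with star′ (back e ua w w′ bv)
    ... | z , sz , zy , zx = around e ua w w′ bv (z , sz , zx , zy)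
    main (inj₁ e) (inj₁ ua) (inj₂ (inj₂ (w , w′))) (inj₁ bv) with star _ (back e ua w w′ bv)
    ... | z , sz , zx , zy = around e ua w w′ bv (z , sz , zy , zx)
    main (inj₁ e) (inj₂ (inj₁ (refl , refl))) (inj₁ w) (inj₁ bv) =
      first e w bv (let (z , sz , zy , zx) = star′ (loop e w bv) in z , sz , zx , zy) (inj₂ (inj₂ (refl , refl)))
    main (inj₁ e) (inj₂ (inj₂ (refl , refl))) (inj₁ w) (inj₁ bv) =
      first e w bv (let (z , sz , zx , zy) = star _ (loop e w bv) in z , sz , zy , zx) (inj₂ (inj₁ (refl , refl)))
    main (inj₁ e) (inj₁ ua) (inj₁ w) (inj₂ (inj₁ (refl , refl))) =
      last e ua w (let (z , sz , zy , zx) = star′ (loop′ e ua w) in z , sz , zx , zy) (inj₂ (inj₁ (refl , refl)))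
    main (inj₁ e) (inj₁ ua) (inj₁ w) (inj₂ (inj₂ (refl , refl))) =
      last e ua w (let (z , sz , zx , zy) = star _ (loop′ e ua w) in z , sz , zy , zx) (inj₂ (inj₂ (refl , refl)))
    main (inj₁ e) (inj₂ (inj₁ (refl , refl))) _ (inj₂ (inj₁ (refl , refl))) = ⊥-elim (¬Su (walk-end w))
    main (inj₁ e) (inj₂ (inj₁ (refl , refl))) _ (inj₂ (inj₂ (refl , refl))) = ⊥-elim (irr e)
    main (inj₁ e) (inj₂ (inj₂ (refl , refl))) _ (inj₂ (inj₁ (refl , refl))) = ⊥-elim (irr e)
    main (inj₁ e) (inj₂ (inj₂ (refl , refl))) _ (inj₂ (inj₂ (refl , refl))) = ⊥-elim (¬Su (walk-end w))
    main (inj₁ e) (inj₂ (inj₁ (refl , refl))) (inj₂ (inj₁ (w , _))) (inj₁ bv) = ⊥-elim (¬Su (walk-end w))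
    main (inj₁ e) (inj₂ (inj₁ (refl , refl))) (inj₂ (inj₂ (_ , w))) (inj₁ bv) = ⊥-elim (¬Su (walk-start w))
    main (inj₁ e) (inj₂ (inj₂ (refl , refl))) (inj₂ (inj₁ (_ , w))) (inj₁ bv) = ⊥-elim (¬Su (walk-start w))
    main (inj₁ e) (inj₂ (inj₂ (refl , refl))) (inj₂ (inj₂ (w , _))) (inj₁ bv) = ⊥-elim (¬Su (walk-end w))
    main (inj₁ e) (inj₁ ua) (inj₂ (inj₁ (_ , w))) (inj₂ (inj₁ (refl , refl))) = ⊥-elim (¬Sv (walk-start w))
    main (inj₁ e) (inj₁ ua) (inj₂ (inj₂ (w , _))) (inj₂ (inj₁ (refl , refl))) = ⊥-elim (¬Sv (walk-end w))
    main (inj₁ e) (inj₁ ua) (inj₂ (inj₁ (w , _))) (inj₂ (inj₂ (refl , refl))) = ⊥-elim (¬Sv (walk-end w))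
    main (inj₁ e) (inj₁ ua) (inj₂ (inj₂ (_ , w))) (inj₂ (inj₂ (refl , refl))) = ⊥-elim (¬Sv (walk-start w))
    main (inj₂ (inj₁ (refl , refl))) ua d bv = both ua d bv
      where
      both : X⁺ x a → Walk X S a b ⊎ ((Walk X S a x × Walk X S y b) ⊎ (Walk X S a y × Walk X S x b)) → X⁺ b y → Goal
      both (inj₁ ua) (inj₁ w) (inj₁ bv) with
        star (λ z → S z ⊎ (z ≡ x ⊎ z ≡ y)) (walk-snoc (step (inj₂ (inj₁ refl)) ua (walk-map id inj₁ w)) bv (inj₂ (inj₂ refl)))
      ... | z , inj₁ sz , zx , zy = z , sz , inj₁ zx , inj₁ zy
      ... | z , inj₂ (inj₁ refl) , zx , zy = ⊥-elim (irr zx)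
      ... | z , inj₂ (inj₂ refl) , zx , zy = ⊥-elim (irr zy)
      both _ (inj₂ (inj₁ (w , _))) _ = ⊥-elim (¬Su (walk-end w))
      both _ (inj₂ (inj₂ (_ , w))) _ = ⊥-elim (¬Su (walk-start w))
      both (inj₂ (inj₁ (refl , refl))) (inj₁ w) _ = ⊥-elim (¬Sv (walk-start w))
      both (inj₂ (inj₂ (e , _))) (inj₁ w) _ = ⊥-elim (x≢y e)
      both (inj₁ _) (inj₁ w) (inj₂ (inj₁ (refl , _))) = ⊥-elim (¬Su (walk-end w))
      both (inj₁ _) (inj₁ w) (inj₂ (inj₂ (_ , e))) = ⊥-elim (x≢y (≡-sym e))
    main (inj₂ (inj₂ (refl , refl))) ua d bv = both ua d bv
      where
      both : X⁺ y a → Walk X S a b ⊎ ((Walk X S a x × Walk X S y b) ⊎ (Walk X S a y × Walk X S x b)) → X⁺ b x → Goal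
      both (inj₁ ua) (inj₁ w) (inj₁ bv) with
        star′ {λ z → S z ⊎ (z ≡ x ⊎ z ≡ y)} (walk-snoc (step (inj₂ (inj₂ refl)) ua (walk-map id inj₁ w)) bv (inj₂ (inj₁ refl)))
      ... | z , inj₁ sz , zy , zx = z , sz , inj₁ zy , inj₁ zx
      ... | z , inj₂ (inj₁ refl) , zy , zx = ⊥-elim (irr zx)
      ... | z , inj₂ (inj₂ refl) , zy , zx = ⊥-elim (irr zy)
      both _ (inj₂ (inj₁ (w , _))) _ = ⊥-elim (¬Sv (walk-end w))
      both _ (inj₂ (inj₂ (_ , w))) _ = ⊥-elim (¬Sv (walk-start w))
      both (inj₂ (inj₁ (e , _))) (inj₁ w) _ = ⊥-elim (x≢y (≡-sym e))
      both (inj₂ (inj₂ (refl , refl))) (inj₁ w) _ = ⊥-elim (¬Sv (walk-start w))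
      both (inj₁ _) (inj₁ w) (inj₂ (inj₁ (_ , e))) = ⊥-elim (x≢y e)
      both (inj₁ _) (inj₁ w) (inj₂ (inj₂ (refl , _))) = ⊥-elim (¬Su (walk-end w))

-- Labelled graphs are chordal and contain no sun

module LabelledGraph {ℓ : ℕ} (G : SimpleGraph ℓ) (L : MATLabelling G) where
  open MATLabelling L

  private
    V = Fin ℓ
    E = EdgeRel G
    N = lower G lab

  E-sym : ∀ {a b} → E a b → E b a
  E-sym = edge-sym G

  -- A colouring that is constant on the class of xy and yz agrees at x and z. This contradicts
  -- `separate` if xz has a smaller label and `acyclic` if xz belongs to the same class.
  triangle : ∀ {x y z} → E x y → E y z → E x z → lab x y ≡ lab y z → ¬ (lab x z ≤ lab x y)
  triangle {x} {y} {z} xy yz xz e le with ℕₚ.m≤n⇒m<n∨m≡n le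
  ... | inj₁ lt with separate xy xz lt
  ...   | f , con , ne = ne (trans (con x y xy refl) (con y z yz (≡-sym e)))
  triangle {x} {y} {z} xy yz xz e le | inj₂ eq with acyclic xz
  ... | f , con , ne = ne (trans
    (con x y xy (≡-sym eq) (λ p → edge-≢ G yz (proj₂ p)) (λ p → edge-≢ G xz (proj₁ p)))
    (con y z yz (trans (≡-sym e) (≡-sym eq)) (λ p → edge-≢ G xy (≡-sym (proj₁ p))) (λ p → edge-≢ G yz (trans (proj₁ p) refl))))

  max⇒lower : ∀ {x y z} → E x y → E x z → E y z → lab x z ≤ lab x y → lab y z ≤ lab x y → N x y z ≡ true
  max⇒lower {x} {y} {z} xy xz yz lxz lyz = lower⁺ G lab xz yz
    (ℕₚ.≤∧≢⇒< lxz λ e → triangle (E-sym xz) xy (E-sym yz) (trans (lab-sym z x) e)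
      (≤-trans (≤-reflexive (lab-sym z y)) (≤-trans lyz (≤-reflexive (trans (≡-sym e) (lab-sym x z))))))
    (ℕₚ.≤∧≢⇒< lyz λ e → triangle xy yz xz (≡-sym e) lxz)

  lower-swap : ∀ {a b w} → N a b w ≡ true → N b a w ≡ true
  lower-swap {a} {b} {w} = lower-sym G lab lab-sym a b w

  H : ℕ → V → V → Set
  H k a b = E a b × lab a b < k

  H-sym : ∀ {k a b} → H k a b → H k b a
  H-sym {k} {a} {b} (e , l) = E-sym e , subst (_< k) (lab-sym a b) l

  H-irrefl : ∀ {k a} → ¬ H k a a
  H-irrefl (e , _) = edge-irrefl G e

  H? : ∀ k a b → Dec (H k a b)
  H? k a b = (Adj G a b Bool.≟ true) ×-dec (lab a b ℕ.<? k)

  lower⇒H : ∀ {a b w} → N a b w ≡ true → H (lab a b) a w × H (lab a b) b w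
  lower⇒H h with lower⁻ G lab h
  ... | aw , bw , l , l′ = (aw , l) , (bw , l′)

  CliqueIn : ℕ → (V → Bool) → Set
  CliqueIn k Q = ∀ {a b} → Q a ≡ true → Q b ≡ true → a ≢ b → H k a b

  clique-shrink : ∀ {k Q} → CliqueIn (suc k) Q →
    (∃ λ a → ∃ λ b → Q a ≡ true × Q b ≡ true × a ≢ b × lab a b ≡ k) ⊎ CliqueIn k Q
  clique-shrink {k} {Q} cl with any? (λ a → any? λ b → (Q a Bool.≟ true) ×-dec ((Q b Bool.≟ true) ×-dec (¬? (a ≟ᶠ b) ×-dec (lab a b ℕ.≟ k))))
  ... | yes w = inj₁ w
  ... | no none = inj₂ λ {a} {b} qa qb ne → let (e , l) = cl qa qb ne in
    e , ℕₚ.≤∧≢⇒< (ℕ.s≤s⁻¹ l) (λ eq → none (a , b , qa , qb , ne , eq))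

  span : V → V → V → Bool
  span a b = insert a (insert b (N a b))

  ⊆-span : ∀ {k Q a b} → CliqueIn (suc k) Q → Q a ≡ true → Q b ≡ true → a ≢ b → lab a b ≡ k → Q ⊆ span a b
  ⊆-span {k} {Q} {a} {b} cl qa qb ne refl z qz = cases (z ≟ᶠ a) (z ≟ᶠ b)
    where
    cases : Dec (z ≡ a) → Dec (z ≡ b) → span a b z ≡ true
    cases (yes refl) _ = insert-self (insert b (N a b)) z
    cases (no za) (yes refl) = ⊆-insert (insert b (N a b)) a z (insert-self (N a b) z)
    cases (no za) (no zb) = ⊆-insert (insert b (N a b)) a z (⊆-insert (N a b) b z
      (max⇒lower (proj₁ (cl qa qb ne)) (proj₁ (cl qa qz (za ∘ ≡-sym))) (proj₁ (cl qb qz (zb ∘ ≡-sym)))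
        (ℕ.s≤s⁻¹ (proj₂ (cl qa qz (za ∘ ≡-sym)))) (ℕ.s≤s⁻¹ (proj₂ (cl qb qz (zb ∘ ≡-sym))))))

  #-span-≤ : ∀ {a b} → E a b → # (span a b) ≤ suc (suc (lab a b))
  #-span-≤ {a} {b} ab = ≤-trans (#-insert-≤ (insert b (N a b)) a)
    (s≤s (≤-trans (#-insert-≤ (N a b) b) (s≤s (≤-reflexive (count ab)))))

  -- If some edge ab of a clique in H (k + 1) has label k, all other vertices of the clique are
  -- lower neighbours of ab, and there are only k of these. Without such an edge the clique lies in
  -- H k.
  clique-bound : ∀ k Q → CliqueIn k Q → # Q ≤ suc k
  clique-bound zero Q cl with any? (λ w → Q w Bool.≟ true)
  ... | no none = ≤-trans (≤-reflexive (#-empty λ x → ¬true⇒false λ q → none (x , q))) z≤n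
  ... | yes (w , qw) = ≤-trans (#-mono {Q = insert w ∅} λ z qz → case z ≟ᶠ w of λ
      { (yes refl) → insert-self ∅ z ; (no ne) → case proj₂ (cl qz qw ne) of λ () })
    (≤-trans (#-insert-≤ ∅ w) (s≤s (≤-reflexive (#-empty {ℓ} {P = ∅} λ _ → refl))))
  clique-bound (suc k) Q cl with clique-shrink cl
  ... | inj₂ cl′ = ≤-trans (clique-bound k Q cl′) (n≤1+n _)
  ... | inj₁ (a , b , qa , qb , ne , refl) = ≤-trans (#-mono (⊆-span cl qa qb ne refl)) (#-span-≤ (proj₁ (cl qa qb ne)))

  module Separation {k : ℕ} (ch : ChordProperty (H k)) (M : V → Bool) (cl : CliqueIn k M) (#M : # M ≡ k) where
    Outside : V → Set
    Outside z = M z ≡ false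

    Complete : V → Set
    Complete c = ∀ {n} → M n ≡ true → H k c n

    module _ (x y : V) (x≢y : x ≢ y) where
      Far : V → Set
      Far z = ¬ H k x z × z ≢ x × Outside z

      NearOrFar : V → V → Set
      NearOrFar p z = (z ≡ p ⊎ ¬ H k x z) × z ≢ x × Outside z

      far⇒ : ∀ {p z} → Far z → NearOrFar p z
      far⇒ (a , b) = inj₂ a , b

      -- Cutting a walk at its last neighbour p of x.
      cut : ∀ {a} → Walk (H k) Outside a y →
        (∃ λ p → H k x p × Walk (H k) (NearOrFar p) p y) ⊎ Walk (H k) Far a y
      cut (here s) with H? k x y
      ... | yes h = inj₁ (y , h , here (inj₁ refl , x≢y ∘ ≡-sym , s))
      ... | no ¬h = inj₂ (here (¬h , x≢y ∘ ≡-sym , s))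
      cut (step {a} s e w) with cut w
      ... | inj₁ r = inj₁ r
      ... | inj₂ v with a ≟ᶠ x | H? k x a
      ...   | yes refl | _ = ⊥-elim (proj₁ (walk-start v) e)
      ...   | no ne | yes h = inj₁ (a , h , step (inj₁ refl , ne , s) e (walk-map id far⇒ v))
      ...   | no ne | no ¬h = inj₂ (step (¬h , ne , s) e v)

      near : Walk (H k) Outside x y → ∃ λ p → H k x p × Walk (H k) (NearOrFar p) p y
      near (here _) = ⊥-elim (x≢y refl)
      near (step s e w) with cut w
      ... | inj₁ r = r
      ... | inj₂ v = ⊥-elim (proj₁ (walk-start v) e)

    -- Let p be the last neighbour of x on the walk. For n in M, the cycle n, x, p, ..., y has no
    -- neighbour of x beyond p, so the triangle over nx has p as its third vertex. Thus p is
    -- complete too, and M with x and p is a clique larger than `clique-bound` allows.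
    at-most-one-complete : ∀ {x y} → Complete x → Complete y → Walk (H k) Outside x y → x ≡ y
    at-most-one-complete {x} {y} cx cy w with x ≟ᶠ y
    ... | yes e = e
    ... | no x≢y with near x y x≢y w
    ... | p , xp , v = ⊥-elim (<-irrefl refl (≤-trans (≤-reflexive (≡-sym size)) (clique-bound k Q clQ)))
      where
      p-complete : Complete p
      p-complete {n} mn with ch {n} {x} (NearOrFar x y x≢y p) (λ s → absurd-bool mn (proj₂ (proj₂ s)))
          (λ s → proj₁ (proj₂ s) refl) (H-sym (cx mn)) (H-sym (cy mn)) (walk-rev H-sym v) (H-sym xp)
      ... | z , (inj₁ refl , _) , zn , zx = zn
      ... | z , (inj₂ ¬h , _) , zn , zx = ⊥-elim (¬h (H-sym zx))
      Q : V → Bool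
      Q = insert x (insert p M)
      clQ : CliqueIn k Q
      clQ {a} {b} qa qb ne with insert⁻ (insert p M) x a qa | insert⁻ (insert p M) x b qb
      ... | inj₁ refl | inj₁ refl = ⊥-elim (ne refl)
      ... | inj₁ refl | inj₂ qb′ with insert⁻ M p b qb′
      ...   | inj₁ refl = xp
      ...   | inj₂ mb = cx mb
      clQ {a} {b} qa qb ne | inj₂ qa′ | inj₁ refl with insert⁻ M p a qa′
      ...   | inj₁ refl = H-sym xp
      ...   | inj₂ ma = H-sym (cx ma)
      clQ {a} {b} qa qb ne | inj₂ qa′ | inj₂ qb′ with insert⁻ M p a qa′ | insert⁻ M p b qb′
      ... | inj₁ refl | inj₁ refl = ⊥-elim (ne refl)
      ... | inj₁ refl | inj₂ mb = p-complete mb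
      ... | inj₂ ma | inj₁ refl = H-sym (p-complete ma)
      ... | inj₂ ma | inj₂ mb = cl ma mb ne
      size : # Q ≡ suc (suc k)
      size = trans (#-insert (insert p M) x (¬true⇒false λ q → case insert⁻ M p x q of λ
                { (inj₁ refl) → H-irrefl xp ; (inj₂ mx) → H-irrefl (cx mx) }))
        (cong suc (trans (#-insert M p (proj₂ (proj₂ (walk-start v)))) (cong suc #M)))

  -- Two lower neighbours a, b form the 4-cycle u a v b. Its diagonal uv is missing from H (lab u
  -- v), as its own label is not below itself.
  lower-clique : ∀ {u v} → ChordProperty (H (lab u v)) → E u v → CliqueIn (lab u v) (N u v)
  lower-clique {u} {v} ch uv {a} {b} na nb ne
    with four-cycle {E = H (lab u v)} ch H-sym H-irrefl (edge-≢ G uv) ne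
      (proj₁ (lower⇒H na)) (H-sym (proj₂ (lower⇒H na))) (proj₂ (lower⇒H nb)) (H-sym (proj₁ (lower⇒H nb)))
  ... | inj₁ (_ , l) = ⊥-elim (<-irrefl refl l)
  ... | inj₂ h = h

  -- Follow the unique complete vertex of the current component of H k - N u v:
  -- it changes only along edges with label k, so the colour of `acyclic` stays constant.
  module _ {u v : V} (uv : E u v) (ch : ChordProperty (H (lab u v))) (F : V → V → Set)
    (F⇒ : ∀ {a b} → F a b → E a b × lab a b ≤ lab u v × ¬ (a ≡ u × b ≡ v) × ¬ (a ≡ v × b ≡ u)) where
    private
      k = lab u v
      f = proj₁ (acyclic uv)
      open module Sep = Separation ch (N u v) (lower-clique ch uv) (count uv)

    Tracked : V → Set
    Tracked p = ∃ λ c → Complete c × f c ≡ f u × Walk (H k) Outside c p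

    walk-meets-lower : ∀ (S : V → Set) → Walk F S u v → ∃ λ z → S z × H k z u × H k z v
    walk-meets-lower S w = let (z , sz , nz) = go start w in
        z , sz , H-sym (proj₁ (lower⇒H nz)) , H-sym (proj₂ (lower⇒H nz))
      where
      start : Tracked u
      start = u , (λ n → proj₁ (lower⇒H n)) , refl ,
        here (¬true⇒false λ n → edge-irrefl G (proj₁ (lower⁻ G lab n)))
      advance : ∀ {a b} → Tracked a → F a b → Outside b → Tracked b
      advance {a} {b} (c , cc , fc , w) Fab ob with F⇒ Fab
      ... | ab , le , ne₁ , ne₂ with ℕₚ.m≤n⇒m<n∨m≡n le
      ...   | inj₁ lt = c , cc , fc , walk-snoc w (ab , lt) ob
      -- A vertex of N a b outside N u v joins a to b within the current component. Otherwise the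
      -- two sets, both of size k, coincide; then a and b are complete, the tracked vertex is a, and
      -- it moves on to b without a change of colour.
      ...   | inj₂ eq with N a b ⊆? N u v
      ...     | no ¬sub = let (z , nz , oz) = ⊈-witness ¬sub
                              (az , bz) = lower⇒H nz
                          in c , cc , fc , walk-snoc (walk-snoc w (subst (λ j → H j a z) eq az) oz)
                               (H-sym (subst (λ j → H j b z) eq bz)) ob
      ...     | yes sub = b , (λ n → subst (λ j → H j b _) eq (proj₂ (lower⇒H (sup _ n)))) ,
                  trans (≡-sym (proj₁ (proj₂ (acyclic uv)) a b ab eq ne₁ ne₂)) (trans (cong f (≡-sym c≡a)) fc) , here ob
        where
        sup : N u v ⊆ N a b
        sup = #-⊆-antisym sub (≤-reflexive (trans (count uv) (trans (≡-sym eq) (≡-sym (count ab)))))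
        c≡a : c ≡ a
        c≡a = at-most-one-complete cc (λ n → subst (λ j → H j a _) eq (proj₁ (lower⇒H (sup _ n)))) w
      go : ∀ {a} → Tracked a → Walk F S a v → ∃ λ z → S z × N u v z ≡ true
      -- At the end v is complete as well, so the tracked vertex is v; but its colour is still that
      -- of u.
      go (c , cc , fc , w) (here s) = ⊥-elim (proj₂ (proj₂ (acyclic uv))
        (trans (≡-sym fc) (cong f (at-most-one-complete cc (λ n → proj₂ (lower⇒H n)) w))))
      go t (step {b = b} s e w) with N u v b in eq
      ... | true = b , walk-start w , eq
      ... | false = go (advance t e eq) w

  module Layer (k : ℕ) (ch : ChordProperty (H k)) where
    H+ : List (V × V) → V → V → Set
    H+ [] = H k
    H+ ((x , y) ∷ es) a b = H+ es a b ⊎ ((a ≡ x × b ≡ y) ⊎ (a ≡ y × b ≡ x))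

    H+-sym : ∀ es {a b} → H+ es a b → H+ es b a
    H+-sym [] h = H-sym h
    H+-sym (_ ∷ es) (inj₁ h) = inj₁ (H+-sym es h)
    H+-sym (_ ∷ es) (inj₂ (inj₁ (p , q))) = inj₂ (inj₂ (q , p))
    H+-sym (_ ∷ es) (inj₂ (inj₂ (p , q))) = inj₂ (inj₁ (q , p))

    H+? : ∀ es a b → Dec (H+ es a b)
    H+? [] = H? k
    H+? ((x , y) ∷ es) a b = H+? es a b ⊎-dec (((a ≟ᶠ x) ×-dec (b ≟ᶠ y)) ⊎-dec ((a ≟ᶠ y) ×-dec (b ≟ᶠ x)))

    InLayer : List (V × V) → Set
    InLayer es = ∀ {x y} → (x , y) ∈ es → E x y × lab x y ≡ k

    H⊆H+ : ∀ es {a b} → H k a b → H+ es a b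
    H⊆H+ [] h = h
    H⊆H+ (_ ∷ es) h = inj₁ (H⊆H+ es h)

    ∈⇒H+ : ∀ es {a b} → (a , b) ∈ es → H+ es a b
    ∈⇒H+ (_ ∷ es) (here refl) = inj₂ (inj₁ (refl , refl))
    ∈⇒H+ (_ ∷ es) (there i) = inj₁ (∈⇒H+ es i)

    H+⇒ : ∀ es → InLayer es → ∀ {a b} → H+ es a b → H (suc k) a b
    H+⇒ [] _ (e , l) = e , ≤-trans l (n≤1+n k)
    H+⇒ (_ ∷ es) il (inj₁ h) = H+⇒ es (il ∘ there) h
    H+⇒ (_ ∷ es) il (inj₂ (inj₁ (refl , refl))) = let (e , l) = il (here refl) in e , s≤s (≤-reflexive l)
    H+⇒ (_ ∷ es) il (inj₂ (inj₂ (refl , refl))) = H-sym (let (e , l) = il (here refl) in e , s≤s (≤-reflexive l))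

    -- A walk between x and y along the edges present so far uses labels at most k and not xy, so
    -- `walk-meets-lower` supplies the common neighbour required for adding xy.
    chord+ : ∀ es → InLayer es → ChordProperty (H+ es)
    chord+ [] _ = ch
    chord+ ((x , y) ∷ es) il with H+? es x y
    -- The list `all` contains every edge in both orientations, so the edge may already be there.
    ... | yes old = chordProperty-resp inj₁ back (chord+ es (il ∘ there))
      where
      back : ∀ {a b} → H+ ((x , y) ∷ es) a b → H+ es a b
      back (inj₁ h) = h
      back (inj₂ (inj₁ (refl , refl))) = old
      back (inj₂ (inj₂ (refl , refl))) = H+-sym es old
    ... | no new with il (here refl)
    ... | xy , refl = AddEdge.chordProperty⁺ (H+ es) (H+-sym es) x y (chord+ es (il ∘ there))
        (λ S w → let (z , sz , zx , zy) = walk-meets-lower xy ch (H+ es) F⇒ S w in z , sz , H⊆H+ es zx , H⊆H+ es zy)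
        (edge-≢ G xy) (λ h → H-irrefl (H+⇒ es (il ∘ there) h))
      where
      F⇒ : ∀ {a b} → H+ es a b → E a b × lab a b ≤ lab x y × ¬ (a ≡ x × b ≡ y) × ¬ (a ≡ y × b ≡ x)
      F⇒ h = let (e , l) = H+⇒ es (il ∘ there) h in e , ℕ.s≤s⁻¹ l ,
        (λ { (refl , refl) → new h }) , (λ { (refl , refl) → new (H+-sym es h) })

    next : ChordProperty (H (suc k))
    next = chordProperty-resp (H+⇒ all layer) to (chord+ all layer)
      where
      P? : (e : V × V) → Dec (E (proj₁ e) (proj₂ e) × lab (proj₁ e) (proj₂ e) ≡ k)
      P? e = (Adj G (proj₁ e) (proj₂ e) Bool.≟ true) ×-dec (lab (proj₁ e) (proj₂ e) ℕ.≟ k)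
      all : List (V × V)
      all = filter P? (cartesianProduct (allFin ℓ) (allFin ℓ))
      layer : InLayer all
      layer i = proj₂ (∈-filter⁻ P? {xs = cartesianProduct (allFin ℓ) (allFin ℓ)} i)
      to : ∀ {a b} → H (suc k) a b → H+ all a b
      to {a} {b} (e , s≤s l) with ℕₚ.m≤n⇒m<n∨m≡n l
      ... | inj₁ lt = H⊆H+ all (e , lt)
      ... | inj₂ eq = ∈⇒H+ all (∈-filter⁺ P? (∈-cartesianProduct⁺ (∈-allFin a) (∈-allFin b)) (e , eq))

  chord-H : ∀ k → ChordProperty (H k)
  chord-H zero S su sv (_ , ()) ua w bv
  chord-H (suc k) = Layer.next k (chord-H k)

  chord-E : ChordProperty E
  chord-E {u} {v} S su sv uv {a} {b} ua w bv =
      let (z , sz , zu , zv) = chord-H K S su sv (up uv) (up ua) (walk-map up id w) (up bv)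
      in z , sz , proj₁ zu , proj₁ zv
    where
    K = proj₁ (bounded λ a → proj₁ (bounded (lab a)))
    up : ∀ {a b} → E a b → H K a b
    up {a} {b} e = e , <-trans (proj₂ (bounded (lab a)) b) (proj₂ (bounded λ a → proj₁ (bounded (lab a))) a)

  span-self : ∀ {a b} → span a b a ≡ true
  span-self {a} {b} = insert-self (insert b (N a b)) a

  span-other : ∀ {a b} → span a b b ≡ true
  span-other {a} {b} = ⊆-insert (insert b (N a b)) a b (insert-self (N a b) b)

  lower⊆span : ∀ {a b} → N a b ⊆ span a b
  lower⊆span {a} {b} z n = ⊆-insert (insert b (N a b)) a z (⊆-insert (N a b) b z n)

  span⁻ : ∀ {a b} z → span a b z ≡ true → z ≡ a ⊎ (z ≡ b ⊎ N a b z ≡ true)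
  span⁻ {a} {b} z h with insert⁻ (insert b (N a b)) a z h
  ... | inj₁ e = inj₁ e
  ... | inj₂ h′ = inj₂ (insert⁻ (N a b) b z h′)

  span-swap : ∀ {a b} → span a b ⊆ span b a
  span-swap {a} {b} z h with span⁻ {a} {b} z h
  ... | inj₁ refl = span-other {b} {a}
  ... | inj₂ (inj₁ refl) = span-self {b} {a}
  ... | inj₂ (inj₂ n) = lower⊆span {b} {a} z (lower-swap n)

  span-clique : ∀ {a b x y} → E a b → span a b x ≡ true → span a b y ≡ true → x ≢ y → E x y
  span-clique {a} {b} {x} {y} ab sx sy ne with span⁻ {a} {b} x sx | span⁻ {a} {b} y sy
  ... | inj₁ refl | inj₁ refl = ⊥-elim (ne refl)
  ... | inj₁ refl | inj₂ (inj₁ refl) = ab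
  ... | inj₁ refl | inj₂ (inj₂ n) = proj₁ (proj₁ (lower⇒H n))
  ... | inj₂ (inj₁ refl) | inj₁ refl = E-sym ab
  ... | inj₂ (inj₁ refl) | inj₂ (inj₁ refl) = ⊥-elim (ne refl)
  ... | inj₂ (inj₁ refl) | inj₂ (inj₂ n) = proj₁ (proj₂ (lower⇒H n))
  ... | inj₂ (inj₂ n) | inj₁ refl = E-sym (proj₁ (proj₁ (lower⇒H n)))
  ... | inj₂ (inj₂ n) | inj₂ (inj₁ refl) = E-sym (proj₁ (proj₂ (lower⇒H n)))
  ... | inj₂ (inj₂ n) | inj₂ (inj₂ n′) = proj₁ (lower-clique (chord-H (lab a b)) ab n n′ ne)

  -- A clique in H k with k + 1 vertices is the span of its edge with label k - 1.
  span-closed : ∀ k {x y} → E x y → lab x y ≡ k → ∀ {a b n} → a ≢ b →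
    span x y a ≡ true → span x y b ≡ true → N a b n ≡ true → span x y n ≡ true
  span-closed-half : ∀ k {x y} → E x y → lab x y ≡ k → ∀ {a b n} → a ≢ b → a ≢ x → b ≢ x →
    span x y a ≡ true → span x y b ≡ true → N a b n ≡ true → span x y n ≡ true

  span-closed k {x} {y} xy lxy {a} {b} {n} ne sa sb nn = cases (a ≟ᶠ x) (b ≟ᶠ x) (a ≟ᶠ y) (b ≟ᶠ y)
    where
    cases : Dec (a ≡ x) → Dec (b ≡ x) → Dec (a ≡ y) → Dec (b ≡ y) → span x y n ≡ true
    -- Two distinct members of the span both avoid x, or both avoid y, or are x and y themselves.
    cases (no ax) (no bx) _ _ = span-closed-half k xy lxy ne ax bx sa sb nn
    cases _ _ (no ay) (no by) = span-swap {y} {x} n (span-closed-half k (E-sym xy) (trans (lab-sym y x) lxy) ne ay by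
      (span-swap {x} {y} a sa) (span-swap {x} {y} b sb) nn)
    cases (yes refl) _ _ (yes refl) = lower⊆span {x} {y} n nn
    cases _ (yes refl) (yes refl) _ = lower⊆span {x} {y} n (lower-swap nn)
    cases (yes refl) _ (yes refl) _ = ⊥-elim (edge-irrefl G xy)
    cases _ (yes refl) _ (yes refl) = ⊥-elim (edge-irrefl G xy)

  span-closed-half k {x} {y} xy lxy {a} {b} {n} ne ax bx sa sb nn = by-size k lxy
    where
    R : V → Bool
    R = insert y (N x y)
    clR : CliqueIn (lab x y) R
    clR {p} {q} rp rq pq with insert⁻ (N x y) y p rp | insert⁻ (N x y) y q rq
    ... | inj₁ refl | inj₁ refl = ⊥-elim (pq refl)
    ... | inj₁ refl | inj₂ nq = proj₂ (lower⇒H nq)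
    ... | inj₂ np | inj₁ refl = H-sym (proj₂ (lower⇒H np))
    ... | inj₂ np | inj₂ nq = lower-clique (chord-H (lab x y)) xy np nq pq
    #R : # R ≡ suc (lab x y)
    #R = trans (#-insert (N x y) y (¬true⇒false λ h → H-irrefl (proj₂ (lower⇒H h)))) (cong suc (count xy))
    inR : ∀ {z} → z ≢ x → span x y z ≡ true → R z ≡ true
    inR {z} zx sz with insert⁻ R x z sz
    ... | inj₁ e = ⊥-elim (zx e)
    ... | inj₂ r = r
    by-size : ∀ k → lab x y ≡ k → span x y n ≡ true
    by-size zero e = case subst (lab a b <_) e (proj₂ (clR (inR ax sa) (inR bx sb) ne)) of λ ()
    -- Here k is one less than the label of xy. R has one vertex too many for a clique in H k, so it
    -- contains an edge with label k, and by counting R is the span of that edge.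
    by-size (suc k) e with clique-shrink {k} {R} (subst (λ j → CliqueIn j R) e clR)
    ... | inj₂ cl = ⊥-elim (<-irrefl refl (≤-trans (≤-reflexive (trans (cong suc (≡-sym e)) (≡-sym #R))) (clique-bound k R cl)))
    ... | inj₁ (c , d , rc , rd , cd , lcd) = ⊆-insert R x n (back n
        (span-closed k (proj₁ (clR rc rd cd)) lcd ne (sub a (inR ax sa)) (sub b (inR bx sb)) nn))
      where
      sub : R ⊆ span c d
      sub = ⊆-span (subst (λ j → CliqueIn j R) e clR) rc rd cd lcd
      back : span c d ⊆ R
      back = #-⊆-antisym sub (≤-trans (#-span-≤ (proj₁ (clR rc rd cd)))
        (≤-reflexive (trans (cong (2 +_) lcd) (trans (cong suc (≡-sym e)) (≡-sym #R)))))

  -- The span of the largest edge of the triangle w a b contains all three vertices. Spans are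
  -- cliques closed under lower neighbours of their edges, so n lies in the same clique as w.
  lower-absorbs : ∀ {a b n w} → E a b → N a b n ≡ true → E w a → E w b → n ≡ w ⊎ E n w
  lower-absorbs {a} {b} {n} {w} ab nn wa wb with n ≟ᶠ w
  ... | yes e = inj₁ e
  ... | no nw with lab w a ℕ.≤? lab a b | lab w b ℕ.≤? lab a b | ℕₚ.≤-total (lab w a) (lab w b)
  ...   | yes la | yes lb | _ = inj₂ (span-clique ab (lower⊆span {a} {b} n nn) (lower⊆span {a} {b} w
            (max⇒lower ab (E-sym wa) (E-sym wb) (≤-trans (≤-reflexive (lab-sym a w)) la)
              (≤-trans (≤-reflexive (lab-sym b w)) lb))) nw)
  ...   | no la | _ | inj₂ le = inj₂ (span-clique wa (span-closed (lab w a) wa refl (edge-≢ G ab) (span-other {w} {a})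
            (lower⊆span {w} {a} b (max⇒lower wa wb ab le (<⇒≤ (ℕₚ.≰⇒> la)))) nn) (span-self {w} {a}) nw)
  ...   | yes la | no lb | inj₂ le = ⊥-elim (lb (≤-trans le la))
  ...   | _ | no lb | inj₁ le = inj₂ (span-clique wb (span-closed (lab w b) wb refl (edge-≢ G ab ∘ ≡-sym) (span-other {w} {b})
            (lower⊆span {w} {b} a (max⇒lower wb wa (E-sym ab) le (≤-trans (≤-reflexive (lab-sym b a)) (<⇒≤ (ℕₚ.≰⇒> lb)))))
            (lower-swap nn)) (span-self {w} {b}) nw)
  ...   | no la | yes lb | inj₁ le = ⊥-elim (la (≤-trans le lb))

  no-sun : ∀ n → 2 < n → ¬ InducedSun G n
  no-sun (suc m) n>2 (f , inj , iff) with argmax {suc m} {λ _ → ⊤} (λ _ → yes tt) (λ i → lab (f (inj₁ i)) (f (inj₁ (csuc i))))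
  ... | inj₁ none = none zero tt
  ... | inj₂ (i , _ , mx) = contradict (cyclic-induction i P (inj₂ (inj₁ refl)) stp)
    where
    u : Fin (suc m) → V
    u j = f (inj₁ j)
    w : Fin (suc m) → V
    w j = f (inj₂ j)
    u-inj : ∀ {j k} → u j ≡ u k → j ≡ k
    u-inj e with inj e
    ... | refl = refl
    k = lab (u i) (u (csuc i))
    S : V → Set
    S z = ∃ λ j → j ≢ i × j ≢ csuc i × z ≡ u j
    edge : ∀ j → H (suc k) (u j) (u (csuc j))
    edge j = proj₂ (iff (inj₁ j) (inj₁ (csuc j))) (λ e → csuc-fixfree (<⇒≤ n>2) j (≡-sym e)) , s≤s (mx j tt)
    -- `S` excludes both ends of the largest edge, so the walk can begin only at the second
    -- successor of i. The three alternatives are: the turn is complete and the walk ended at the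
    -- predecessor of i; the walk has not begun; the walk has reached j.
    P : Fin (suc m) → Set
    P j = (j ≡ i × ∃ λ b → csuc b ≡ i × Walk (H (suc k)) S (u (csuc (csuc i))) (u b)) ⊎
          (j ≡ csuc i ⊎ Walk (H (suc k)) S (u (csuc (csuc i))) (u j))
    stp : ∀ j → j ≢ i → P j → P (csuc j)
    stp j ne (inj₁ (e , _)) = ⊥-elim (ne e)
    stp j ne (inj₂ (inj₁ refl)) = inj₂ (inj₂ (here (csuc (csuc i) , csuc²-fixfree n>2 i ,
      (λ e → csuc-fixfree (<⇒≤ n>2) (csuc i) e) , refl)))
    stp j ne (inj₂ (inj₂ v)) with csuc j ≟ᶠ i
    ... | yes e = inj₁ (e , j , e , v)
    ... | no ne′ = inj₂ (inj₂ (walk-snoc v (edge j) (csuc j , ne′ , (λ e → ne (csuc-injective e)) , refl)))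
    contradict : P i → ⊥
    contradict (inj₂ (inj₁ e)) = csuc-fixfree (<⇒≤ n>2) i (≡-sym e)
    contradict (inj₂ (inj₂ v)) = let (j , ne , _ , e) = walk-end v in ne (≡-sym (u-inj e))
    contradict (inj₁ (_ , b , e , v)) with chord-H (suc k) {u (csuc i)} {u i} S
      (λ { (j , _ , ne , e) → ne (≡-sym (u-inj e)) }) (λ { (j , ne , _ , e) → ne (≡-sym (u-inj e)) })
      (H-sym (edge i)) (edge (csuc i)) v (subst (λ t → H (suc k) (u b) (u t)) e (edge b))
    ... | _ , (j , ji , jsi , refl) , (ju , l) , (ju′ , l′) with lower-absorbs {u i} {u (csuc i)} {u j} {w i} (proj₁ (edge i))
          (max⇒lower (proj₁ (edge i)) (E-sym ju′) (E-sym ju) (≤-trans (≤-reflexive (lab-sym (u i) (u j))) (ℕ.s≤s⁻¹ l′))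
            (≤-trans (≤-reflexive (lab-sym (u (csuc i)) (u j))) (ℕ.s≤s⁻¹ l)))
          (proj₂ (iff (inj₂ i) (inj₁ i)) (inj₁ refl)) (proj₂ (iff (inj₂ i) (inj₁ (csuc i))) (inj₂ refl))
    ...   | inj₁ e = case inj e of λ ()
    ...   | inj₂ e with proj₁ (iff (inj₁ j) (inj₂ i)) e
    ...     | inj₁ p = ji p
    ...     | inj₂ p = jsi p

labelling⇒stronglyChordal : ∀ {ℓ} (G : SimpleGraph ℓ) → MATLabelling G → StronglyChordal G
labelling⇒stronglyChordal G L = chordProperty⇒chordal G chord-E , no-sun
  where open LabelledGraph G L

-- Special cycles

-- x i belongs to y j exactly when these are neighbours on a cycle x₀ y₀ x₁ y₁ … x_m y_m.
Inc : ℕ → ℕ → ℕ → Set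
Inc m i j = i ≡ j ⊎ (i ≡ suc j ⊎ (i ≡ 0 × j ≡ m))

record SpecialCycle {X Y : Set} (M : X → Y → Bool) (m : ℕ) : Set where
  field
    x : ℕ → X
    y : ℕ → Y
    m≥2 : 2 ≤ m
    inc : ∀ {i j} → i ≤ m → j ≤ m → Inc m i j → M (x i) (y j) ≡ true
    exc : ∀ {i j} → i ≤ m → j ≤ m → ¬ Inc m i j → M (x i) (y j) ≡ false

nearest-below : ∀ (p : ℕ → Bool) {a} d → p a ≡ true → p (d + a) ≡ false →
  ∃ λ b → a ≤ b × b < d + a × p b ≡ true × (∀ i → b < i → i ≤ d + a → p i ≡ false)
nearest-below p zero pa pl = absurd-bool pa pl
nearest-below p {a} (suc d) pa pl with p (d + a) in eq
... | true = d + a , ℕₚ.m≤n+m a d , ≤-refl , eq , λ i l g → subst (λ t → p t ≡ false) (≤-antisym l g) pl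
... | false with nearest-below p d pa eq
... | b , ab , bl , pb , h = b , ab , ≤-trans bl (n≤1+n _) , pb , λ i l g → case ℕₚ.m≤n⇒m<n∨m≡n g of λ
  { (inj₁ lt) → h i l (ℕ.s≤s⁻¹ lt) ; (inj₂ refl) → pl }

nearest-above : ∀ (p : ℕ → Bool) {l} d → p l ≡ false → p (d + l) ≡ true →
  ∃ λ b → l < b × b ≤ d + l × p b ≡ true × (∀ i → l ≤ i → i < b → p i ≡ false)
nearest-above p zero pl pb = absurd-bool pb pl
nearest-above p {l} (suc d) pl pb with p (suc l) in eq
... | true = suc l , ≤-refl , s≤s (ℕₚ.m≤n+m l d) , eq , λ i g h → subst (λ t → p t ≡ false) (≤-antisym g (ℕ.s≤s⁻¹ h)) pl
... | false with nearest-above p {suc l} d eq (subst (λ t → p t ≡ true) (≡-sym (ℕₚ.+-suc d l)) pb)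
... | b , lb , bd , pb′ , h = b , <⇒≤ lb , subst (b ≤_) (ℕₚ.+-suc d l) bd , pb′ , λ i g g′ → case ℕₚ.m≤n⇒m<n∨m≡n g of λ
  { (inj₁ lt) → h i lt g′ ; (inj₂ refl) → pl }

-- Between two members of a clique on a special cycle this isolates a full run of non-members, the
-- situation that `shorten` exploits.
gap : ∀ (p : ℕ → Bool) {a l b} → a ≤ l → l ≤ b → p a ≡ true → p l ≡ false → p b ≡ true →
  ∃ λ a′ → ∃ λ b′ → a ≤ a′ × a′ < l × l < b′ × b′ ≤ b × p a′ ≡ true × p b′ ≡ true ×
    (∀ i → a′ < i → i < b′ → p i ≡ false)
gap p {a} {l} {b} al lb pa pl pb
  with nearest-below p (l ∸ a) pa (subst (λ t → p t ≡ false) (≡-sym (ℕₚ.m∸n+n≡m al)) pl)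
     | nearest-above p {l} (b ∸ l) pl (subst (λ t → p t ≡ true) (≡-sym (ℕₚ.m∸n+n≡m lb)) pb)
... | a′ , aa′ , a′l , pa′ , h | b′ , lb′ , b′b , pb′ , h′ =
  a′ , b′ , aa′ , subst (a′ <_) (ℕₚ.m∸n+n≡m al) a′l , lb′ , subst (b′ ≤_) (ℕₚ.m∸n+n≡m lb) b′b , pa′ , pb′ ,
  λ i g g′ → case ℕₚ.≤-total i l of λ
    { (inj₁ le) → h i g (subst (i ≤_) (≡-sym (ℕₚ.m∸n+n≡m al)) le) ; (inj₂ ge) → h′ i ge g′ }

pick : {A : Set} → A → A → A → ℕ → A
pick a b c 0 = a
pick a b c 1 = b
pick a b c _ = c

-- Maximal cliques form no special cycle

module CliqueFamily {ℓ : ℕ} (G : SimpleGraph ℓ) (ch : ChordProperty (EdgeRel G))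
  (no-suns : ∀ n → 2 < n → ¬ InducedSun G n) {J : Set} (C : Fin ℓ → J → Bool)
  (clique : ∀ j {a b} → C a j ≡ true → C b j ≡ true → a ≢ b → EdgeRel G a b)
  (maximal : ∀ j x → C x j ≡ false → ∃ λ y → C y j ≡ true × Adj G y x ≡ false)
  (cover : ∀ {a b} → EdgeRel G a b → ∃ λ j → C a j ≡ true × C b j ≡ true) where

  private
    V = Fin ℓ
    E = EdgeRel G

  C4-free : ∀ {a b c d} → a ≢ c → b ≢ d → E a b → E b c → E c d → E d a → E a c ⊎ E b d
  C4-free = four-cycle {E = E} ch (edge-sym G) (edge-irrefl G)

  -- Chordality nests the neighbourhoods in C j of the clique vertices outside C j.
  far-vertex : ∀ j (U : ℕ → V) t {w₀} → C w₀ j ≡ true →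
    (∀ {s s′} → s < t → s′ < t → s ≢ s′ → E (U s) (U s′)) →
    ∃ λ w → C w j ≡ true × (∀ s → s < t → C (U s) j ≡ false → Adj G w (U s) ≡ false)
  far-vertex j U zero {w₀} h adj = w₀ , h , λ s ()
  far-vertex j U (suc t) h adj with far-vertex j U t h (λ l l′ → adj (≤-trans l (n≤1+n _)) (≤-trans l′ (n≤1+n _)))
  ... | w , wC , far with C (U t) j in Ut | Adj G w (U t) in wt
  ...   | true | _ = w , wC , λ s l e → case ℕₚ.m≤n⇒m<n∨m≡n (ℕ.s≤s⁻¹ l) of λ
            { (inj₁ lt) → far s lt e ; (inj₂ refl) → absurd-bool Ut e }
  ...   | false | false = w , wC , λ s l e → case ℕₚ.m≤n⇒m<n∨m≡n (ℕ.s≤s⁻¹ l) of λ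
            { (inj₁ lt) → far s lt e ; (inj₂ refl) → wt }
  -- The new choice w′ misses U t by maximality. Were it adjacent to an earlier U s outside C j,
  -- then w, U t, U s, w′ would be a 4-cycle without chords, since w misses U s.
  ...   | false | true with maximal j (U t) Ut
  ...     | w′ , w′C , w′t = w′ , w′C , λ s l e → case ℕₚ.m≤n⇒m<n∨m≡n (ℕ.s≤s⁻¹ l) of λ
            { (inj₁ lt) → ¬true⇒false λ w′s → case C4-free {w} {U t} {U s} {w′}
                (λ { refl → absurd-bool wC e }) (λ { refl → absurd-bool w′C Ut })
                wt (adj ≤-refl l (λ { refl → <-irrefl refl lt })) (edge-sym G w′s)
                (clique j w′C wC (λ { refl → absurd-bool wt w′t })) of λ
                { (inj₁ ws) → absurd-bool ws (far s lt e)
                ; (inj₂ tw′) → absurd-bool (edge-sym G tw′) w′t }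
            ; (inj₂ refl) → w′t }

  module _ {m : ℕ} (P : SpecialCycle C m) where
    open SpecialCycle P

    module _ (adj : ∀ {s t} → s ≤ m → t ≤ m → s ≢ t → E (x s) (x t)) where
      private
        n>2 : 2 < suc m
        n>2 = s≤s m≥2
        bound : (i : Fin (suc m)) → toℕ i ≤ m
        bound i = ℕ.s≤s⁻¹ (Finₚ.toℕ<n i)

      u : Fin (suc m) → V
      u i = x (toℕ i)

      u-adj : ∀ {i j} → i ≢ j → E (u i) (u j)
      u-adj {i} {j} ne = adj (bound i) (bound j) (ne ∘ toℕ-injective)

      member : ∀ i {l} → l ≡ i ⊎ l ≡ csuc i → C (u l) (y (toℕ i)) ≡ true
      member i {l} (inj₁ refl) = inc (bound i) (bound i) (inj₁ refl)
      member i {l} (inj₂ refl) with csuc-spec i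
      ... | inj₁ (_ , e) = inc (bound l) (bound i) (inj₂ (inj₁ e))
      ... | inj₂ (e , e′) = inc (bound l) (bound i) (inj₂ (inj₂ (cong toℕ e′ , e)))

      nonmember : ∀ i {l} → l ≢ i → l ≢ csuc i → C (u l) (y (toℕ i)) ≡ false
      nonmember i {l} ne ne′ = exc (bound l) (bound i) λ
        { (inj₁ e) → ne (toℕ-injective e)
        ; (inj₂ (inj₁ e)) → case csuc-spec i of λ
          { (inj₁ (_ , e′)) → ne′ (toℕ-injective (trans e (≡-sym e′)))
          ; (inj₂ (e′ , _)) → <-irrefl refl (≤-trans (≤-reflexive (cong suc (≡-sym e′))) (≤-trans (≤-reflexive (≡-sym e)) (bound l))) }
        ; (inj₂ (inj₂ (e , e′))) → case csuc-spec i of λ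
          { (inj₁ (lt , _)) → <-irrefl e′ lt
          ; (inj₂ (_ , e″)) → ne′ (toℕ-injective (trans e (≡-sym (cong toℕ e″)))) } }

      private
        farᵢ : ∀ i → _
        farᵢ i = far-vertex (y (toℕ i)) x (suc m) (member i (inj₁ refl)) (λ l l′ → adj (ℕ.s≤s⁻¹ l) (ℕ.s≤s⁻¹ l′))

      w : Fin (suc m) → V
      w i = proj₁ (farᵢ i)

      w∈ : ∀ i → C (w i) (y (toℕ i)) ≡ true
      w∈ i = proj₁ (proj₂ (farᵢ i))

      w-far : ∀ i {l} → l ≢ i → l ≢ csuc i → Adj G (w i) (u l) ≡ false
      w-far i {l} ne ne′ = proj₂ (proj₂ (farᵢ i)) (toℕ l) (Finₚ.toℕ<n l) (nonmember i ne ne′)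

      w≢u : ∀ i l → w i ≢ u l
      w≢u i l e with l ≟ᶠ i | l ≟ᶠ csuc i
      ... | no ne | no ne′ = absurd-bool (w∈ i) (trans (cong (λ v → C v (y (toℕ i))) e) (nonmember i ne ne′))
      ... | yes refl | _ = absurd-bool (u-adj {l} {csuc (csuc l)} (csuc²-fixfree n>2 l ∘ ≡-sym))
          (subst (λ v → Adj G v (u (csuc (csuc l))) ≡ false) e
            (w-far i (csuc²-fixfree n>2 i) (csuc-fixfree (<⇒≤ n>2) (csuc i))))
      ... | no _ | yes refl = absurd-bool (u-adj {csuc i} {csuc (csuc i)} (csuc-fixfree (<⇒≤ n>2) (csuc i) ∘ ≡-sym))
          (subst (λ v → Adj G v (u (csuc (csuc i))) ≡ false) e
            (w-far i (csuc²-fixfree n>2 i) (csuc-fixfree (<⇒≤ n>2) (csuc i))))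

      w-adj : ∀ i {l} → l ≡ i ⊎ l ≡ csuc i → E (w i) (u l)
      w-adj i {l} h = clique (y (toℕ i)) (w∈ i) (member i h) (w≢u i l)

      private-foot : ∀ {i j : Fin (suc m)} → i ≢ j → ∃ λ a → (a ≡ i ⊎ a ≡ csuc i) × a ≢ j × a ≢ csuc j
      private-foot {i} {j} ne with i ≟ᶠ csuc j
      ... | no ne′ = i , inj₁ refl , ne , ne′
      ... | yes refl = csuc i , inj₂ refl , csuc²-fixfree n>2 j , csuc-fixfree (<⇒≤ n>2) (csuc j)

      w-distinct : ∀ {i j} → i ≢ j → w i ≢ w j
      w-distinct {i} {j} ne e with private-foot ne
      ... | a , h , aj , asj = absurd-bool (w-adj i h) (subst (λ v → Adj G v (u a) ≡ false) (≡-sym e) (w-far j aj asj))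

      -- Each of w i and w j has a neighbour among the u that the other one misses. An edge between
      -- w i and w j would close these four vertices to a 4-cycle without chords.
      w-nonadj : ∀ {i j} → i ≢ j → ¬ E (w i) (w j)
      w-nonadj {i} {j} ne e with private-foot ne | private-foot (ne ∘ ≡-sym)
      ... | a , ha , aj , asj | b , hb , bi , bsi with C4-free {w i} {u a} {u b} {w j} (w≢u i b) (w≢u j a ∘ ≡-sym)
            (w-adj i ha) (u-adj (λ { refl → absurd-bool (w-adj i ha) (w-far i bi bsi) })) (edge-sym G (w-adj j hb)) (edge-sym G e)
      ... | inj₁ h = absurd-bool h (w-far i bi bsi)
      ... | inj₂ h = absurd-bool (edge-sym G h) (w-far j aj asj)

      -- The u i are the central clique of a sun; w i, taken from the clique y i far from all other
      -- u l, is the outer vertex over u i and its successor.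
      clique-cycle-absurd : ⊥
      clique-cycle-absurd = no-suns (suc m) n>2 (f , (λ {a} {b} → f-inj a b) , λ a b → to a b , from a b)
        where
        f : Fin (suc m) ⊎ Fin (suc m) → V
        f (inj₁ i) = u i
        f (inj₂ i) = w i
        f-inj : ∀ a b → f a ≡ f b → a ≡ b
        f-inj (inj₁ i) (inj₁ j) e with i ≟ᶠ j
        ... | yes refl = refl
        ... | no ne = ⊥-elim (edge-≢ G (u-adj ne) e)
        f-inj (inj₁ i) (inj₂ j) e = ⊥-elim (w≢u j i (≡-sym e))
        f-inj (inj₂ i) (inj₁ j) e = ⊥-elim (w≢u i j e)
        f-inj (inj₂ i) (inj₂ j) e with i ≟ᶠ j
        ... | yes refl = refl
        ... | no ne = ⊥-elim (w-distinct ne e)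
        foot : ∀ i l → E (w i) (u l) → l ≡ i ⊎ l ≡ csuc i
        foot i l e with l ≟ᶠ i | l ≟ᶠ csuc i
        ... | yes h | _ = inj₁ h
        ... | no _ | yes h = inj₂ h
        ... | no h | no h′ = absurd-bool e (w-far i h h′)
        to : ∀ a b → E (f a) (f b) → SunAdj a b
        to (inj₁ i) (inj₁ j) e refl = edge-irrefl G e
        to (inj₁ i) (inj₂ j) e = foot j i (edge-sym G e)
        to (inj₂ i) (inj₁ j) e = foot i j e
        to (inj₂ i) (inj₂ j) e with i ≟ᶠ j
        ... | yes refl = edge-irrefl G e
        ... | no ne = w-nonadj ne e
        from : ∀ a b → SunAdj a b → E (f a) (f b)
        from (inj₁ i) (inj₁ j) ne = u-adj ne
        from (inj₁ i) (inj₂ j) h = edge-sym G (w-adj j h)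
        from (inj₂ i) (inj₁ j) h = w-adj i h

    -- Some clique of the cycle contains x s but not x t: y s unless t = s + 1, and otherwise the
    -- one preceding x s, which for s = 0 is y m.
    distinct : ∀ {s t} → s < t → t ≤ m → x s ≢ x t
    distinct {s} {t} st tm e with t ℕ.≟ suc s
    ... | no ne = absurd-bool (trans (cong (λ v → C v (y s)) (≡-sym e)) (inc (<⇒≤ (≤-trans st tm)) (<⇒≤ (≤-trans st tm)) (inj₁ refl)))
        (exc tm (<⇒≤ (≤-trans st tm)) λ
          { (inj₁ refl) → <-irrefl refl st ; (inj₂ (inj₁ h)) → ne h ; (inj₂ (inj₂ (refl , _))) → case st of λ () })
    distinct {zero} {t} st tm e | yes refl = absurd-bool (trans (cong (λ v → C v (y m)) (≡-sym e)) (inc z≤n ≤-refl (inj₂ (inj₂ (refl , refl)))))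
        (exc tm ≤-refl λ { (inj₁ h) → <-irrefl h m≥2 ; (inj₂ (inj₁ h)) → <-irrefl (ℕₚ.suc-injective h) (<⇒≤ m≥2) ; (inj₂ (inj₂ (() , _))) })
    distinct {suc s} {t} st tm e | yes refl = absurd-bool (trans (cong (λ v → C v (y s)) (≡-sym e)) (inc (<⇒≤ tm) s≤m (inj₂ (inj₁ refl))))
        (exc tm s≤m λ { (inj₁ h) → ℕₚ.m≢1+n+m s {1} (≡-sym h) ; (inj₂ (inj₁ h)) → ℕₚ.1+n≢n (ℕₚ.suc-injective h) ; (inj₂ (inj₂ (() , _))) })
      where
      s≤m : s ≤ m
      s≤m = ≤-trans (≤-trans (n≤1+n s) (n≤1+n (suc s))) tm

  edge-of : ∀ {m} (P : SpecialCycle C m) → let open SpecialCycle P in ∀ {s t j} → s < t → t ≤ m →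
    C (x s) j ≡ true → C (x t) j ≡ true → E (x s) (x t)
  edge-of P {j = j} st tm cs ct = clique j cs ct (distinct P st tm)

  consecutive : ∀ {m} (P : SpecialCycle C m) → let open SpecialCycle P in ∀ t → t < m → E (x t) (x (suc t))
  consecutive P t l = edge-of P ≤-refl l (inc (<⇒≤ l) (<⇒≤ l) (inj₁ refl)) (inc l (<⇒≤ l) (inj₂ (inj₁ refl)))
    where open SpecialCycle P

  closing : ∀ {m} (P : SpecialCycle C m) → let open SpecialCycle P in E (x 0) (x m)
  closing P = edge-of P (≤-trans (s≤s z≤n) m≥2) ≤-refl (inc z≤n ≤-refl (inj₂ (inj₂ (refl , refl)))) (inc ≤-refl ≤-refl (inj₁ refl))
    where open SpecialCycle P

  -- The arc from x a to x b is closed up by D, which takes the last place among the cliques;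
  -- `suc a < b` leaves at least three vertices.
  shorten : ∀ {m} (P : SpecialCycle C m) → let open SpecialCycle P in ∀ {a b} D → suc a < b → b ≤ m →
    C (x a) D ≡ true → C (x b) D ≡ true → (∀ i → a < i → i < b → C (x i) D ≡ false) → SpecialCycle C (b ∸ a)
  shorten {m} P {a} {b} D ab bm xa xb inner = record
    { x = λ i → x (i + a)
    ; y = y′
    ; m≥2 = subst (_≤ δ) (ℕₚ.m+n∸n≡m 2 a) (ℕₚ.∸-monoˡ-≤ a ab)
    ; inc = inc′
    ; exc = exc′
    }
    where
    open SpecialCycle P
    δ = b ∸ a
    δ+a : δ + a ≡ b
    δ+a = ℕₚ.m∸n+n≡m (≤-trans (n≤1+n a) (<⇒≤ ab))
    y′ : ℕ → J
    y′ j = if does (j ℕ.<? δ) then y (j + a) else D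
    y-low : ∀ {j} → j < δ → y′ j ≡ y (j + a)
    y-low {j} l rewrite dec-true (j ℕ.<? δ) l = refl
    y-last : ∀ {j} → ¬ (j < δ) → y′ j ≡ D
    y-last {j} l rewrite dec-false (j ℕ.<? δ) l = refl
    up : ∀ {i} → i ≤ δ → i + a ≤ m
    up {i} l = ≤-trans (ℕₚ.+-monoˡ-≤ a l) (≤-trans (≤-reflexive δ+a) bm)
    inc′ : ∀ {i j} → i ≤ δ → j ≤ δ → Inc δ i j → C (x (i + a)) (y′ j) ≡ true
    inc′ {i} {j} li lj h with j ℕ.<? δ
    ... | yes l = trans (cong (C (x (i + a))) (y-low l)) (low h)
      where
      low : Inc δ i j → C (x (i + a)) (y (j + a)) ≡ true
      low (inj₁ refl) = inc (up li) (up lj) (inj₁ refl)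
      low (inj₂ (inj₁ refl)) = inc (up li) (up lj) (inj₂ (inj₁ refl))
      low (inj₂ (inj₂ (_ , refl))) = ⊥-elim (<-irrefl refl l)
    ... | no ¬l = trans (cong (C (x (i + a))) (y-last ¬l)) (last h)
      where
      j≡δ : j ≡ δ
      j≡δ = ≤-antisym lj (ℕₚ.≮⇒≥ ¬l)
      last : Inc δ i j → C (x (i + a)) D ≡ true
      last (inj₁ e) = subst (λ t → C (x t) D ≡ true) (≡-sym (trans (cong (_+ a) (trans e j≡δ)) δ+a)) xb
      last (inj₂ (inj₁ e)) = ⊥-elim (<-irrefl refl (≤-trans (≤-reflexive (trans (cong suc (≡-sym j≡δ)) (≡-sym e))) li))
      last (inj₂ (inj₂ (refl , _))) = xa
    exc′ : ∀ {i j} → i ≤ δ → j ≤ δ → ¬ Inc δ i j → C (x (i + a)) (y′ j) ≡ false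
    exc′ {i} {j} li lj h with j ℕ.<? δ
    ... | yes l = trans (cong (C (x (i + a))) (y-low l)) (exc (up li) (up lj) λ
          { (inj₁ e) → h (inj₁ (ℕₚ.+-cancelʳ-≡ a i j e))
          ; (inj₂ (inj₁ e)) → h (inj₂ (inj₁ (ℕₚ.+-cancelʳ-≡ a i (suc j) e)))
          ; (inj₂ (inj₂ (_ , e))) → <-irrefl e (≤-trans (ℕₚ.+-monoˡ-≤ a l) (≤-trans (≤-reflexive δ+a) bm)) })
    ... | no ¬l = trans (cong (C (x (i + a))) (y-last ¬l)) (inner (i + a) (pos i i≢0)
            (subst (i + a <_) δ+a (ℕₚ.+-monoˡ-≤ a (ℕₚ.≤∧≢⇒< li (λ e → h (inj₁ (trans e (≡-sym j≡δ))))))))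
      where
      j≡δ : j ≡ δ
      j≡δ = ≤-antisym lj (ℕₚ.≮⇒≥ ¬l)
      i≢0 : i ≢ 0
      i≢0 e = h (inj₂ (inj₂ (e , j≡δ)))
      pos : ∀ i → i ≢ 0 → a < i + a
      pos zero ne = ⊥-elim (ne refl)
      pos (suc i) _ = s≤s (ℕₚ.m≤n+m a i)

  triangle-cycle : ∀ {p q r A B D} → C p A ≡ true → C q A ≡ true → C r A ≡ false →
    C p B ≡ false → C q B ≡ true → C r B ≡ true → C p D ≡ true → C q D ≡ false → C r D ≡ true → SpecialCycle C 2
  triangle-cycle {p} {q} {r} {A} {B} {D} pA qA rA pB qB rB pD qD rD = record
    { x = pick p q r ; y = pick A B D ; m≥2 = ≤-refl ; inc = inc′ ; exc = exc′ }
    where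
    inc′ : ∀ {i j} → i ≤ 2 → j ≤ 2 → Inc 2 i j → C (pick p q r i) (pick A B D j) ≡ true
    inc′ {0} {0} _ _ _ = pA
    inc′ {1} {0} _ _ _ = qA
    inc′ {2} {0} _ _ (inj₂ (inj₁ ()))
    inc′ {2} {0} _ _ (inj₂ (inj₂ (() , _)))
    inc′ {0} {1} _ _ (inj₂ (inj₂ (_ , ())))
    inc′ {1} {1} _ _ _ = qB
    inc′ {2} {1} _ _ _ = rB
    inc′ {0} {2} _ _ _ = pD
    inc′ {1} {2} _ _ (inj₂ (inj₁ ()))
    inc′ {1} {2} _ _ (inj₂ (inj₂ (() , _)))
    inc′ {2} {2} _ _ _ = rD
    inc′ {suc (suc (suc _))} (s≤s (s≤s ()))
    inc′ {_} {suc (suc (suc _))} _ (s≤s (s≤s ()))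
    exc′ : ∀ {i j} → i ≤ 2 → j ≤ 2 → ¬ Inc 2 i j → C (pick p q r i) (pick A B D j) ≡ false
    exc′ {0} {0} _ _ h = ⊥-elim (h (inj₁ refl))
    exc′ {1} {0} _ _ h = ⊥-elim (h (inj₂ (inj₁ refl)))
    exc′ {2} {0} _ _ h = rA
    exc′ {0} {1} _ _ h = pB
    exc′ {1} {1} _ _ h = ⊥-elim (h (inj₁ refl))
    exc′ {2} {1} _ _ h = ⊥-elim (h (inj₂ (inj₁ refl)))
    exc′ {0} {2} _ _ h = ⊥-elim (h (inj₂ (inj₂ (refl , refl))))
    exc′ {1} {2} _ _ h = qD
    exc′ {2} {2} _ _ h = ⊥-elim (h (inj₁ refl))
    exc′ {suc (suc (suc _))} (s≤s (s≤s ()))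
    exc′ {_} {suc (suc (suc _))} _ (s≤s (s≤s ()))

  -- For m = 2 the x are pairwise adjacent and give a sun. For larger m some x t is adjacent to x 0
  -- and x m; take cliques A through x 0, x t and B through x t, x m. If A misses x m and B misses x
  -- 0, then A, B and y m form a shorter special cycle. Otherwise one of them contains three of the
  -- vertices and `three` applies.
  no-special-cycle : ∀ m → Acc _<_ m → ¬ SpecialCycle C m
  no-special-cycle m (acc rs) P = by-length (ℕₚ.m≤n⇒m<n∨m≡n m≥2)
    where
    open SpecialCycle P
    in-clique : ∀ j → (∀ {t} → t ≤ m → C (x t) j ≡ true) → ⊥
    in-clique j all = clique-cycle-absurd P λ {s} {t} sm tm ne → case ℕₚ.<-cmp s t of λ
      { (tri< l _ _) → edge-of P l tm (all sm) (all tm)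
      ; (tri≈ _ e _) → ⊥-elim (ne e)
      ; (tri> _ _ l) → edge-sym G (edge-of P l sm (all tm) (all sm)) }
    -- A set containing x₀, x_m and some x_t between contains all of them, else the cycle shortens.
    three : ∀ j t → 0 < t → t < m → C (x 0) j ≡ true → C (x t) j ≡ true → C (x m) j ≡ true → ⊥
    three j t 0<t t<m c0 ct cm = in-clique j all
      where
      stretch : ∀ {a l b} → a ≤ l → l ≤ b → b ≤ m → b ∸ a < m → C (x a) j ≡ true → C (x b) j ≡ true → C (x l) j ≡ true
      stretch {a} {l} {b} al lb bm d ca cb with C (x l) j in eq
      ... | true = refl
      ... | false with gap (λ i → C (x i) j) al lb ca eq cb
      ... | a′ , b′ , aa′ , a′l , lb′ , b′b , ca′ , cb′ , inner =
        ⊥-elim (no-special-cycle (b′ ∸ a′) (rs d′) (shorten P j (≤-trans (s≤s a′l) lb′) (≤-trans b′b bm) ca′ cb′ inner))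
        where
        d′ : b′ ∸ a′ < m
        d′ = ≤-trans (s≤s (ℕₚ.∸-mono b′b aa′)) d
      all : ∀ {l} → l ≤ m → C (x l) j ≡ true
      -- Splitting at t makes both index ranges shorter than m, so any gap leads to a strictly
      -- smaller cycle.
      all {l} lm with ℕₚ.≤-total l t
      ... | inj₁ le = stretch z≤n le (<⇒≤ t<m) t<m c0 ct
      ... | inj₂ ge = stretch ge lm ≤-refl (ℕₚ.∸-monoʳ-< 0<t (<⇒≤ t<m)) ct cm
    S : V → Set
    S z = ∃ λ t → 0 < t × t < m × z ≡ x t
    by-length : 2 < m ⊎ 2 ≡ m → ⊥
    by-length (inj₂ refl) = clique-cycle-absurd P adj
      where
      adj : ∀ {s t} → s ≤ 2 → t ≤ 2 → s ≢ t → E (x s) (x t)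
      adj {0} {0} _ _ ne = ⊥-elim (ne refl)
      adj {0} {1} _ _ _ = consecutive P 0 (s≤s z≤n)
      adj {0} {2} _ _ _ = closing P
      adj {1} {0} _ _ _ = edge-sym G (consecutive P 0 (s≤s z≤n))
      adj {1} {1} _ _ ne = ⊥-elim (ne refl)
      adj {1} {2} _ _ _ = consecutive P 1 (s≤s (s≤s z≤n))
      adj {2} {0} _ _ _ = edge-sym G (closing P)
      adj {2} {1} _ _ _ = edge-sym G (consecutive P 1 (s≤s (s≤s z≤n)))
      adj {2} {2} _ _ ne = ⊥-elim (ne refl)
      adj {suc (suc (suc _))} (s≤s (s≤s ()))
      adj {_} {suc (suc (suc _))} _ (s≤s (s≤s ()))
    by-length (inj₁ m>2) = conclude (ch {x 0} {x m} S
        (λ { (t , p , l , e) → distinct P p (<⇒≤ l) e }) (λ { (t , p , l , e) → distinct P l ≤-refl (≡-sym e) })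
        (closing P) (consecutive P 0 (<⇒≤ m≥2))
        (segment-walk {E = E} x 1 (m ∸ 2) (λ t _ l → consecutive P t (≤-trans l (≤-trans (n≤1+n _) (≤-reflexive pm))))
          (λ t p l → t , p , ≤-trans (s≤s l) (≤-reflexive pm) , refl))
        (subst (λ t → E (x (m ∸ 2 + 1)) (x t)) pm (consecutive P (m ∸ 2 + 1) (≤-reflexive pm))))
      where
      pm : suc (m ∸ 2 + 1) ≡ m
      pm = trans (≡-sym (ℕₚ.+-suc (m ∸ 2) 1)) (ℕₚ.m∸n+n≡m m≥2)
      conclude : (∃ λ z → S z × E z (x 0) × E z (x m)) → ⊥
      conclude (_ , (t , 0<t , t<m , refl) , e0 , em) with cover e0 | cover em
      ... | A , tA , 0A | B , tB , mB with C (x m) A in mA | C (x 0) B in 0B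
      ...   | true | _ = three A t 0<t t<m 0A tA mA
      ...   | false | true = three B t 0<t t<m 0B tB mB
      ...   | false | false = no-special-cycle 2 (rs m>2) (triangle-cycle {D = y m} 0A tA mA 0B tB mB
                (inc z≤n ≤-refl (inj₂ (inj₂ (refl , refl))))
                (exc (<⇒≤ t<m) ≤-refl λ { (inj₁ e) → <-irrefl e t<m
                                        ; (inj₂ (inj₁ e)) → <-irrefl e (≤-trans t<m (n≤1+n m))
                                        ; (inj₂ (inj₂ (e , _))) → <-irrefl (≡-sym e) 0<t })
                (inc ≤-refl ≤-refl (inj₁ refl)))

-- Doubly lexical orderings

transpose : ∀ {X Y : Set} → (X → Y → Bool) → Y → X → Bool
transpose M j i = M i j

-- Rows increase lexicographically, later columns being more significant.
LexRows : ∀ {n m} → (Fin n → Fin m → Bool) → Set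
LexRows {n} {m} M = ∀ {i i′ : Fin n} {j : Fin m} → i Fin.< i′ → M i j ≡ true → M i′ j ≡ false →
  ∃ λ j′ → j Fin.< j′ × M i j′ ≡ false × M i′ j′ ≡ true × (∀ c → j′ Fin.< c → M i c ≡ M i′ c)

snoc : ∀ {X : Set} → ℕ → (ℕ → X) → X → ℕ → X
snoc k f z i = if does (i ℕ.≤? k) then f i else z

snoc-low : ∀ {X : Set} {k} (f : ℕ → X) z {i} → i ≤ k → snoc k f z i ≡ f i
snoc-low {k = k} f z {i} l rewrite dec-true (i ℕ.≤? k) l = refl

snoc-last : ∀ {X : Set} {k} (f : ℕ → X) z → snoc k f z (suc k) ≡ z
snoc-last {k = k} f z rewrite dec-false (suc k ℕ.≤? k) (<-irrefl refl) = refl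

cons : ∀ {X : Set} → X → (ℕ → X) → ℕ → X
cons z f zero = z
cons z f (suc i) = f i

-- An induced path x₀ y₀ x₁ y₁ … x_k y_k, grown from a Γ at both ends towards later rows and columns.
record Zigzag {n m} (M : Fin n → Fin m → Bool) (k : ℕ) : Set where
  field
    x : ℕ → Fin n
    y : ℕ → Fin m
    k≥1 : 1 ≤ k
    inc : ∀ {i j} → i ≤ k → j ≤ k → i ≡ j ⊎ i ≡ suc j → M (x i) (y j) ≡ true
    exc : ∀ {i j} → i ≤ k → j ≤ k → ¬ (i ≡ j ⊎ i ≡ suc j) → M (x i) (y j) ≡ false
    x-order : x k Fin.< x 0
    y-order : y 0 Fin.< y k
    rows-agree : ∀ c → y k Fin.< c → ∀ {i} → 1 ≤ i → i ≤ k → M (x i) c ≡ M (x k) c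
    cols-agree : ∀ r → x 0 Fin.< r → ∀ {j} → j < k → M r (y j) ≡ M r (y 0)

module Extend {n m} {M : Fin n → Fin m → Bool} {k} (Z : Zigzag M k)
  (c : Fin m) (yc : Zigzag.y Z k Fin.< c) (xkc : M (Zigzag.x Z k) c ≡ false) (x0c : M (Zigzag.x Z 0) c ≡ true)
  (c-agree : ∀ c′ → c Fin.< c′ → M (Zigzag.x Z k) c′ ≡ M (Zigzag.x Z 0) c′)
  (r : Fin n) (xr : Zigzag.x Z 0 Fin.< r) (ry0 : M r (Zigzag.y Z 0) ≡ false) (ryk : M r (Zigzag.y Z k) ≡ true)
  (r-agree : ∀ r′ → r Fin.< r′ → M r′ (Zigzag.y Z 0) ≡ M r′ (Zigzag.y Z k)) where
  open Zigzag Z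

  rows : ℕ → Fin n
  rows = snoc k x r

  row-y : ∀ {i j} → i ≤ suc k → j ≤ k → i ≡ j ⊎ i ≡ suc j → M (rows i) (y j) ≡ true
  row-y {i} {j} li lj h with ℕₚ.m≤n⇒m<n∨m≡n li
  ... | inj₁ (s≤s l) = trans (cong (λ z → M z (y j)) (snoc-low x r l)) (inc l lj h)
  ... | inj₂ refl with h
  ...   | inj₁ refl = ⊥-elim (<-irrefl refl lj)
  ...   | inj₂ refl = trans (cong (λ z → M z (y k)) (snoc-last {k = k} x r)) ryk

  row-y-exc : ∀ {i j} → i ≤ suc k → j ≤ k → ¬ (i ≡ j ⊎ i ≡ suc j) → M (rows i) (y j) ≡ false
  row-y-exc {i} {j} li lj h with ℕₚ.m≤n⇒m<n∨m≡n li
  ... | inj₁ (s≤s l) = trans (cong (λ z → M z (y j)) (snoc-low x r l)) (exc l lj h)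
  ... | inj₂ refl = trans (cong (λ z → M z (y j)) (snoc-last {k = k} x r))
    (trans (cols-agree r xr (ℕₚ.≤∧≢⇒< lj λ e → h (inj₂ (cong suc (≡-sym e))))) ry0)

  row-c : ∀ {i} → 1 ≤ i → i ≤ k → M (rows i) c ≡ false
  row-c l l′ = trans (cong (λ z → M z c) (snoc-low x r l′)) (trans (rows-agree c yc l l′) xkc)

  first-c : M (rows 0) c ≡ true
  first-c = x0c

  last-c : ∀ {b} → M r c ≡ b → M (rows (suc k)) c ≡ b
  last-c e = trans (cong (λ z → M z c) (snoc-last {k = k} x r)) e

  -- The zeros at (x k, c) and (r, y 0) spread, by `rows-agree` and `cols-agree`, to all other
  -- places where c or r must not meet the path, so the closed path is induced.
  close : M r c ≡ true → SpecialCycle M (suc k)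
  close rc = record
    { x = rows ; y = snoc k y c ; m≥2 = s≤s k≥1 ; inc = inc′ ; exc = exc′ }
    where
    inc′ : ∀ {i j} → i ≤ suc k → j ≤ suc k → Inc (suc k) i j → M (rows i) (snoc k y c j) ≡ true
    inc′ {i} {j} li lj h with ℕₚ.m≤n⇒m<n∨m≡n lj
    ... | inj₁ (s≤s l) = trans (cong (M (rows i)) (snoc-low y c l)) (row-y li l (low h))
      where
      low : Inc (suc k) i j → i ≡ j ⊎ i ≡ suc j
      low (inj₁ e) = inj₁ e
      low (inj₂ (inj₁ e)) = inj₂ e
      low (inj₂ (inj₂ (_ , refl))) = ⊥-elim (<-irrefl refl l)
    ... | inj₂ refl = trans (cong (M (rows i)) (snoc-last {k = k} y c)) (last h)
      where
      last : Inc (suc k) i (suc k) → M (rows i) c ≡ true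
      last (inj₁ refl) = last-c rc
      last (inj₂ (inj₁ refl)) = ⊥-elim (<-irrefl refl li)
      last (inj₂ (inj₂ (refl , _))) = first-c
    exc′ : ∀ {i j} → i ≤ suc k → j ≤ suc k → ¬ Inc (suc k) i j → M (rows i) (snoc k y c j) ≡ false
    exc′ {i} {j} li lj h with ℕₚ.m≤n⇒m<n∨m≡n lj
    ... | inj₁ (s≤s l) = trans (cong (M (rows i)) (snoc-low y c l)) (row-y-exc li l
          (λ { (inj₁ e) → h (inj₁ e) ; (inj₂ e) → h (inj₂ (inj₁ e)) }))
    ... | inj₂ refl = trans (cong (M (rows i)) (snoc-last {k = k} y c))
          (row-c (ℕₚ.n≢0⇒n>0 λ e → h (inj₂ (inj₂ (e , refl)))) (ℕ.s≤s⁻¹ (ℕₚ.≤∧≢⇒< li λ e → h (inj₁ e))))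

  -- With c in front and r at the end the path begins with a column, hence is a zigzag of the
  -- transpose. `c-agree` and `r-agree` renew the two agreement fields beyond the new ends.
  extend : M r c ≡ false → Zigzag (transpose M) (suc k)
  extend rc = record
    { x = cons c y ; y = rows ; k≥1 = s≤s z≤n
    ; inc = inc′ ; exc = exc′
    ; x-order = yc
    ; y-order = subst (x 0 Fin.<_) (≡-sym (snoc-last {k = k} x r)) xr
    ; rows-agree = λ r′ l {i} → agree r′ (subst (Fin._< r′) (snoc-last {k = k} x r) l)
    ; cols-agree = λ c′ l {j} j≤k → agree′ c′ l (ℕ.s≤s⁻¹ j≤k)
    }
    where
    inc′ : ∀ {i j} → i ≤ suc k → j ≤ suc k → i ≡ j ⊎ i ≡ suc j → M (rows j) (cons c y i) ≡ true
    inc′ {zero} {j} li lj (inj₁ refl) = first-c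
    inc′ {suc i} {j} (s≤s li) lj (inj₁ refl) = row-y lj li (inj₂ refl)
    inc′ {suc i} {j} (s≤s li) lj (inj₂ refl) = row-y lj li (inj₁ refl)
    exc′ : ∀ {i j} → i ≤ suc k → j ≤ suc k → ¬ (i ≡ j ⊎ i ≡ suc j) → M (rows j) (cons c y i) ≡ false
    exc′ {zero} {j} li lj h with ℕₚ.m≤n⇒m<n∨m≡n lj
    ... | inj₁ (s≤s l) = row-c (ℕₚ.n≢0⇒n>0 λ e → h (inj₁ (≡-sym e))) l
    ... | inj₂ refl = last-c rc
    exc′ {suc i} {j} (s≤s li) lj h = row-y-exc lj li
      (λ { (inj₁ e) → h (inj₂ (cong suc (≡-sym e))) ; (inj₂ e) → h (inj₁ (≡-sym e)) })
    agree : ∀ r′ → r Fin.< r′ → ∀ {i} → 1 ≤ i → i ≤ suc k → M r′ (cons c y i) ≡ M r′ (y k)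
    agree r′ l {suc i} _ (s≤s li) with ℕₚ.m≤n⇒m<n∨m≡n li
    ... | inj₂ refl = refl
    ... | inj₁ lt = trans (cols-agree r′ (<-trans xr l) lt) (r-agree r′ l)
    agree′ : ∀ c′ → c Fin.< c′ → ∀ {j} → j ≤ k → M (rows j) c′ ≡ M (rows 0) c′
    agree′ c′ l {zero} _ = refl
    agree′ c′ l {suc j} lj = trans (cong (λ z → M z c′) (snoc-low x r lj))
      (trans (rows-agree c′ (<-trans yc l) (s≤s z≤n) lj) (c-agree c′ l))

-- Lexicographic order supplies c and r. No cycle can close, so the zigzag grows for ever; but c
-- lies beyond y k and r beyond x 0, so the sum of the two end indices increases strictly while it
-- stays below n + m.
chase : ∀ fuel {n m} (M : Fin n → Fin m → Bool) → LexRows M → LexRows (transpose M) →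
  (∀ k → ¬ SpecialCycle M k) → (∀ k → ¬ SpecialCycle (transpose M) k) →
  ∀ {k} (Z : Zigzag M k) → n + m ≤ fuel + (toℕ (Zigzag.x Z 0) + toℕ (Zigzag.y Z k)) → ⊥
chase zero M lr lc nc nc′ {k} Z le =
  <-irrefl refl (≤-trans (ℕₚ.+-mono-< (Finₚ.toℕ<n (x 0)) (Finₚ.toℕ<n (y k))) le)
  where open Zigzag Z
chase (suc fuel) {n} {m} M lr lc nc nc′ {k} Z le
  with lr {j = Zigzag.y Z k} (Zigzag.x-order Z) (Zigzag.inc Z ≤-refl ≤-refl (inj₁ refl))
         (Zigzag.exc Z z≤n ≤-refl (λ { (inj₁ e) → <-irrefl e (Zigzag.k≥1 Z) ; (inj₂ ()) }))
     | lc {j = Zigzag.x Z 0} (Zigzag.y-order Z) (Zigzag.inc Z z≤n z≤n (inj₁ refl))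
         (Zigzag.exc Z z≤n ≤-refl (λ { (inj₁ e) → <-irrefl e (Zigzag.k≥1 Z) ; (inj₂ ()) }))
... | c , yc , xkc , x0c , c-agree | r , xr , ry0 , ryk , r-agree with M r c in rc
... | true = nc _ (Extend.close Z c yc xkc x0c c-agree r xr ry0 ryk r-agree rc)
... | false = chase fuel (transpose M) lc lr nc′ nc Z′ (subst₂ _≤_ (ℕₚ.+-comm n m) refl (≤-trans le grow))
  where
  open Zigzag Z
  Z′ : Zigzag (transpose M) (suc k)
  Z′ = Extend.extend Z c yc xkc x0c c-agree r xr ry0 ryk r-agree rc
  grow : suc fuel + (toℕ (x 0) + toℕ (y k)) ≤ fuel + (toℕ c + toℕ (snoc k x r (suc k)))
  grow rewrite snoc-last {k = k} x r = ≤-trans (≤-reflexive (≡-sym (ℕₚ.+-suc fuel _)))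
    (ℕₚ.+-monoʳ-≤ fuel (≤-trans (ℕₚ.+-mono-≤ xr (<⇒≤ yc)) (≤-reflexive (ℕₚ.+-comm (toℕ r) (toℕ c)))))

-- The same cycle read from y 0 on: x 1 now follows y 0, and x 0 comes last.
transpose-cycle : ∀ {X Y : Set} {M : X → Y → Bool} {k} → SpecialCycle (transpose M) k → SpecialCycle M k
transpose-cycle {M = M} {k} P = record { x = y ; y = Y ; m≥2 = m≥2 ; inc = inc′ ; exc = exc′ }
  where
  open SpecialCycle P
  Y : ℕ → _
  Y j = if does (j ℕ.<? k) then x (suc j) else x 0
  Y-low : ∀ {j} → j < k → Y j ≡ x (suc j)
  Y-low {j} l rewrite dec-true (j ℕ.<? k) l = refl
  Y-last : Y k ≡ x 0
  Y-last rewrite dec-false (k ℕ.<? k) (<-irrefl refl) = refl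
  inc′ : ∀ {i j} → i ≤ k → j ≤ k → Inc k i j → M (y i) (Y j) ≡ true
  inc′ {i} {j} li lj h with ℕₚ.m≤n⇒m<n∨m≡n lj
  inc′ {i} {j} li lj (inj₁ refl) | inj₁ l = trans (cong (M (y i)) (Y-low l)) (inc l li (inj₂ (inj₁ refl)))
  inc′ {i} {j} li lj (inj₂ (inj₁ refl)) | inj₁ l = trans (cong (M (y i)) (Y-low l)) (inc l li (inj₁ refl))
  inc′ {i} {j} li lj (inj₂ (inj₂ (_ , e))) | inj₁ l = ⊥-elim (<-irrefl e l)
  inc′ {i} {j} li lj (inj₁ refl) | inj₂ refl = trans (cong (M (y i)) Y-last) (inc z≤n li (inj₂ (inj₂ (refl , refl))))
  inc′ {i} {j} li lj (inj₂ (inj₁ e)) | inj₂ refl = ⊥-elim (<-irrefl refl (≤-trans (≤-reflexive (≡-sym e)) li))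
  inc′ {i} {j} li lj (inj₂ (inj₂ (refl , _))) | inj₂ refl = trans (cong (M (y i)) Y-last) (inc z≤n li (inj₁ refl))
  exc′ : ∀ {i j} → i ≤ k → j ≤ k → ¬ Inc k i j → M (y i) (Y j) ≡ false
  exc′ {i} {j} li lj h with ℕₚ.m≤n⇒m<n∨m≡n lj
  ... | inj₁ l = trans (cong (M (y i)) (Y-low l)) (exc l li λ
        { (inj₁ e) → h (inj₂ (inj₁ (≡-sym e))) ; (inj₂ (inj₁ e)) → h (inj₁ (ℕₚ.suc-injective (≡-sym e))) ; (inj₂ (inj₂ (() , _))) })
  ... | inj₂ refl = trans (cong (M (y i)) Y-last) (exc z≤n li λ
        { (inj₁ e) → h (inj₂ (inj₂ (≡-sym e , refl))) ; (inj₂ (inj₁ ())) ; (inj₂ (inj₂ (_ , e))) → h (inj₁ e) })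

-- A missing corner is itself a zigzag with k = 1, with rows i′, i and columns j, j′, from which
-- `chase` starts.
Γ-free : ∀ {n m} (M : Fin n → Fin m → Bool) → LexRows M → LexRows (transpose M) → (∀ k → ¬ SpecialCycle M k) →
  ∀ {i i′ j j′} → i Fin.< i′ → j Fin.< j′ → M i j ≡ true → M i j′ ≡ true → M i′ j ≡ true → M i′ j′ ≡ true
Γ-free {n} {m} M lr lc nc {i} {i′} {j} {j′} ii jj a b c with M i′ j′ in d
... | true = refl
... | false = ⊥-elim (chase (n + m) M lr lc nc (λ k → nc k ∘ transpose-cycle) Z (ℕₚ.m≤m+n (n + m) _))
  where
  inc′ : ∀ {s t} → s ≤ 1 → t ≤ 1 → s ≡ t ⊎ s ≡ suc t → M (cons i′ (λ _ → i) s) (cons j (λ _ → j′) t) ≡ true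
  inc′ {zero} {zero} _ _ _ = c
  inc′ {zero} {suc t} _ _ (inj₁ ())
  inc′ {suc s} {zero} _ _ _ = a
  inc′ {suc s} {suc t} _ _ _ = b
  exc′ : ∀ {s t} → s ≤ 1 → t ≤ 1 → ¬ (s ≡ t ⊎ s ≡ suc t) → M (cons i′ (λ _ → i) s) (cons j (λ _ → j′) t) ≡ false
  exc′ {zero} {zero} _ _ h = ⊥-elim (h (inj₁ refl))
  exc′ {zero} {suc t} _ _ _ = d
  exc′ {suc .0} {zero} (s≤s z≤n) _ h = ⊥-elim (h (inj₂ refl))
  exc′ {suc .0} {suc .0} (s≤s z≤n) (s≤s z≤n) h = ⊥-elim (h (inj₁ refl))
  Z : Zigzag M 1
  Z = record
    { x = cons i′ (λ _ → i) ; y = cons j (λ _ → j′) ; k≥1 = ≤-refl ; inc = inc′ ; exc = exc′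
    ; x-order = ii ; y-order = jj
    ; rows-agree = λ { _ _ {suc _} _ _ → refl }
    ; cols-agree = λ { _ _ {zero} _ → refl ; _ _ {suc _} (s≤s ()) } }

-- Existence of doubly lexical orderings

weigh : ∀ {X : Set} → (X → ℕ) → List X → ℕ
weigh f [] = 0
weigh f (x ∷ xs) = f x + 2 * weigh f xs

weigh-linear : ∀ {X : Set} (f g : X → ℕ) xs → weigh (λ x → f x + 2 * g x) xs ≡ weigh f xs + 2 * weigh g xs
weigh-linear f g [] = refl
weigh-linear f g (x ∷ xs) rewrite weigh-linear f g xs = arith (f x) (g x) (weigh f xs) (weigh g xs)
  where
  arith : ∀ a b c d → a + 2 * b + 2 * (c + 2 * d) ≡ a + 2 * c + 2 * (b + 2 * d)
  arith = solve-∀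

weigh-zero : ∀ {Y : Set} (ys : List Y) → weigh (λ _ → 0) ys ≡ 0
weigh-zero [] = refl
weigh-zero (y ∷ ys) rewrite weigh-zero ys = refl

-- This makes `total` symmetric in rows and columns, so the same potential rises whichever of the
-- two is improved.
weigh-swap : ∀ {X Y : Set} (g : X → Y → ℕ) xs ys →
  weigh (λ x → weigh (g x) ys) xs ≡ weigh (λ y → weigh (λ x → g x y) xs) ys
weigh-swap g [] ys = ≡-sym (weigh-zero ys)
weigh-swap g (x ∷ xs) ys = trans (cong (λ t → weigh (g x) ys + 2 * t) (weigh-swap g xs ys))
  (≡-sym (weigh-linear (g x) (λ y → weigh (λ x → g x y) xs) ys))

-- The number 2^l - 1, the largest value of l binary digits; in `weigh`, entry i has weight 2^i.
full : ℕ → ℕ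
full zero = 0
full (suc l) = 1 + 2 * full l

weigh-bound : ∀ {X : Set} (f : X → ℕ) B → (∀ x → f x ≤ B) → ∀ xs → weigh f xs ≤ B * full (length xs)
weigh-bound f B h [] = z≤n
weigh-bound f B h (x ∷ xs) = ≤-trans (ℕₚ.+-mono-≤ (h x) (ℕₚ.*-monoʳ-≤ 2 (weigh-bound f B h xs)))
  (≤-reflexive (arith B (full (length xs))))
  where
  arith : ∀ b p → b + 2 * (b * p) ≡ b * (1 + 2 * p)
  arith = solve-∀

sorted-or-improvable : ∀ {X : Set} (f : X → ℕ) xs →
  AllPairs (λ x y → f x ≤ f y) xs ⊎ (∃ λ ys → ys ↭ xs × weigh f xs < weigh f ys)
sorted-or-improvable f [] = inj₁ []
sorted-or-improvable f (x ∷ xs) with sorted-or-improvable f xs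
... | inj₂ (ys , p , lt) = inj₂ (x ∷ ys , prep x p , ℕₚ.+-monoʳ-< (f x) (ℕₚ.*-monoʳ-< 2 lt))
sorted-or-improvable f (x ∷ []) | inj₁ s = inj₁ ([] ∷ s)
sorted-or-improvable f (x ∷ y ∷ xs) | inj₁ (h ∷ s) with f x ℕ.≤? f y
... | yes le = inj₁ ((le ∷ All.map (≤-trans le) h) ∷ h ∷ s)
... | no gt = inj₂ (y ∷ x ∷ xs , swap y x ↭-refl , lt)
  where
  arith : ∀ a b w → b + a + (b + 4 * w) ≡ a + 2 * (b + 2 * w)
  arith = solve-∀
  arith′ : ∀ a b w → b + a + (a + 4 * w) ≡ b + 2 * (a + 2 * w)
  arith′ = solve-∀
  lt : f x + 2 * (f y + 2 * weigh f xs) < f y + 2 * (f x + 2 * weigh f xs)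
  lt = subst₂ _<_ (arith (f x) (f y) (weigh f xs)) (arith′ (f x) (f y) (weigh f xs))
    (ℕₚ.+-monoʳ-< (f y + f x) (ℕₚ.+-monoˡ-< (4 * weigh f xs) (ℕₚ.≰⇒> gt)))

module _ {X Y : Set} (A : X → Y → Bool) where
  rowWeight : List Y → X → ℕ
  rowWeight ys x = weigh (λ y → bit (A x y)) ys

  colWeight : List X → Y → ℕ
  colWeight xs y = weigh (λ x → bit (A x y)) xs

  total : List X → List Y → ℕ
  total xs ys = weigh (rowWeight ys) xs

  total-bound : ∀ xs ys → total xs ys ≤ 1 * full (length ys) * full (length xs)
  total-bound xs ys = weigh-bound (rowWeight ys) _ (λ x → weigh-bound _ 1 (λ y → bit≤1 (A x y)) ys) xs

  DoublySorted : List X → List Y → Set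
  DoublySorted xs ys = AllPairs (λ x x′ → rowWeight ys x ≤ rowWeight ys x′) xs ×
                       AllPairs (λ y y′ → colWeight xs y ≤ colWeight xs y′) ys

  -- Swapping two neighbouring rows or columns that are out of order increases `total`.
  doubly-sort : ∀ fuel xs ys → 1 * full (length ys) * full (length xs) ≤ fuel + total xs ys →
    ∃ λ xs′ → ∃ λ ys′ → xs′ ↭ xs × ys′ ↭ ys × DoublySorted xs′ ys′
  doubly-sort fuel xs ys le with sorted-or-improvable (rowWeight ys) xs | sorted-or-improvable (colWeight xs) ys
  doubly-sort fuel xs ys le | inj₁ s | inj₁ t = xs , ys , ↭-refl , ↭-refl , s , t
  doubly-sort zero xs ys le | inj₂ (xs′ , p , lt) | _ = ⊥-elim (<-irrefl refl (≤-trans lt (≤-trans (total-bound xs′ ys)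
    (≤-trans (≤-reflexive (cong (λ l → 1 * full (length ys) * full l) (↭-length p))) le))))
  doubly-sort (suc fuel) xs ys le | inj₂ (xs′ , p , lt) | _ with doubly-sort fuel xs′ ys
    (≤-trans (≤-reflexive (cong (λ l → 1 * full (length ys) * full l) (↭-length p)))
      (≤-trans le (≤-trans (≤-reflexive (≡-sym (ℕₚ.+-suc fuel _))) (ℕₚ.+-monoʳ-≤ fuel lt))))
  ... | xs″ , ys″ , q , r , s = xs″ , ys″ , ↭-trans q p , r , s
  doubly-sort zero xs ys le | inj₁ _ | inj₂ (ys′ , p , lt) = ⊥-elim (<-irrefl refl (≤-trans
    (subst₂ _<_ (≡-sym (weigh-swap _ xs ys)) (≡-sym (weigh-swap _ xs ys′)) lt) (≤-trans (total-bound xs ys′)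
    (≤-trans (≤-reflexive (cong (λ l → 1 * full l * full (length xs)) (↭-length p))) le))))
  doubly-sort (suc fuel) xs ys le | inj₁ _ | inj₂ (ys′ , p , lt) with doubly-sort fuel xs ys′
    (≤-trans (≤-reflexive (cong (λ l → 1 * full l * full (length xs)) (↭-length p)))
      (≤-trans le (≤-trans (≤-reflexive (≡-sym (ℕₚ.+-suc fuel _))) (ℕₚ.+-monoʳ-≤ fuel
        (subst₂ _<_ (≡-sym (weigh-swap _ xs ys)) (≡-sym (weigh-swap _ xs ys′)) lt)))))
  ... | xs″ , ys″ , q , r , s = xs″ , ys″ , q , ↭-trans r p , s

bit-injective : ∀ {a b} → bit a ≡ bit b → a ≡ b
bit-injective {true} {true} _ = refl
bit-injective {false} {false} _ = refl

half-≤ : ∀ a b {F G} → bit a + 2 * F ≤ bit b + 2 * G → F ≤ G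
half-≤ a b {F} {G} le with F ℕ.≤? G
... | yes l = l
... | no gt = ⊥-elim (<-irrefl refl (≤-trans (≤-trans (s≤s (≤-trans le (ℕₚ.+-monoˡ-≤ (2 * G) (bit≤1 b))))
  (≤-reflexive (≡-sym (ℕₚ.*-suc 2 G)))) (≤-trans (ℕₚ.*-monoʳ-≤ 2 (ℕₚ.≰⇒> gt)) (ℕₚ.m≤n+m (2 * F) (bit a)))))

module _ {Y : Set} (f g : Y → Bool) where
  private
    W : (Y → Bool) → List Y → ℕ
    W h = weigh (bit ∘ h)

  lex-≡ : ∀ ys → W f ys ≡ W g ys → ∀ j → f (lookup ys j) ≡ g (lookup ys j)
  lex-≡ (y ∷ ys) e = agree
    where
    tail≡ : W f ys ≡ W g ys
    tail≡ = ≤-antisym (half-≤ (f y) (g y) (≤-reflexive e)) (half-≤ (g y) (f y) (≤-reflexive (≡-sym e)))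
    agree : ∀ j → f (lookup (y ∷ ys) j) ≡ g (lookup (y ∷ ys) j)
    agree zero = bit-injective (ℕₚ.+-cancelʳ-≡ (2 * W g ys) _ _ (trans (cong (λ t → bit (f y) + 2 * t) (≡-sym tail≡)) e))
    agree (suc j) = lex-≡ ys tail≡ j

  lex-< : ∀ ys → W f ys < W g ys → ∃ λ j → f (lookup ys j) ≡ false × g (lookup ys j) ≡ true ×
    (∀ c → j Fin.< c → f (lookup ys c) ≡ g (lookup ys c))
  lex-< (y ∷ ys) lt with ℕₚ.m≤n⇒m<n∨m≡n (half-≤ (f y) (g y) (<⇒≤ lt))
  ... | inj₁ l with lex-< ys l
  ...   | j , fj , gj , h = suc j , fj , gj , λ { (suc c) (s≤s jc) → h c jc }
  lex-< (y ∷ ys) lt | inj₂ e with f y in fy | g y in gy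
  ... | false | true = zero , fy , gy , λ { (suc c) _ → lex-≡ ys e c }
  ... | false | false = ⊥-elim (<-irrefl (cong (2 *_) e) lt)
  ... | true | true = ⊥-elim (<-irrefl (cong (λ t → 1 + 2 * t) e) lt)
  ... | true | false = ⊥-elim (<-irrefl (cong (2 *_) e) (<⇒≤ lt))

  -- Binary numerals compare at their last differing digit. That digit favours g, whereas f is ahead
  -- at j, so it lies beyond j.
  lex-≤ : ∀ ys → W f ys ≤ W g ys → ∀ j → f (lookup ys j) ≡ true → g (lookup ys j) ≡ false →
    ∃ λ j′ → j Fin.< j′ × f (lookup ys j′) ≡ false × g (lookup ys j′) ≡ true ×
    (∀ c → j′ Fin.< c → f (lookup ys c) ≡ g (lookup ys c))
  lex-≤ (y ∷ ys) le zero fy gy with lex-< ys (ℕₚ.≤∧≢⇒< (half-≤ (f y) (g y) le)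
      (λ e → <-irrefl (cong (2 *_) e) (subst₂ (λ a b → bit a + 2 * W f ys ≤ bit b + 2 * W g ys) fy gy le)))
  ... | j , fj , gj , h = suc j , s≤s z≤n , fj , gj , λ { (suc c) (s≤s jc) → h c jc }
  lex-≤ (y ∷ ys) le (suc j) fj gj with lex-≤ ys (half-≤ (f y) (g y) le) j fj gj
  ... | j′ , jj , fj′ , gj′ , h = suc j′ , s≤s jj , fj′ , gj′ , λ { (suc c) (s≤s jc) → h c jc }

AllPairs-lookup : ∀ {X : Set} {R : X → X → Set} {xs : List X} → AllPairs R xs →
  ∀ {i j} → i Fin.< j → R (lookup xs i) (lookup xs j)
AllPairs-lookup (h ∷ hs) {zero} {suc j} _ = All.lookup h (∈-lookup j)
AllPairs-lookup (h ∷ hs) {suc i} {suc j} (s≤s l) = AllPairs-lookup hs l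

doublySorted⇒LexRows : ∀ {X Y : Set} (A : X → Y → Bool) {xs ys} → AllPairs (λ x x′ → rowWeight A ys x ≤ rowWeight A ys x′) xs →
  LexRows (λ i j → A (lookup xs i) (lookup ys j))
doublySorted⇒LexRows A {xs} {ys} s {i} {i′} {j} l = lex-≤ (A (lookup xs i)) (A (lookup xs i′)) ys (AllPairs-lookup s l) j

-- Labelling along an elimination order

#-pos : ∀ {n} {P : Fin n → Bool} {x} → P x ≡ true → 0 < # P
#-pos {P = P} {x} h = subst (0 <_) (#-remove P x h) (s≤s z≤n)

override : ∀ {n} → Fin n → ℕ → (Fin n → ℕ) → Fin n → ℕ
override x₀ s g x = if does (x ≟ᶠ x₀) then s else g x

override-new : ∀ {n} (x₀ : Fin n) s g → override x₀ s g x₀ ≡ s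
override-new x₀ s g rewrite dec-true (x₀ ≟ᶠ x₀) refl = refl

override-old : ∀ {n} (x₀ : Fin n) s g {x} → x ≢ x₀ → override x₀ s g x ≡ g x
override-old x₀ s g {x} ne rewrite dec-false (x ≟ᶠ x₀) ne = refl

-- Everything is stated at the first vertex of an edge or triangle, so these conditions persist when
-- a vertex is put in front. By `uniq` and `tri` the largest label of a triangle sits on an edge at
-- its first vertex.
record UpLabelling {n} (G : SimpleGraph n) : Set where
  field
    lab : Fin n → Fin n → ℕ
    lab-sym : ∀ a b → lab a b ≡ lab b a
    uniq : ∀ {a b c} → a Fin.< b → a Fin.< c → EdgeRel G a b → EdgeRel G a c → lab a b ≡ lab a c → b ≡ c
    tri : ∀ {a b c} → a Fin.< b → a Fin.< c → EdgeRel G a b → EdgeRel G a c → lab a b < lab a c → lab b c < lab a c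
    up-clique : ∀ {a b c} → a Fin.< b → a Fin.< c → EdgeRel G a b → EdgeRel G a c → b ≢ c → EdgeRel G b c

-- With an `UpLabelling` that is `Counted`, such a set with at least two vertices consists of its
-- edge of largest label and all lower neighbours of that edge; the bound is then attained.
Principal : ∀ {n} (G : SimpleGraph n) (lab : Fin n → Fin n → ℕ) → (Fin n → Bool) → Set
Principal G lab P = ∀ {a b} → P a ≡ true → P b ≡ true → a ≢ b → EdgeRel G a b × 2 + lab a b ≤ # P

Counted : ∀ {n} (G : SimpleGraph n) (lab : Fin n → Fin n → ℕ) → Set
Counted G lab = ∀ {a b} → EdgeRel G a b → # (lower G lab a b) ≡ lab a b

module Flags {n} (G : SimpleGraph n) (L : UpLabelling G) (count : Counted G (UpLabelling.lab L)) where
  open UpLabelling L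
  private
    E = EdgeRel G
    Pr = Principal G lab

  -- In the triangle v a b the first vertex v is an end of the edge with the largest label, so ab
  -- lies strictly below a label that respects the bound of X.
  below-max : ∀ {X} → Pr X → ∀ {v} → X v ≡ true → (∀ y → X y ≡ true → y ≢ v → v Fin.< y) →
    ∀ {a b} → X a ≡ true → X b ≡ true → a ≢ v → b ≢ v → a ≢ b → 2 + lab a b < # X
  below-max {X} pX {v} Xv v< {a} {b} Xa Xb av bv ab with ℕₚ.<-cmp (lab v a) (lab v b)
  ... | tri< l _ _ = ≤-trans (s≤s (s≤s (tri (v< a Xa av) (v< b Xb bv) (proj₁ (pX Xv Xa (av ∘ ≡-sym))) (proj₁ (pX Xv Xb (bv ∘ ≡-sym))) l)))
      (proj₂ (pX Xv Xb (bv ∘ ≡-sym)))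
  ... | tri≈ _ e _ = ⊥-elim (ab (uniq (v< a Xa av) (v< b Xb bv) (proj₁ (pX Xv Xa (av ∘ ≡-sym))) (proj₁ (pX Xv Xb (bv ∘ ≡-sym))) e))
  ... | tri> _ _ l = ≤-trans (s≤s (s≤s (≤-trans (s≤s (≤-reflexive (lab-sym a b)))
      (tri (v< b Xb bv) (v< a Xa av) (proj₁ (pX Xv Xb (bv ∘ ≡-sym))) (proj₁ (pX Xv Xa (av ∘ ≡-sym))) l))))
      (proj₂ (pX Xv Xa (av ∘ ≡-sym)))

  -- One of the two end points of the edge of largest label in X can be removed.
  removable : ∀ {X Y} → Pr X → Pr Y → Y ⊆ X → ¬ (X ⊆ Y) →
    ∃ λ x → X x ≡ true × Y x ≡ false × Pr (remove x X)
  removable {X} {Y} pX pY YX X⊈Y with ⊈-witness X⊈Y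
  ... | z , Xz , Yz with least X Xz
  ... | v , Xv , v< with Y v in Yv
  ... | false = v , Xv , Yv , λ {a} {b} ra rb ab → let (av , Xa) = remove⁻ X v a ra ; (bv , Xb) = remove⁻ X v b rb in
      proj₁ (pX Xa Xb ab) , ℕ.s≤s⁻¹ (subst (_ <_) (≡-sym (#-remove X v Xv)) (below-max pX Xv v< Xa Xb av bv ab))
  ... | true with argmax {P = λ w → X w ≡ true × w ≢ v} (λ w → (X w Bool.≟ true) ×-dec ¬? (w ≟ᶠ v)) (lab v)
  ...   | inj₁ none = ⊥-elim (none z (Xz , λ { refl → absurd-bool Yv Yz }))
  ...   | inj₂ (w , (Xw , wv) , mx) = w , Xw , Yw , pr
    where
    vw : E v w
    vw = proj₁ (pX Xv Xw (wv ∘ ≡-sym))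
    va : ∀ {a} → X a ≡ true → a ≢ v → E v a
    va Xa av = proj₁ (pX Xv Xa (av ∘ ≡-sym))
    smaller : ∀ {a} → X a ≡ true → a ≢ v → a ≢ w → lab v a < lab v w
    smaller {a} Xa av aw = ℕₚ.≤∧≢⇒< (mx a (Xa , av)) (λ e → aw (uniq (v< a Xa av) (v< w Xw wv) (va Xa av) vw e))
    X⊆ : X ⊆ insert v (insert w (lower G lab v w))
    X⊆ a Xa = cases (a ≟ᶠ v) (a ≟ᶠ w)
      where
      cases : Dec (a ≡ v) → Dec (a ≡ w) → insert v (insert w (lower G lab v w)) a ≡ true
      cases (yes refl) _ = insert-self (insert w (lower G lab v w)) a
      cases (no _) (yes refl) = ⊆-insert (insert w (lower G lab v w)) v a (insert-self (lower G lab v w) a)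
      cases (no av) (no aw) = ⊆-insert (insert w (lower G lab v w)) v a (⊆-insert (lower G lab v w) w a
        (lower⁺ G lab (va Xa av) (edge-sym G (proj₁ (pX Xa Xw aw))) (smaller Xa av aw)
          (≤-trans (s≤s (≤-reflexive (lab-sym w a))) (tri (v< a Xa av) (v< w Xw wv) (va Xa av) vw (smaller Xa av aw)))))
    #X≤ : # X ≤ 2 + lab v w
    #X≤ = ≤-trans (#-mono X⊆) (≤-trans (#-insert-≤ (insert w (lower G lab v w)) v)
      (s≤s (≤-trans (#-insert-≤ (lower G lab v w) w) (s≤s (≤-reflexive (count vw))))))
    -- X lies in the span of vw, hence has at most 2 + lab v w vertices. A principal Y through v and
    -- w would be at least as large, although it is a proper subset of X.
    Yw : Y w ≡ false
    Yw = ¬true⇒false λ h → <-irrefl refl (≤-trans (#-mono-< YX Xz Yz) (≤-trans #X≤ (proj₂ (pY Yv h (wv ∘ ≡-sym)))))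
    drop : ∀ {t} → 2 + t < # X → 2 + t ≤ # (remove w X)
    drop l = ℕ.s≤s⁻¹ (subst (_ <_) (≡-sym (#-remove X w Xw)) l)
    pr : Pr (remove w X)
    pr {a} {b} ra rb ab with remove⁻ X w a ra | remove⁻ X w b rb | a ≟ᶠ v | b ≟ᶠ v
    ... | aw , Xa | bw , Xb | yes refl | yes refl = ⊥-elim (ab refl)
    ... | aw , Xa | bw , Xb | yes refl | no bv = va Xb bv , drop (≤-trans (s≤s (s≤s (smaller Xb bv bw))) (proj₂ (pX Xv Xw (wv ∘ ≡-sym))))
    ... | aw , Xa | bw , Xb | no av | yes refl = edge-sym G (va Xa av) , drop (≤-trans (s≤s (s≤s (≤-trans (s≤s (≤-reflexive (lab-sym a b)))
            (smaller Xa av aw)))) (proj₂ (pX Xv Xw (wv ∘ ≡-sym))))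
    ... | aw , Xa | bw , Xb | no av | no bv = proj₁ (pX Xa Xb ab) , drop (below-max pX Xv v< Xa Xb av bv ab)

  -- `g` numbers X along the flag and becomes the label of the edges from the new vertex. `g-tri`
  -- and `g-count` give `tri` and the counts for these edges; `g-set` keeps each B j principal once
  -- the new vertex joins it.
  record Flag {m} (act : Fin m → Bool) (B : Fin m → Fin n → Bool) (X : Fin n → Bool) (s : ℕ) : Set where
    field
      g : Fin n → ℕ
      g-bound : ∀ {x} → X x ≡ true → g x < s
      g-injective : ∀ {x y} → X x ≡ true → X y ≡ true → g x ≡ g y → x ≡ y
      g-tri : ∀ {x y} → X x ≡ true → X y ≡ true → g x < g y → lab x y < g y
      g-count : ∀ {i} → i ≤ s → # (λ x → X x ∧ does (g x ℕ.<? i)) ≡ i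
      g-set : ∀ j → act j ≡ true → B j ⊆ X → ∀ {x} → B j x ≡ true → g x < # (B j)

  module _ {m} (act : Fin m → Bool) (B : Fin m → Fin n → Bool)
    (chain : ∀ j j′ → act j ≡ true → act j′ ≡ true → B j ⊆ B j′ ⊎ B j′ ⊆ B j)
    (principal : ∀ j → act j ≡ true → Pr (B j)) where

    flag : ∀ s X → # X ≡ s → Pr X → (∀ j → act j ≡ true → B j ⊆ X ⊎ X ⊆ B j) → Flag act B X s
    flag zero X #X pX comp = record
      { g = λ _ → 0
      ; g-bound = λ h → ⊥-elim (none h)
      ; g-injective = λ h → ⊥-elim (none h)
      ; g-tri = λ h → ⊥-elim (none h)
      ; g-count = λ {i} l → trans (ℕₚ.n≤0⇒n≡0 (≤-trans (#-mono {Q = X} λ x h → proj₁ (∧-true⁻ {X x} h)) (≤-reflexive #X))) (≡-sym (ℕₚ.n≤0⇒n≡0 l))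
      ; g-set = λ j a sub h → ⊥-elim (none (sub _ h)) }
      where
      none : ∀ {x} → ¬ (X x ≡ true)
      none h = <-irrefl (≡-sym #X) (#-pos {P = X} h)
    flag (suc s) X #X pX comp = result pick-step
      where
      Below : Fin m → Set
      Below j = act j ≡ true × B j ⊆ X × ¬ (X ⊆ B j)
      pick-step : ∃ λ x → X x ≡ true × Pr (remove x X) × (∀ j → Below j → B j x ≡ false)
      pick-step with argmax {P = Below} (λ j → (act j Bool.≟ true) ×-dec ((B j ⊆? X) ×-dec ¬? (X ⊆? B j))) (λ j → # (B j))
      ... | inj₁ none with removable {X} {∅} pX (λ ()) (λ _ ()) (λ h → <-irrefl (≡-sym (#-empty λ x → ¬true⇒false λ p → true≢false (≡-sym (h x p)))) (subst (0 <_) (≡-sym #X) (s≤s z≤n)))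
      ...   | x , Xx , _ , pr = x , Xx , pr , λ j b → ⊥-elim (none j b)
      -- The active sets properly inside X form a chain, so a vertex outside the largest of them is
      -- outside them all. Without such sets, `∅` served as the set to avoid.
      pick-step | inj₂ (j* , (a* , sub* , sup*) , mx) with removable {X} {B j*} pX (principal j* a*) sub* sup*
      ... | x , Xx , x∉ , pr = x , Xx , pr , λ j b → ¬true⇒false λ h → absurd-bool (inside j b x h) x∉
        where
        inside : ∀ j → Below j → B j ⊆ B j*
        inside j b with chain j j* (proj₁ b) a*
        ... | inj₁ h = h
        ... | inj₂ h = #-⊆-antisym h (mx j b)
      result : (∃ λ x → X x ≡ true × Pr (remove x X) × (∀ j → Below j → B j x ≡ false)) → Flag act B X (suc s)
      result (x₀ , Xx₀ , pr , avoid) = record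
        { g = g′
        ; g-bound = λ {x} h → case x ≟ᶠ x₀ of λ
            { (yes refl) → subst (_< suc s) (≡-sym new) ≤-refl
            ; (no ne) → subst (_< suc s) (≡-sym (old ne)) (≤-trans (F.g-bound (remove⁺ X ne h)) (n≤1+n s)) }
        ; g-injective = inj
        ; g-tri = tri′
        ; g-count = count′
        ; g-set = set }
        where
        X′ = remove x₀ X
        #X′ : # X′ ≡ s
        #X′ = ℕₚ.suc-injective (trans (#-remove X x₀ Xx₀) #X)
        comp′ : ∀ j → act j ≡ true → B j ⊆ X′ ⊎ X′ ⊆ B j
        comp′ j a with comp j a
        ... | inj₂ sup = inj₂ λ x h → sup x (proj₂ (remove⁻ X x₀ x h))
        ... | inj₁ sub with X ⊆? B j
        ...   | yes sup = inj₂ λ x h → sup x (proj₂ (remove⁻ X x₀ x h))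
        ...   | no ¬sup = inj₁ λ x h → remove⁺ X (λ { refl → absurd-bool h (avoid j (a , sub , ¬sup)) }) (sub x h)
        module F = Flag (flag s X′ #X′ pr comp′)
        g′ : Fin n → ℕ
        g′ = override x₀ s F.g
        new : g′ x₀ ≡ s
        new = override-new x₀ s F.g
        old : ∀ {x} → x ≢ x₀ → g′ x ≡ F.g x
        old = override-old x₀ s F.g
        small : ∀ {x} → X x ≡ true → x ≢ x₀ → g′ x < s
        small Xx ne = subst (_< s) (≡-sym (old ne)) (F.g-bound (remove⁺ X ne Xx))
        inj : ∀ {x y} → X x ≡ true → X y ≡ true → g′ x ≡ g′ y → x ≡ y
        inj {x} {y} Xx Xy e = cases (x ≟ᶠ x₀) (y ≟ᶠ x₀)
          where
          cases : Dec (x ≡ x₀) → Dec (y ≡ x₀) → x ≡ y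
          cases (yes p) (yes q) = trans p (≡-sym q)
          cases (yes refl) (no q) = ⊥-elim (<-irrefl (trans (≡-sym e) new) (small Xy q))
          cases (no p) (yes refl) = ⊥-elim (<-irrefl (trans e new) (small Xx p))
          cases (no p) (no q) = F.g-injective (remove⁺ X p Xx) (remove⁺ X q Xy) (trans (≡-sym (old p)) (trans e (old q)))
        tri′ : ∀ {x y} → X x ≡ true → X y ≡ true → g′ x < g′ y → lab x y < g′ y
        tri′ {x} {y} Xx Xy l = cases (x ≟ᶠ x₀) (y ≟ᶠ x₀)
          where
          cases : Dec (x ≡ x₀) → Dec (y ≡ x₀) → lab x y < g′ y
          cases (yes refl) (yes refl) = ⊥-elim (<-irrefl refl l)
          cases (yes refl) (no q) = ⊥-elim (<-irrefl refl (<-trans (subst (_< g′ y) new l) (small Xy q)))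
          cases (no p) (yes refl) = subst (lab x y <_) (≡-sym new) (ℕ.s≤s⁻¹ (≤-trans (proj₂ (pX Xx Xy p)) (≤-reflexive #X)))
          cases (no p) (no q) = subst (lab x y <_) (≡-sym (old q)) (F.g-tri (remove⁺ X p Xx) (remove⁺ X q Xy) (subst₂ _<_ (old p) (old q) l))
        count′ : ∀ {i} → i ≤ suc s → # (λ x → X x ∧ does (g′ x ℕ.<? i)) ≡ i
        count′ {i} l with ℕₚ.m≤n⇒m<n∨m≡n l
        ... | inj₂ refl = trans (#-ext (λ x h → proj₁ (∧-true⁻ h)) (λ x h → ∧-true⁺ h (does⁺ (g′ x ℕ.<? suc s)
                (case x ≟ᶠ x₀ of λ { (yes refl) → ≤-reflexive (cong suc new) ; (no ne) → ≤-trans (small h ne) (n≤1+n s) })))) #X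
        ... | inj₁ (s≤s li) = trans (#-ext to from) (F.g-count li)
          where
          to : (λ x → X x ∧ does (g′ x ℕ.<? i)) ⊆ (λ x → X′ x ∧ does (F.g x ℕ.<? i))
          to x h = let (Xx , d) = ∧-true⁻ h ; gi = does⁻ (g′ x ℕ.<? i) d
                       ne = λ e → <-irrefl refl (≤-trans (subst (λ z → g′ z < i) e gi) (≤-trans li (≤-reflexive (≡-sym new))))
                   in ∧-true⁺ (remove⁺ X ne Xx) (does⁺ (F.g x ℕ.<? i) (subst (_< i) (old ne) gi))
          from : (λ x → X′ x ∧ does (F.g x ℕ.<? i)) ⊆ (λ x → X x ∧ does (g′ x ℕ.<? i))
          from x h = let (X′x , d) = ∧-true⁻ h ; (ne , Xx) = remove⁻ X x₀ x X′x
                     in ∧-true⁺ Xx (does⁺ (g′ x ℕ.<? i) (subst (_< i) (≡-sym (old ne)) (does⁻ (F.g x ℕ.<? i) d)))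
        set : ∀ j → act j ≡ true → B j ⊆ X → ∀ {x} → B j x ≡ true → g′ x < # (B j)
        set j a sub {x} h with X ⊆? B j
        ... | yes sup = subst (g′ x <_) (≡-sym (trans (#-ext sub sup) #X)) (case x ≟ᶠ x₀ of λ
              { (yes refl) → ≤-reflexive (cong suc new) ; (no ne) → ≤-trans (small (sub x h) ne) (n≤1+n s) })
        ... | no ¬sup = subst (_< # (B j)) (≡-sym (old (avoided h))) (F.g-set j a (λ z hz → remove⁺ X (avoided hz) (sub z hz)) h)
          where
          avoided : ∀ {z} → B j z ≡ true → z ≢ x₀
          avoided hz refl = absurd-bool hz (avoid j (a , sub , ¬sup))

tailGraph : ∀ {n} → SimpleGraph (suc n) → SimpleGraph n
tailGraph G = record
  { Adj = λ i j → Adj G (suc i) (suc j)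
  ; sym = λ i j → sym G (suc i) (suc j)
  ; irrefl = λ i → irrefl G (suc i) }

record Built {n m} (G : SimpleGraph n) (C : Fin m → Fin n → Bool) : Set where
  field
    labelling : UpLabelling G
  open UpLabelling labelling public
  field
    count : Counted G lab
    descend : ∀ {a b k} → a Fin.< b → EdgeRel G a b → lab a b ≡ suc k →
      ∃ λ c → a Fin.< c × EdgeRel G a c × lab a c ≡ k
    principal : ∀ j → Principal G lab (C j)

-- The first vertex is added last: its neighbours are labelled along a full flag of principal sets
-- through the chain of all C j containing that vertex.
build : ∀ n {m} (G : SimpleGraph n) (C : Fin m → Fin n → Bool) →
  (∀ j {a b} → C j a ≡ true → C j b ≡ true → a ≢ b → EdgeRel G a b) →
  (∀ {a b} → EdgeRel G a b → ∃ λ j → C j a ≡ true × C j b ≡ true) →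
  (∀ j j′ {v} → C j v ≡ true → C j′ v ≡ true →
    (∀ {y} → v Fin.< y → C j y ≡ true → C j′ y ≡ true) ⊎ (∀ {y} → v Fin.< y → C j′ y ≡ true → C j y ≡ true)) →
  Built G C
build zero G C _ _ _ = record
  { labelling = record { lab = λ () ; lab-sym = λ () ; uniq = λ { {()} } ; tri = λ { {()} } ; up-clique = λ { {()} } }
  ; count = λ { {()} } ; descend = λ { {()} } ; principal = λ { _ {()} } }
build (suc n) {m} G C clique cover chain = record
  { labelling = record
    { lab = lab′ ; lab-sym = lab′-sym ; uniq = λ {a} {b} {c} → uniq′ {a} {b} {c}
    ; tri = λ {a} {b} {c} → tri′ {a} {b} {c} ; up-clique = λ {a} {b} {c} → up {a} {b} {c} }
  ; count = λ {a} {b} → count′ {a} {b} ; descend = λ {a} {b} → descend′ {a} {b} ; principal = λ j {a} {b} → principal′ j {a} {b} }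
  where
  G′ = tailGraph G
  C′ : Fin m → Fin n → Bool
  C′ j = C j ∘ suc
  module R = Built (build n G′ C′ (λ j p q ne → clique j p q (λ e → ne (Finₚ.suc-injective e))) cover
    (λ j j′ p q → Sum.map (λ h {y} l → h {suc y} (s≤s l)) (λ h {y} l → h {suc y} (s≤s l)) (chain j j′ p q)))
  T : Fin n → Bool
  T b = Adj G zero (suc b)
  act : Fin m → Bool
  act j = C j zero
  chain′ : ∀ j j′ → act j ≡ true → act j′ ≡ true → C′ j ⊆ C′ j′ ⊎ C′ j′ ⊆ C′ j
  chain′ j j′ p q with chain j j′ p q
  ... | inj₁ h = inj₁ λ x → h (s≤s z≤n)
  ... | inj₂ h = inj₂ λ x → h (s≤s z≤n)
  B⊆T : ∀ j → act j ≡ true → C′ j ⊆ T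
  B⊆T j a x h = clique j a h λ ()
  common : ∀ {a b} → T a ≡ true → T b ≡ true → ∃ λ j → act j ≡ true × C′ j a ≡ true × C′ j b ≡ true
  common {a} {b} Ta Tb with cover Ta | cover Tb
  ... | j , j0 , ja | j′ , j′0 , j′b with chain′ j j′ j0 j′0
  ...   | inj₁ h = j′ , j′0 , h a ja , j′b
  ...   | inj₂ h = j , j0 , ja , h b j′b
  -- Two neighbours of the new vertex share some C j through it, because these sets form a chain;
  -- the bound of that set carries over to the larger T.
  pT : Principal G′ R.lab T
  pT {a} {b} Ta Tb ne with common Ta Tb
  ... | j , j0 , ja , jb = proj₁ (R.principal j ja jb ne) , ≤-trans (proj₂ (R.principal j ja jb ne)) (#-mono (B⊆T j j0))
  open module F = Flags.Flag (Flags.flag G′ R.labelling R.count act C′ chain′ (λ j _ → R.principal j) (# T) T refl pT (λ j a → inj₁ (B⊆T j a)))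
  lab′ : Fin (suc n) → Fin (suc n) → ℕ
  lab′ zero zero = 0
  lab′ zero (suc b) = g b
  lab′ (suc a) zero = g a
  lab′ (suc a) (suc b) = R.lab a b
  lab′-sym : ∀ a b → lab′ a b ≡ lab′ b a
  lab′-sym zero zero = refl
  lab′-sym zero (suc b) = refl
  lab′-sym (suc a) zero = refl
  lab′-sym (suc a) (suc b) = R.lab-sym a b
  uniq′ : ∀ {a b c} → a Fin.< b → a Fin.< c → EdgeRel G a b → EdgeRel G a c → lab′ a b ≡ lab′ a c → b ≡ c
  uniq′ {zero} {suc b} {suc c} _ _ p q e = cong suc (g-injective p q e)
  uniq′ {suc a} {suc b} {suc c} (s≤s l) (s≤s l′) p q e = cong suc (R.uniq l l′ p q e)
  tri′ : ∀ {a b c} → a Fin.< b → a Fin.< c → EdgeRel G a b → EdgeRel G a c → lab′ a b < lab′ a c → lab′ b c < lab′ a c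
  tri′ {zero} {suc b} {suc c} _ _ p q e = g-tri p q e
  tri′ {suc a} {suc b} {suc c} (s≤s l) (s≤s l′) p q e = R.tri l l′ p q e
  up : ∀ {a b c} → a Fin.< b → a Fin.< c → EdgeRel G a b → EdgeRel G a c → b ≢ c → EdgeRel G b c
  up {zero} {suc b} {suc c} _ _ p q ne = proj₁ (pT p q (λ e → ne (cong suc e)))
  up {suc a} {suc b} {suc c} (s≤s l) (s≤s l′) p q ne = R.up-clique l l′ p q (λ e → ne (cong suc e))
  count-zero : ∀ {b} → T b ≡ true → # (lower G lab′ zero (suc b)) ≡ g b
  count-zero {b} Tb rewrite irrefl G zero = trans (#-ext {P = λ w → lower G lab′ zero (suc b) (suc w)} to from) (g-count (<⇒≤ (g-bound Tb)))
    where
    to : (λ w → lower G lab′ zero (suc b) (suc w)) ⊆ (λ w → T w ∧ does (g w ℕ.<? g b))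
    to w h with lower⁻ G lab′ {zero} {suc b} {suc w} h
    ... | Tw , _ , l , _ = ∧-true⁺ Tw (does⁺ (g w ℕ.<? g b) l)
    from : (λ w → T w ∧ does (g w ℕ.<? g b)) ⊆ (λ w → lower G lab′ zero (suc b) (suc w))
    from w h with ∧-true⁻ {T w} h
    ... | Tw , d with does⁻ (g w ℕ.<? g b) d
    ...   | l = lower⁺ G lab′ {zero} {suc b} {suc w} Tw (edge-sym G′ (proj₁ (pT Tw Tb λ { refl → <-irrefl refl l }))) l
            (subst (_< g b) (R.lab-sym w b) (g-tri Tw Tb l))
  count′ : ∀ {a b} → EdgeRel G a b → # (lower G lab′ a b) ≡ lab′ a b
  count′ {zero} {zero} e = ⊥-elim (edge-irrefl G e)
  count′ {zero} {suc b} e = count-zero e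
  count′ {suc a} {zero} e = trans (#-ext (lower-sym G lab′ lab′-sym (suc a) zero) (lower-sym G lab′ lab′-sym zero (suc a)))
    (count-zero (edge-sym G e))
  count′ {suc a} {suc b} e = trans (cong (λ t → bit t + # (lower G′ R.lab a b)) (¬true⇒false no-zero)) (R.count e)
    where
    -- The new vertex is no lower neighbour of an old edge ab: by `g-tri` the larger of g a and g b
    -- exceeds the label of ab.
    no-zero : lower G lab′ (suc a) (suc b) zero ≢ true
    no-zero h with lower⁻ G lab′ {suc a} {suc b} {zero} h
    ... | a0 , b0 , la , lb with ℕₚ.<-cmp (g a) (g b)
    ...   | tri< l _ _ = <-irrefl refl (<-trans lb (g-tri (edge-sym G a0) (edge-sym G b0) l))
    ...   | tri≈ _ eq _ = edge-≢ G′ e (g-injective (edge-sym G a0) (edge-sym G b0) eq)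
    ...   | tri> _ _ l = <-irrefl refl (<-trans la (subst (_< g a) (R.lab-sym b a) (g-tri (edge-sym G b0) (edge-sym G a0) l)))
  descend′ : ∀ {a b k} → a Fin.< b → EdgeRel G a b → lab′ a b ≡ suc k → ∃ λ c → a Fin.< c × EdgeRel G a c × lab′ a c ≡ k
  descend′ {suc a} {suc b} (s≤s l) e eq with R.descend l e eq
  ... | c , ac , h = suc c , s≤s ac , h
  descend′ {zero} {suc b} {k} _ Tb eq with ⊈-witness {P = λ w → T w ∧ does (g w ℕ.<? suc k)} {λ w → T w ∧ does (g w ℕ.<? k)}
      (λ sub → <-irrefl refl (≤-trans (≤-reflexive (≡-sym (g-count sk))) (≤-trans (#-mono sub) (≤-reflexive (g-count (<⇒≤ sk))))))
    where
    sk : suc k ≤ # T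
    sk = <⇒≤ (≤-trans (s≤s (≤-reflexive (≡-sym eq))) (g-bound Tb))
  ... | w , h , h′ with ∧-true⁻ {T w} h
  ... | Tw , d = suc w , s≤s z≤n , Tw , ≤-antisym (ℕ.s≤s⁻¹ (does⁻ (g w ℕ.<? suc k) d))
        (ℕₚ.≮⇒≥ λ l → absurd-bool (∧-true⁺ Tw (does⁺ (g w ℕ.<? k) l)) h′)
  principal′ : ∀ j → Principal G lab′ (C j)
  principal′ j {zero} {zero} _ _ ne = ⊥-elim (ne refl)
  principal′ j {zero} {suc b} p q ne = clique j p q ne ,
    subst (λ t → 2 + g b ≤ bit t + # (C′ j)) (≡-sym p) (s≤s (g-set j p (B⊆T j p) q))
  principal′ j {suc a} {zero} p q ne = clique j p q ne ,
    subst (λ t → 2 + g a ≤ bit t + # (C′ j)) (≡-sym q) (s≤s (g-set j q (B⊆T j q) p))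
  principal′ j {suc a} {suc b} p q ne = clique j p q ne ,
    ≤-trans (proj₂ (R.principal j p q (λ e → ne (cong suc e)))) (ℕₚ.m≤n+m (# (C′ j)) (bit (C j zero)))

-- Label classes of an up-labelling are forests

tailLabelling : ∀ {n} {G : SimpleGraph (suc n)} → UpLabelling G → UpLabelling (tailGraph G)
tailLabelling L = record
  { lab = λ a b → lab (suc a) (suc b)
  ; lab-sym = λ a b → lab-sym (suc a) (suc b)
  ; uniq = λ l l′ p q e → Finₚ.suc-injective (uniq (s≤s l) (s≤s l′) p q e)
  ; tri = λ l l′ → tri (s≤s l) (s≤s l′)
  ; up-clique = λ l l′ p q ne → up-clique (s≤s l) (s≤s l′) p q (λ e → ne (Finₚ.suc-injective e)) }
  where open UpLabelling L

module _ {n} (G : SimpleGraph (suc n)) (L : UpLabelling G) (k : ℕ) where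
  open UpLabelling L

  UpEdge : Set
  UpEdge = ∃ λ c → EdgeRel G zero (suc c) × lab zero (suc c) ≡ k

  upEdge? : Dec UpEdge
  upEdge? = any? λ c → (Adj G zero (suc c) Bool.≟ true) ×-dec (lab zero (suc c) ℕ.≟ k)

  -- By `uniq` the first vertex has at most one edge with label k, so any colouring of the rest
  -- extends: it copies the other end of that edge. Without such an edge its colour is free, and the
  -- value `true` is relied on by `up-separate-zero`.
  colour : Dec UpEdge → (Fin n → Bool) → Fin (suc n) → Bool
  colour (yes (c , _)) f zero = f c
  colour (no _) f zero = true
  colour _ f (suc x) = f x

  colour-constant : ∀ d f {Q : Fin (suc n) → Fin (suc n) → Set} →
    (∀ {x y} → EdgeRel G (suc x) (suc y) → lab (suc x) (suc y) ≡ k → Q (suc x) (suc y) → f x ≡ f y) →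
    ∀ x y → EdgeRel G x y → lab x y ≡ k → Q x y → colour d f x ≡ colour d f y
  colour-constant d f h zero zero e _ _ = refl
  colour-constant (yes (c , c0 , ck)) f h zero (suc y) e ek _ = cong f (Finₚ.suc-injective (uniq (s≤s z≤n) (s≤s z≤n) c0 e (trans ck (≡-sym ek))))
  colour-constant (yes (c , c0 , ck)) f h (suc x) zero e ek _ =
    cong f (≡-sym (Finₚ.suc-injective (uniq (s≤s z≤n) (s≤s z≤n) c0 (edge-sym G e) (trans ck (trans (≡-sym ek) (lab-sym (suc x) zero))))))
  colour-constant (no ¬c) f h zero (suc y) e ek _ = ⊥-elim (¬c (y , e , ek))
  colour-constant (no ¬c) f h (suc x) zero e ek _ = ⊥-elim (¬c (x , edge-sym G e , trans (lab-sym zero (suc x)) ek))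
  colour-constant (yes _) f h (suc x) (suc y) e ek q = h e ek q
  colour-constant (no _) f h (suc x) (suc y) e ek q = h e ek q

  colour-suc : ∀ d f x → colour d f (suc x) ≡ f x
  colour-suc (yes _) f x = refl
  colour-suc (no _) f x = refl

up-separate : ∀ {n} (G : SimpleGraph n) (L : UpLabelling G) → let open UpLabelling L in ∀ k {a b} → EdgeRel G a b → lab a b < k →
  Σ (Fin n → Bool) λ f → (∀ x y → EdgeRel G x y → lab x y ≡ k → f x ≡ f y) × f a ≢ f b
up-separate-zero : ∀ {n} (G : SimpleGraph (suc n)) (L : UpLabelling G) → let open UpLabelling L in ∀ k {b} →
  EdgeRel G zero (suc b) → lab zero (suc b) < k →
  Σ (Fin (suc n) → Bool) λ f → (∀ x y → EdgeRel G x y → lab x y ≡ k → f x ≡ f y) × f zero ≢ f (suc b)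

up-separate-zero G L k {b} e l with upEdge? G L k
-- No edge of the class meets the first vertex, so it is separated by its default colour against
-- `false` everywhere else.
... | no ¬c = colour G L k (no ¬c) (λ _ → false) ,
      (λ x y xy xyk → colour-constant G L k (no ¬c) (λ _ → false) {λ _ _ → Fin 1} (λ _ _ _ → refl) x y xy xyk zero) , λ ()
-- The first vertex takes the colour of c. By `tri` the edge from b to c again has label below k, so
-- the tail can separate b from c.
... | yes (c , c0 , ck) with up-separate (tailGraph G) (tailLabelling L) k
      (up-clique (s≤s z≤n) (s≤s z≤n) e c0 λ { refl → <-irrefl ck l })
      (subst (lab (suc b) (suc c) <_) ck (tri (s≤s z≤n) (s≤s z≤n) e c0 (subst (lab zero (suc b) <_) (≡-sym ck) l)))
  where open UpLabelling L
...   | f , con , ne = colour G L k (yes (c , c0 , ck)) f ,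
      (λ x y xy xyk → colour-constant G L k (yes (c , c0 , ck)) f {λ _ _ → Fin 1} (λ p q _ → con _ _ p q) x y xy xyk zero) ,
      λ h → ne (≡-sym h)

up-separate {suc n} G L k {zero} {zero} e l = ⊥-elim (edge-irrefl G e)
up-separate {suc n} G L k {zero} {suc b} e l = up-separate-zero G L k e l
up-separate {suc n} G L k {suc a} {zero} e l with up-separate-zero G L k (edge-sym G e) (subst (_< k) (UpLabelling.lab-sym L (suc a) zero) l)
... | f , con , ne = f , con , λ h → ne (≡-sym h)
up-separate {suc n} G L k {suc a} {suc b} e l with up-separate (tailGraph G) (tailLabelling L) k e l
... | f , con , ne = colour G L k d f ,
      (λ x y xy xyk → colour-constant G L k d f {λ _ _ → Fin 1} (λ p q _ → con _ _ p q) x y xy xyk zero) ,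
      λ h → ne (trans (≡-sym (colour-suc G L k d f a)) (trans h (colour-suc G L k d f b)))
  where d = upEdge? G L k

isZero : ∀ {n} → Fin (suc n) → Bool
isZero zero = true
isZero (suc _) = false

Other : ∀ {n} → Fin n → Fin n → Fin n → Fin n → Set
Other a b x y = ¬ (x ≡ a × y ≡ b) × ¬ (x ≡ b × y ≡ a)

up-acyclic : ∀ {n} (G : SimpleGraph n) (L : UpLabelling G) → let open UpLabelling L in ∀ {a b} → EdgeRel G a b →
  Σ (Fin n → Bool) λ f → (∀ x y → EdgeRel G x y → lab x y ≡ lab a b → Other a b x y → f x ≡ f y) × f a ≢ f b
-- By `uniq` no other edge of the class meets the first vertex, so isolating that vertex cuts only
-- this edge.
up-acyclic-zero : ∀ {n} (G : SimpleGraph (suc n)) (L : UpLabelling G) → let open UpLabelling L in ∀ {b} → EdgeRel G zero (suc b) →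
  Σ (Fin (suc n) → Bool) λ f → (∀ x y → EdgeRel G x y → lab x y ≡ lab zero (suc b) → Other zero (suc b) x y → f x ≡ f y) × f zero ≢ f (suc b)
up-acyclic-zero G L {b} e = isZero , con , λ ()
  where
  open UpLabelling L
  con : ∀ x y → EdgeRel G x y → lab x y ≡ lab zero (suc b) → Other zero (suc b) x y →
    isZero x ≡ isZero y
  con zero zero _ _ _ = refl
  con zero (suc y) xy eq (o , _) = ⊥-elim (o (refl , uniq (s≤s z≤n) (s≤s z≤n) xy e eq))
  con (suc x) zero xy eq (_ , o) = ⊥-elim (o (uniq (s≤s z≤n) (s≤s z≤n) (edge-sym G xy) e (trans (lab-sym zero (suc x)) eq) , refl))
  con (suc x) (suc y) _ _ _ = refl

up-acyclic {suc n} G L {zero} {zero} e = ⊥-elim (edge-irrefl G e)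
up-acyclic {suc n} G L {zero} {suc b} e = up-acyclic-zero G L e
up-acyclic {suc n} G L {suc a} {zero} e with up-acyclic-zero G L (edge-sym G e)
... | f , con , ne = f , (λ x y xy eq o → con x y xy (trans eq (UpLabelling.lab-sym L (suc a) zero)) (proj₂ o , proj₁ o)) , λ h → ne (≡-sym h)
up-acyclic {suc n} G L {suc a} {suc b} e with up-acyclic (tailGraph G) (tailLabelling L) e
... | f , con , ne = colour G L k d f ,
      colour-constant G L k d f {Other (suc a) (suc b)} (λ {x} {y} p q o → con x y p q
        ((λ { (refl , refl) → proj₁ o (refl , refl) }) , (λ { (refl , refl) → proj₂ o (refl , refl) }))) ,
      λ h → ne (trans (≡-sym (colour-suc G L k d f a)) (trans h (colour-suc G L k d f b)))
  where
  k = UpLabelling.lab L (suc a) (suc b)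
  d = upEdge? G L k

-- From strongly chordal graphs to labellings

Unique-lookup-injective : ∀ {A : Set} {xs : List A} → Unique xs → ∀ {i j} → lookup xs i ≡ lookup xs j → i ≡ j
Unique-lookup-injective u {i} {j} e with Finₚ.<-cmp i j
... | tri< l _ _ = ⊥-elim (AllPairs-lookup u l e)
... | tri≈ _ h _ = h
... | tri> _ _ l = ⊥-elim (AllPairs-lookup u l (≡-sym e))

Unique-resp-↭ : ∀ {A : Set} {xs ys : List A} → xs ↭ ys → Unique xs → Unique ys
Unique-resp-↭ {A} p = Permₛ.Unique-resp-↭ (setoid A) (↭⇒↭ₛ p)

-- No label below an occurring one is skipped; otherwise the partition would have an empty block.
Descending : ∀ {ℓ} {G : SimpleGraph ℓ} → MATLabelling G → Set
Descending {G = G} L = ∀ {a b k} → EdgeRel G a b → lab a b ≡ suc k → ∃ λ c → ∃ λ d → EdgeRel G c d × lab c d ≡ k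
  where open MATLabelling L

module Relabel {ℓ n} (G : SimpleGraph ℓ) (ρ : Fin n → Fin ℓ) (pos : Fin ℓ → Fin n)
  (ρ-pos : ∀ v → ρ (pos v) ≡ v) (pos-ρ : ∀ i → pos (ρ i) ≡ i) where

  G↓ : SimpleGraph n
  G↓ = record { Adj = λ i j → Adj G (ρ i) (ρ j) ; sym = λ i j → sym G (ρ i) (ρ j) ; irrefl = λ i → irrefl G (ρ i) }

  down : ∀ {a b} → EdgeRel G a b → EdgeRel G↓ (pos a) (pos b)
  down {a} {b} = subst₂ (EdgeRel G) (≡-sym (ρ-pos a)) (≡-sym (ρ-pos b))

  module _ {m} {C : Fin m → Fin n → Bool} (B : Built G↓ C) where
    open Built B

    relabelled : MATLabelling G
    relabelled = record
      { lab = λ a b → lab (pos a) (pos b)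
      ; lab-sym = λ a b → lab-sym (pos a) (pos b)
      ; count = λ {a} {b} e → trans (≤-antisym
          (#-inject {P = lower G lab↑ a b} {lower G↓ lab (pos a) (pos b)} pos pos-inj (to a b))
          (#-inject {P = lower G↓ lab (pos a) (pos b)} {lower G lab↑ a b} ρ ρ-inj (from a b))) (count (down e))
      ; separate = λ {c} {d} _ ab l → let (f , con , ne) = up-separate G↓ labelling (lab (pos c) (pos d)) (down ab) l in
          f ∘ pos , (λ x y xy → con (pos x) (pos y) (down xy)) , ne
      ; acyclic = λ {a} {b} ab → let (f , con , ne) = up-acyclic G↓ labelling (down ab) in
          f ∘ pos , (λ x y xy eq o o′ → con (pos x) (pos y) (down xy) eq
            ((λ { (p , q) → o (pos-inj p , pos-inj q) }) , (λ { (p , q) → o′ (pos-inj p , pos-inj q) }))) , ne }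
      where
      lab↑ : Fin ℓ → Fin ℓ → ℕ
      lab↑ a b = lab (pos a) (pos b)
      pos-inj : ∀ {x y} → pos x ≡ pos y → x ≡ y
      pos-inj {x} {y} e = trans (≡-sym (ρ-pos x)) (trans (cong ρ e) (ρ-pos y))
      ρ-inj : ∀ {x y} → ρ x ≡ ρ y → x ≡ y
      ρ-inj {x} {y} e = trans (≡-sym (pos-ρ x)) (trans (cong pos e) (pos-ρ y))
      to : ∀ a b w → lower G lab↑ a b w ≡ true → lower G↓ lab (pos a) (pos b) (pos w) ≡ true
      to a b w h with lower⁻ G lab↑ h
      ... | aw , bw , l , l′ = lower⁺ G↓ lab (down aw) (down bw) l l′
      from : ∀ a b w → lower G↓ lab (pos a) (pos b) w ≡ true → lower G lab↑ a b (ρ w) ≡ true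
      from a b w h with lower⁻ G↓ lab h
      ... | aw , bw , l , l′ = lower⁺ G lab↑ (subst (λ v → EdgeRel G v (ρ w)) (ρ-pos a) aw) (subst (λ v → EdgeRel G v (ρ w)) (ρ-pos b) bw)
        (subst (λ v → lab (pos a) v < lab (pos a) (pos b)) (≡-sym (pos-ρ w)) l)
        (subst (λ v → lab (pos b) v < lab (pos a) (pos b)) (≡-sym (pos-ρ w)) l′)

    descending : Descending relabelled
    descending {a} {b} {k} e eq with ℕₚ.<-cmp (toℕ (pos a)) (toℕ (pos b))
    ... | tri< l _ _ = let (c , _ , h , h′) = descend l (down e) eq in a , ρ c ,
          subst (λ v → EdgeRel G v (ρ c)) (ρ-pos a) h , trans (cong (lab (pos a)) (pos-ρ c)) h′
    ... | tri≈ _ h _ = ⊥-elim (edge-≢ G↓ (down e) (toℕ-injective h))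
    ... | tri> _ _ l = let (c , _ , h , h′) = descend l (down (edge-sym G e)) (trans (lab-sym (pos b) (pos a)) eq) in b , ρ c ,
          subst (λ v → EdgeRel G v (ρ c)) (ρ-pos b) h , trans (cong (lab (pos b)) (pos-ρ c)) h′

#≤n : ∀ {n} (P : Fin n → Bool) → # P ≤ n
#≤n {zero} P = z≤n
#≤n {suc n} P = ℕₚ.+-mono-≤ (bit≤1 (P zero)) (#≤n (P ∘ suc))

module _ {ℓ} (G : SimpleGraph ℓ) where
  IsClique : (Fin ℓ → Bool) → Set
  IsClique P = ∀ {a b} → P a ≡ true → P b ≡ true → a ≢ b → EdgeRel G a b

  IsMaximal : (Fin ℓ → Bool) → Set
  IsMaximal P = ∀ x → P x ≡ false → ∃ λ y → P y ≡ true × Adj G y x ≡ false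

  extend-clique : ∀ fuel P → IsClique P → ℓ ≤ fuel + # P → ∃ λ Q → P ⊆ Q × IsClique Q × IsMaximal Q
  extend-clique fuel P cl le with any? (λ x → (P x Bool.≟ false) ×-dec all? λ y → (P y Bool.≟ true) →-dec (Adj G y x Bool.≟ true))
  extend-clique fuel P cl le | no none = P , (λ _ h → h) , cl , λ x Px → case any? (λ y → (P y Bool.≟ true) ×-dec (Adj G y x Bool.≟ false)) of λ
    { (yes w) → w
    ; (no ¬w) → ⊥-elim (none (x , Px , λ y Py → case Adj G y x Bool.≟ true of λ
        { (yes e) → e ; (no ne) → ⊥-elim (¬w (y , Py , ¬true⇒false ne)) })) }
  extend-clique zero P cl le | yes (x , Px , _) =
    ⊥-elim (<-irrefl refl (≤-trans (subst (_≤ # (insert x P)) refl (≤-reflexive (≡-sym (#-insert P x Px)))) (≤-trans (#≤n (insert x P)) le)))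
  extend-clique (suc fuel) P cl le | yes (x , Px , adj) with extend-clique fuel (insert x P) cl′
      (≤-trans le (≤-reflexive (trans (≡-sym (ℕₚ.+-suc fuel (# P))) (cong (fuel +_) (≡-sym (#-insert P x Px))))))
    where
    cl′ : IsClique (insert x P)
    cl′ {a} {b} ia ib ne with insert⁻ P x a ia | insert⁻ P x b ib
    ... | inj₁ refl | inj₁ refl = ⊥-elim (ne refl)
    ... | inj₁ refl | inj₂ Pb = edge-sym G (adj b Pb)
    ... | inj₂ Pa | inj₁ refl = adj a Pa
    ... | inj₂ Pa | inj₂ Pb = cl Pa Pb ne
  ... | Q , sub , clQ , mxQ = Q , (λ y Py → sub y (⊆-insert P x y Py)) , clQ , mxQ

  -- All ordered pairs serve as indices of cliques, so the columns form a fixed finite list; for a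
  -- non-edge only the first vertex remains. Repeated cliques do no harm.
  pair : Fin ℓ × Fin ℓ → Fin ℓ → Bool
  pair (a , b) v = does (v ≟ᶠ a) ∨ (Adj G a b ∧ does (v ≟ᶠ b))

  pair⁻ : ∀ a b v → pair (a , b) v ≡ true → v ≡ a ⊎ (EdgeRel G a b × v ≡ b)
  pair⁻ a b v h with ∨-true⁻ {does (v ≟ᶠ a)} h
  ... | inj₁ d = inj₁ (does⁻ (v ≟ᶠ a) d)
  ... | inj₂ d = let (e , d′) = ∧-true⁻ {Adj G a b} d in inj₂ (e , does⁻ (v ≟ᶠ b) d′)

  pair-clique : ∀ ab → IsClique (pair ab)
  pair-clique (a , b) {x} {y} px py ne with pair⁻ a b x px | pair⁻ a b y py
  ... | inj₁ refl | inj₁ refl = ⊥-elim (ne refl)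
  ... | inj₁ refl | inj₂ (e , refl) = e
  ... | inj₂ (e , refl) | inj₁ refl = edge-sym G e
  ... | inj₂ (e , refl) | inj₂ (_ , refl) = ⊥-elim (ne refl)

  maxClique : ∀ ab → ∃ λ Q → IsClique Q × IsMaximal Q × pair ab ⊆ Q
  maxClique ab with extend-clique ℓ (pair ab) (pair-clique ab) (ℕₚ.m≤m+n ℓ _)
  ... | Q , sub , cl , mx = Q , cl , mx , sub

  cliqueFamily : Fin ℓ → Fin ℓ × Fin ℓ → Bool
  cliqueFamily v ab = proj₁ (maxClique ab) v

  family-cover : ∀ {a b} → EdgeRel G a b → cliqueFamily a (a , b) ≡ true × cliqueFamily b (a , b) ≡ true
  family-cover {a} {b} e = sub a (∨-left (does⁺ (a ≟ᶠ a) refl)) , sub b (∨-trueʳ {does (b ≟ᶠ a)} (∧-true⁺ e (does⁺ (b ≟ᶠ b) refl)))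
    where
    sub = proj₂ (proj₂ (proj₂ (maxClique (a , b))))
    ∨-left : ∀ {p q} → p ≡ true → p ∨ q ≡ true
    ∨-left refl = refl

family⇒labelling : ∀ {ℓ} (G : SimpleGraph ℓ) → StronglyChordal G → (C : Fin ℓ → Fin ℓ × Fin ℓ → Bool) →
  (∀ j → IsClique G (λ v → C v j)) → (∀ j → IsMaximal G (λ v → C v j)) →
  (∀ {a b} → EdgeRel G a b → C a (a , b) ≡ true × C b (a , b) ≡ true) → Σ (MATLabelling G) Descending
family⇒labelling {ℓ} G (chordal , no-suns) C clique maximal cover
  with doubly-sort C _ (allFin ℓ) (cartesianProduct (allFin ℓ) (allFin ℓ)) (ℕₚ.m≤m+n _ _)
... | xs , ys , xs↭ , ys↭ , rows , cols = relabelled built , descending built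
  where
  ch : ChordProperty (EdgeRel G)
  ch = chordal⇒chordProperty G chordal
  xs-unique : Unique xs
  xs-unique = Unique-resp-↭ (↭-sym xs↭) (allFin⁺ ℓ)
  ∈xs : ∀ v → v ∈ xs
  ∈xs v = ∈-resp-↭ (↭-sym xs↭) (∈-allFin v)
  ∈ys : ∀ ab → ab ∈ ys
  ∈ys (a , b) = ∈-resp-↭ (↭-sym ys↭) (∈-cartesianProduct⁺ (∈-allFin a) (∈-allFin b))
  ρ : Fin (length xs) → Fin ℓ
  ρ = lookup xs
  pos : Fin ℓ → Fin (length xs)
  pos v = Any.index (∈xs v)
  ρ-pos : ∀ v → ρ (pos v) ≡ v
  ρ-pos v = ≡-sym (lookup-index (∈xs v))
  pos-ρ : ∀ i → pos (ρ i) ≡ i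
  pos-ρ i = Unique-lookup-injective xs-unique (ρ-pos (ρ i))
  open Relabel G ρ pos ρ-pos pos-ρ
  M : Fin (length xs) → Fin (length ys) → Bool
  M i j = C (ρ i) (lookup ys j)
  no-cycle : ∀ k → ¬ SpecialCycle M k
  no-cycle k P = CliqueFamily.no-special-cycle G ch no-suns C clique maximal
    (λ {a} {b} e → (a , b) , cover e) k (<-wellFounded k)
    (record { x = ρ ∘ x ; y = lookup ys ∘ y ; m≥2 = m≥2 ; inc = inc ; exc = exc })
    where open SpecialCycle P
  Γ : ∀ {i i′ j j′} → i Fin.< i′ → j Fin.< j′ → M i j ≡ true → M i j′ ≡ true → M i′ j ≡ true → M i′ j′ ≡ true
  Γ = Γ-free M (doublySorted⇒LexRows C {xs} {ys} rows) (doublySorted⇒LexRows (transpose C) {ys} {xs} cols) no-cycle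
  built : Built G↓ (λ j i → M i j)
  built = build (length xs) G↓ (λ j i → M i j)
    (λ j p q ne → clique (lookup ys j) p q (λ e → ne (Unique-lookup-injective xs-unique e)))
    (λ {a} {b} e → let i = ∈ys (ρ a , ρ b) ; (p , q) = cover e in
      Any.index i , subst (λ t → C (ρ a) t ≡ true) (lookup-index i) p , subst (λ t → C (ρ b) t ≡ true) (lookup-index i) q)
    chain
    where
    -- Γ-freeness with v as the upper row: of two cliques through v, the one in the later column
    -- contains every later vertex of the other.
    chain : ∀ j j′ {v} → M v j ≡ true → M v j′ ≡ true →
      (∀ {y} → v Fin.< y → M y j ≡ true → M y j′ ≡ true) ⊎ (∀ {y} → v Fin.< y → M y j′ ≡ true → M y j ≡ true)
    chain j j′ p q with Finₚ.<-cmp j j′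
    ... | tri< l _ _ = inj₁ λ v<y h → Γ v<y l p q h
    ... | tri≈ _ refl _ = inj₁ λ _ h → h
    ... | tri> _ _ l = inj₂ λ v<y h → Γ v<y l q p h

stronglyChordal⇒labelling : ∀ {ℓ} (G : SimpleGraph ℓ) → StronglyChordal G → Σ (MATLabelling G) Descending
stronglyChordal⇒labelling G sc = family⇒labelling G sc (cliqueFamily G) (λ j → proj₁ (proj₂ (maxClique G j)))
  (λ j → proj₁ (proj₂ (proj₂ (maxClique G j)))) (family-cover G)

-- Connected components

Unique-⊆-length : ∀ {A : Set} {xs ys : List A} → Unique xs → (∀ {x} → x ∈ xs → x ∈ ys) → length xs ≤ length ys
Unique-⊆-length {xs = []} u h = z≤n
Unique-⊆-length {xs = x ∷ xs} {ys} (nx ∷ u) h with ∈-∃++ (h (here refl))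
... | as , bs , refl = subst (suc (length xs) ≤_) len (s≤s (Unique-⊆-length u sub))
  where
  len : suc (length (as ++ bs)) ≡ length (as ++ x ∷ bs)
  len = trans (cong suc (Listₚ.length-++ as)) (trans (≡-sym (ℕₚ.+-suc (length as) (length bs))) (≡-sym (Listₚ.length-++ as)))
  sub : ∀ {y} → y ∈ xs → y ∈ as ++ bs
  sub {y} i with ∈-++⁻ as (h (there i))
  ... | inj₁ j = ∈-++⁺ˡ j
  ... | inj₂ (here refl) = ⊥-elim (All.lookup nx i refl)
  ... | inj₂ (there j) = ∈-++⁺ʳ as j

Unique-length : ∀ {A : Set} {xs ys : List A} → Unique xs → Unique ys →
  (∀ {x} → x ∈ xs → x ∈ ys) → (∀ {x} → x ∈ ys → x ∈ xs) → length xs ≡ length ys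
Unique-length u v h g = ≤-antisym (Unique-⊆-length u h) (Unique-⊆-length v g)

module Components {ℓ : ℕ} where
  private V = Fin ℓ

  -- Union-find: every component is named by one of its vertices.
  root : List (Edge ℓ) → V → V
  root [] x = x
  root ((u , v) ∷ b) x = if does (root b x ≟ᶠ root b u) then root b v else root b x

  reps : List (Edge ℓ) → List V
  reps [] = allFin ℓ
  reps ((u , v) ∷ b) = if does (root b u ≟ᶠ root b v) then reps b else filter (λ s → ¬? (s ≟ᶠ root b u)) (reps b)

  root-joined : ∀ {u v} b {x} → root b x ≡ root b u → root ((u , v) ∷ b) x ≡ root b v
  root-joined {u} {v} b {x} e rewrite dec-true (root b x ≟ᶠ root b u) e = refl

  root-kept : ∀ {u v} b {x} → root b x ≢ root b u → root ((u , v) ∷ b) x ≡ root b x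
  root-kept {u} {v} b {x} ne rewrite dec-false (root b x ≟ᶠ root b u) ne = refl

  reps-same : ∀ {u v} b → root b u ≡ root b v → reps ((u , v) ∷ b) ≡ reps b
  reps-same {u} {v} b e rewrite dec-true (root b u ≟ᶠ root b v) e = refl

  reps-filter : ∀ {u v} b → root b u ≢ root b v → reps ((u , v) ∷ b) ≡ filter (λ s → ¬? (s ≟ᶠ root b u)) (reps b)
  reps-filter {u} {v} b ne rewrite dec-false (root b u ≟ᶠ root b v) ne = refl

  root-cong : ∀ e b {x y} → root b x ≡ root b y → root (e ∷ b) x ≡ root (e ∷ b) y
  root-cong (u , v) b h rewrite h = refl

  root-edge : ∀ b {u v} → (u , v) ∈ b → root b u ≡ root b v
  root-edge ((u , v) ∷ b) (here refl) = case root b v ≟ᶠ root b u of λ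
    { (yes e) → root-cong (u , v) b (≡-sym e)
    ; (no ne) → trans (root-joined b refl) (≡-sym (root-kept b ne)) }
  root-edge (e ∷ b) (there i) = root-cong e b (root-edge b i)

  -- The universal property of components. It serves equality of coordinates of a vector as well as
  -- equality of colours.
  root-finest : ∀ {r} {R : V → V → Set r} → IsEquivalence R → ∀ b → (∀ {u v} → (u , v) ∈ b → R u v) → ∀ x → R (root b x) x
  root-finest eq [] h x = IsEquivalence.refl eq
  root-finest {R = R} eq ((u , v) ∷ b) h x = cases (root b x ≟ᶠ root b u)
    where
    module Q = IsEquivalence eq
    IH = root-finest eq b (h ∘ there)
    cases : Dec (root b x ≡ root b u) → R (root ((u , v) ∷ b) x) x
    cases (yes e) = subst (λ t → R t x) (≡-sym (root-joined b e))
      (Q.trans (IH v) (Q.trans (Q.sym (h (here refl))) (Q.trans (Q.sym (IH u)) (subst (λ t → R t x) e (IH x)))))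
    cases (no ne) = subst (λ t → R t x) (≡-sym (root-kept b ne)) (IH x)

  same-root : ∀ {r} {R : V → V → Set r} → IsEquivalence R → ∀ b → (∀ {u v} → (u , v) ∈ b → R u v) →
    ∀ {x y} → root b x ≡ root b y → R x y
  same-root {R = R} eq b h {x} {y} e = Q.trans (Q.sym (root-finest eq b h x)) (subst (λ t → R t y) (≡-sym e) (root-finest eq b h y))
    where module Q = IsEquivalence eq

  root∈reps : ∀ b x → root b x ∈ reps b
  root∈reps [] x = ∈-allFin x
  root∈reps ((u , v) ∷ b) x = cases (root b u ≟ᶠ root b v) (root b x ≟ᶠ root b u)
    where
    cases : Dec (root b u ≡ root b v) → Dec (root b x ≡ root b u) → root ((u , v) ∷ b) x ∈ reps ((u , v) ∷ b)
    cases (yes e) (yes h) = subst₂ _∈_ (≡-sym (root-joined b h)) (≡-sym (reps-same b e)) (root∈reps b v)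
    cases (yes e) (no h) = subst₂ _∈_ (≡-sym (root-kept b h)) (≡-sym (reps-same b e)) (root∈reps b x)
    cases (no ne) (yes h) = subst₂ _∈_ (≡-sym (root-joined b h)) (≡-sym (reps-filter b ne))
      (∈-filter⁺ (λ s → ¬? (s ≟ᶠ root b u)) (root∈reps b v) (ne ∘ ≡-sym))
    cases (no ne) (no h) = subst₂ _∈_ (≡-sym (root-kept b h)) (≡-sym (reps-filter b ne))
      (∈-filter⁺ (λ s → ¬? (s ≟ᶠ root b u)) (root∈reps b x) h)

  reps-fixed : ∀ b {s} → s ∈ reps b → root b s ≡ s
  reps-fixed [] _ = refl
  reps-fixed ((u , v) ∷ b) {s} i = cases (root b u ≟ᶠ root b v) (root b s ≟ᶠ root b u)
    where
    cases : Dec (root b u ≡ root b v) → Dec (root b s ≡ root b u) → root ((u , v) ∷ b) s ≡ s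
    cases (yes e) (yes h) = trans (root-joined b h) (trans (≡-sym e) (trans (≡-sym h) (reps-fixed b (subst (s ∈_) (reps-same b e) i))))
    cases (yes e) (no h) = trans (root-kept b h) (reps-fixed b (subst (s ∈_) (reps-same b e) i))
    cases (no ne) d with ∈-filter⁻ (λ s → ¬? (s ≟ᶠ root b u)) {xs = reps b} (subst (s ∈_) (reps-filter b ne) i)
    ... | j , s≢ with d
    ...   | yes h = ⊥-elim (s≢ (trans (≡-sym (reps-fixed b j)) h))
    ...   | no h = trans (root-kept b h) (reps-fixed b j)

  reps-unique : ∀ b → Unique (reps b)
  reps-unique [] = allFin⁺ ℓ
  reps-unique ((u , v) ∷ b) with root b u ≟ᶠ root b v
  ... | yes e = reps-unique b
  ... | no ne = filter⁺ (λ s → ¬? (s ≟ᶠ root b u)) (reps-unique b)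

  length-filter-≢ : ∀ {xs : List V} {x} → Unique xs → x ∈ xs → suc (length (filter (λ s → ¬? (s ≟ᶠ x)) xs)) ≡ length xs
  length-filter-≢ {xs} {x} u i = Unique-length (All.tabulate (λ j e → proj₂ (∈-filter⁻ (λ s → ¬? (s ≟ᶠ x)) {xs = xs} j) (≡-sym e)) ∷ filter⁺ (λ s → ¬? (s ≟ᶠ x)) u) u
    (λ { (here refl) → i ; (there j) → proj₁ (∈-filter⁻ (λ s → ¬? (s ≟ᶠ x)) {xs = xs} j) })
    (λ {y} j → case y ≟ᶠ x of λ { (yes refl) → here refl ; (no ne) → there (∈-filter⁺ (λ s → ¬? (s ≟ᶠ x)) j ne) })

  reps-shrink : ∀ {u v} b → root b u ≢ root b v → suc (length (reps ((u , v) ∷ b))) ≡ length (reps b)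
  reps-shrink {u} {v} b ne = trans (cong (suc ∘ length) (reps-filter b ne)) (length-filter-≢ (reps-unique b) (root∈reps b u))

  length-allFin : length (allFin ℓ) ≡ ℓ
  length-allFin = Listₚ.length-tabulate {n = ℓ} (λ i → i)

  reps-length : ∀ b → ℓ ≤ length (reps b) + length b
  reps-length [] = ≤-reflexive (trans (≡-sym length-allFin) (≡-sym (ℕₚ.+-identityʳ _)))
  reps-length ((u , v) ∷ b) = cases (root b u ≟ᶠ root b v)
    where
    cases : Dec (root b u ≡ root b v) → ℓ ≤ length (reps ((u , v) ∷ b)) + suc (length b)
    cases (yes e) = ≤-trans (reps-length b) (ℕₚ.+-mono-≤ (≤-reflexive (cong length (≡-sym (reps-same b e)))) (n≤1+n _))
    cases (no ne) = ≤-trans (reps-length b) (≤-reflexive (trans (cong (_+ length b) (≡-sym (reps-shrink b ne))) (≡-sym (ℕₚ.+-suc _ (length b)))))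

  -- Each edge joins two components of the edges behind it in the list, so it lowers the number of
  -- components by exactly one.
  Forest : List (Edge ℓ) → Set
  Forest [] = Fin 1
  Forest ((u , v) ∷ b) = root b u ≢ root b v × Forest b

  forest-length : ∀ b → Forest b → length (reps b) + length b ≡ ℓ
  forest-length [] _ = trans (ℕₚ.+-identityʳ _) length-allFin
  forest-length ((u , v) ∷ b) (ne , f) = trans (ℕₚ.+-suc _ (length b)) (trans (cong (_+ length b) (reps-shrink b ne)) (forest-length b f))

open Components public

-- Linear algebra

module Linear {c ℓ′ : Level} (K : Field c ℓ′) (ℓ : ℕ) where
  open Field K hiding (zero) renaming (refl to ≈-refl; sym to ≈-sym; trans to ≈-trans; reflexive to ≈-reflexive; _+_ to _⊕_; _*_ to _⊛_; setoid to ≈-setoid)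
  open import Relation.Binary.Reasoning.Setoid ≈-setoid
  open import Data.Vec.Functional using (insertAt)
  open import Data.Vec.Functional.Properties using (insertAt-lookup; insertAt-punchIn)
  import Algebra.Properties.Ring ring as Ringₚ
  import Algebra.Properties.CommutativeSemigroup as CSG

  private
    Σ′ : ∀ d → (Fin d → Carrier) → Carrier
    Σ′ = LinAlg.sumF K ℓ

  interchange : ∀ a b c d → (a ⊕ b) ⊕ (c ⊕ d) ≈ (a ⊕ c) ⊕ (b ⊕ d)
  interchange = CSG.interchange +-commutativeSemigroup

  sum-cong : ∀ d {f g : Fin d → Carrier} → (∀ k → f k ≈ g k) → Σ′ d f ≈ Σ′ d g
  sum-cong zero h = ≈-refl
  sum-cong (suc d) h = +-cong (h zero) (sum-cong d (h ∘ suc))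

  sum-zero : ∀ d {f : Fin d → Carrier} → (∀ k → f k ≈ 0#) → Σ′ d f ≈ 0#
  sum-zero zero h = ≈-refl
  sum-zero (suc d) h = ≈-trans (+-cong (h zero) (sum-zero d (h ∘ suc))) (+-identityʳ 0#)

  sum-single : ∀ d (f : Fin d → Carrier) k → (∀ s → s ≢ k → f s ≈ 0#) → Σ′ d f ≈ f k
  sum-single (suc d) f zero h = ≈-trans (+-cong ≈-refl (sum-zero d (λ s → h (suc s) λ ()))) (+-identityʳ _)
  sum-single (suc d) f (suc k) h = ≈-trans (+-cong (h zero λ ()) (sum-single d (f ∘ suc) k (λ s ne → h (suc s) (ne ∘ Finₚ.suc-injective)))) (+-identityˡ _)

  sum-add : ∀ d (f g : Fin d → Carrier) → Σ′ d (λ k → f k ⊕ g k) ≈ Σ′ d f ⊕ Σ′ d g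
  sum-add zero f g = ≈-sym (+-identityʳ 0#)
  sum-add (suc d) f g = ≈-trans (+-cong ≈-refl (sum-add d (f ∘ suc) (g ∘ suc))) (interchange _ _ _ _)

  sum-scaleʳ : ∀ d (f : Fin d → Carrier) t → Σ′ d (λ k → f k ⊛ t) ≈ Σ′ d f ⊛ t
  sum-scaleʳ zero f t = ≈-sym (zeroˡ t)
  sum-scaleʳ (suc d) f t = ≈-trans (+-cong ≈-refl (sum-scaleʳ d (f ∘ suc) t)) (≈-sym (distribʳ t _ _))

  sum-scaleˡ : ∀ d (f : Fin d → Carrier) t → Σ′ d (λ k → t ⊛ f k) ≈ t ⊛ Σ′ d f
  sum-scaleˡ d f t = ≈-trans (sum-cong d λ k → *-comm t (f k)) (≈-trans (sum-scaleʳ d f t) (*-comm _ t))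

  sum-swap : ∀ d e (f : Fin d → Fin e → Carrier) → Σ′ d (λ i → Σ′ e (f i)) ≈ Σ′ e (λ j → Σ′ d (λ i → f i j))
  sum-swap zero e f = ≈-sym (sum-zero e λ _ → ≈-refl)
  sum-swap (suc d) e f = ≈-trans (+-cong ≈-refl (sum-swap d e (f ∘ suc))) (≈-sym (sum-add e (f zero) _))

  sum-punchIn : ∀ d (f : Fin (suc d) → Carrier) p → Σ′ (suc d) f ≈ f p ⊕ Σ′ d (f ∘ Fin.punchIn p)
  sum-punchIn d f zero = ≈-refl
  sum-punchIn (suc d) f (suc p) = begin
    f zero ⊕ Σ′ (suc d) (f ∘ suc)                                  ≈⟨ +-cong ≈-refl (sum-punchIn d (f ∘ suc) p) ⟩
    f zero ⊕ (f (suc p) ⊕ Σ′ d (f ∘ suc ∘ Fin.punchIn p))           ≈⟨ CSG.x∙yz≈y∙xz +-commutativeSemigroup _ _ _ ⟩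
    f (suc p) ⊕ (f zero ⊕ Σ′ d (f ∘ suc ∘ Fin.punchIn p))           ∎

  TrivialKernel : ∀ d e → (Fin d → Fin e → Carrier) → Set (c Level.⊔ ℓ′)
  TrivialKernel d e a = ∀ (x : Fin d → Carrier) → (∀ j → Σ′ d (λ k → x k ⊛ a k j) ≈ 0#) → ∀ k → x k ≈ 0#

  -- Equality with 0 is not decidable in K, so the search for a pivot takes place under a double
  -- negation, which suffices for a negative goal.
  ¬¬-finite : ∀ {p} n {P : Fin n → Set p} → (∀ k → ¬ ¬ P k) → ¬ ¬ (∀ k → P k)
  ¬¬-finite zero h g = g λ ()
  ¬¬-finite (suc n) h g = h zero λ p → ¬¬-finite n (h ∘ suc) λ q → g λ { zero → p ; (suc k) → q k }

  module Pivot {d} (a : Fin (suc (suc d)) → Fin (suc d) → Carrier) (tk : TrivialKernel _ _ a)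
    (p : Fin (suc (suc d))) (q : Carrier) (inv : a p zero ⊛ q ≈ 1#) where
    reduced : Fin (suc d) → Fin d → Carrier
    reduced k j = a (Fin.punchIn p k) (suc j) ⊕ a (Fin.punchIn p k) zero ⊛ (- q ⊛ a p (suc j))

    reduced-trivial : TrivialKernel _ _ reduced
    reduced-trivial x h k = ≈-trans (≈-reflexive (≡-sym (insertAt-punchIn x p (Y ⊛ - q) k))) (tk y sys (Fin.punchIn p k))
      where
      Y = Σ′ (suc d) (λ k → x k ⊛ a (Fin.punchIn p k) zero)
      -- The unknown p receives the value that solves the first equation.
      y : Fin (suc (suc d)) → Carrier
      y = insertAt x p (Y ⊛ - q)
      column : ∀ j → Σ′ (2 + d) (λ k → y k ⊛ a k j) ≈ (Y ⊛ - q) ⊛ a p j ⊕ Σ′ (1 + d) (λ k → x k ⊛ a (Fin.punchIn p k) j)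
      column j = ≈-trans (sum-punchIn (1 + d) (λ k → y k ⊛ a k j) p) (+-cong (*-cong (≈-reflexive (insertAt-lookup x p (Y ⊛ - q))) ≈-refl)
        (sum-cong (1 + d) λ k → *-cong (≈-reflexive (insertAt-punchIn x p (Y ⊛ - q) k)) (≈-refl {a (Fin.punchIn p k) j})))
      sys : ∀ j → Σ′ (2 + d) (λ k → y k ⊛ a k j) ≈ 0#
      sys zero = begin
        Σ′ (2 + d) (λ k → y k ⊛ a k zero)       ≈⟨ column zero ⟩
        (Y ⊛ - q) ⊛ a p zero ⊕ Y          ≈⟨ +-cong (*-assoc Y (- q) _) (≈-sym (*-identityʳ Y)) ⟩
        Y ⊛ (- q ⊛ a p zero) ⊕ Y ⊛ 1#     ≈⟨ distribˡ Y _ _ ⟨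
        Y ⊛ (- q ⊛ a p zero ⊕ 1#)         ≈⟨ *-cong ≈-refl (+-cong (≈-trans (≈-sym (Ringₚ.-‿distribˡ-* q _)) (-‿cong (≈-trans (*-comm q _) inv))) ≈-refl) ⟩
        Y ⊛ (- 1# ⊕ 1#)                   ≈⟨ *-cong ≈-refl (-‿inverseˡ 1#) ⟩
        Y ⊛ 0#                            ≈⟨ zeroʳ Y ⟩
        0#                                ∎
      sys (suc j) = begin
        Σ′ (2 + d) (λ k → y k ⊛ a k (suc j))                          ≈⟨ column (suc j) ⟩
        (Y ⊛ - q) ⊛ z ⊕ Σ′ (1 + d) (λ k → x k ⊛ A k)                  ≈⟨ +-comm _ _ ⟩
        Σ′ (1 + d) (λ k → x k ⊛ A k) ⊕ (Y ⊛ - q) ⊛ z                  ≈⟨ +-cong ≈-refl (≈-trans (*-assoc Y (- q) z) (≈-sym (sum-scaleʳ (1 + d) (λ k → x k ⊛ B k) t))) ⟩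
        Σ′ (1 + d) (λ k → x k ⊛ A k) ⊕ Σ′ (1 + d) (λ k → (x k ⊛ B k) ⊛ t)   ≈⟨ sum-add (1 + d) (λ k → x k ⊛ A k) (λ k → (x k ⊛ B k) ⊛ t) ⟨
        Σ′ (1 + d) (λ k → x k ⊛ A k ⊕ (x k ⊛ B k) ⊛ t)                ≈⟨ sum-cong (1 + d) (λ k → ≈-trans (+-cong ≈-refl (*-assoc (x k) (B k) t)) (≈-sym (distribˡ (x k) (A k) (B k ⊛ t)))) ⟩
        Σ′ (1 + d) (λ k → x k ⊛ reduced k j)                          ≈⟨ h j ⟩
        0#                                                      ∎
        where
        z = a p (suc j)
        t = - q ⊛ z
        A : Fin (suc d) → Carrier
        A = λ k → a (Fin.punchIn p k) (suc j)
        B : Fin (suc d) → Carrier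
        B = λ k → a (Fin.punchIn p k) zero

  -- Gaussian elimination: a nonzero coefficient in the first equation serves as a pivot. If all of
  -- them vanish, that equation is void and the first unknown can be set to 0.
  wide-kernel : ∀ d (a : Fin (suc d) → Fin d → Carrier) → ¬ TrivialKernel (suc d) d a
  wide-kernel zero a tk = 1≉0 (tk (λ _ → 1#) (λ ()) zero)
  wide-kernel (suc d) a tk = ¬¬-finite (suc (suc d)) {λ p → a p zero ≈ 0#}
    (λ p ne → let (q , inv) = inverse (a p zero) ne in wide-kernel d (Pivot.reduced a tk p q inv) (Pivot.reduced-trivial a tk p q inv))
    λ zeros → wide-kernel d (λ k j → a (suc k) (suc j)) λ x h k →
      tk (cons′ x) (λ { zero → sum-zero (suc (suc d)) (λ k → ≈-trans (*-cong (≈-refl {cons′ x k}) (zeros k)) (zeroʳ _))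
                      ; (suc j) → ≈-trans (+-cong (zeroˡ _) (h j)) (+-identityˡ 0#) }) (suc k)
    where
    cons′ : ∀ {m} → (Fin m → Carrier) → Fin (suc m) → Carrier
    cons′ x zero = 0#
    cons′ x (suc k) = x k

  open LinAlg K ℓ

  -≈0⇒≈ : ∀ {p q} → p - q ≈ 0# → p ≈ q
  -≈0⇒≈ {p} {q} h = Ringₚ.x∙y⁻¹≈ε⇒x≈y p q h

  ≈⇒-≈0 : ∀ {p q} → p ≈ q → p - q ≈ 0#
  ≈⇒-≈0 {p} {q} h = ≈-trans (+-cong h ≈-refl) (-‿inverseʳ q)

  indicator : Bool → Carrier
  indicator true = 1#
  indicator false = 0#

  component : List (Edge ℓ) → Fin ℓ → Vec
  component b s x = indicator (does (root b x ≟ᶠ s))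

  Inter⁺ : ∀ b {x : Vec} → (∀ {u v} → (u , v) ∈ b → x u ≈ x v) → Inter b x
  Inter⁺ b h = All.tabulate λ i → Level.lift (≈⇒-≈0 (h i))

  Inter⁻ : ∀ b {x : Vec} → Inter b x → ∀ {u v} → (u , v) ∈ b → x u ≈ x v
  Inter⁻ b h i = -≈0⇒≈ (Level.lower (All.lookup h i))

  level : (x : Vec) → IsEquivalence (λ p q → x p ≈ x q)
  level x = record { refl = ≈-refl ; sym = ≈-sym ; trans = ≈-trans }

  component-values : ∀ b {x y s} → root b x ≡ root b y → component b s x ≈ component b s y
  component-values b {s = s} e = ≈-reflexive (cong (λ t → indicator (does (t ≟ᶠ s))) e)

  component-self : ∀ b {s} → root b s ≡ s → component b s s ≈ 1#
  component-self b {s} e = ≈-reflexive (cong indicator (dec-true (root b s ≟ᶠ s) e))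

  component-other : ∀ b {s x} → root b x ≢ s → component b s x ≈ 0#
  component-other b {s} {x} ne = ≈-reflexive (cong indicator (dec-false (root b x ≟ᶠ s) ne))

  module _ (b : List (Edge ℓ)) where
    private
      n = length (reps b)
      rep : Fin n → Fin ℓ
      rep = lookup (reps b)

    basis : Fin n → Vec
    basis k = component b (rep k)

    rep-root : ∀ k → root b (rep k) ≡ rep k
    rep-root k = reps-fixed b (∈-lookup k)

    combination-at : ∀ (a : Fin n → Carrier) i k → root b i ≡ rep k → lincomb n a basis i ≈ a k
    combination-at a i k e = ≈-trans (sum-single n (λ s → a s ⊛ basis s i) k λ s ne →
        ≈-trans (*-cong ≈-refl (component-other b λ e′ → ne (Unique-lookup-injective (reps-unique b) (trans (≡-sym e′) e)))) (zeroʳ (a s)))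
      (≈-trans (*-cong ≈-refl (≈-reflexive (cong indicator (dec-true (root b i ≟ᶠ rep k) e)))) (*-identityʳ (a k)))

    basis-independent : ∀ a → (∀ i → lincomb n a basis i ≈ 0#) → ∀ k → a k ≈ 0#
    basis-independent a h k = ≈-trans (≈-sym (combination-at a (rep k) k (rep-root k))) (h (rep k))

    Inter-dim : HasDim (Inter b) n
    Inter-dim = basis , (λ k → Inter⁺ b λ i → component-values b (root-edge b i)) , basis-independent , spanning
      where
      spanning : ∀ w → Inter b w → Σ (Fin n → Carrier) λ a → ∀ i → w i ≈ lincomb n a basis i
      spanning w h = w ∘ rep , λ i → let k = Any.index (root∈reps b i) ; e = lookup-index (root∈reps b i) in
        ≈-trans (≈-sym (root-finest (level w) b (Inter⁻ b h) i)) (≈-trans (≈-reflexive (cong w e)) (≈-sym (combination-at (w ∘ rep) i k e)))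

    forest-rank : Forest b → HasRank b (length b)
    forest-rank f = subst (length b ≤_) (forest-length b f) (ℕₚ.m≤n+m (length b) n) ,
      subst (HasDim (Inter b)) (trans (≡-sym (ℕₚ.m+n∸n≡m n (length b))) (cong (_∸ length b) (forest-length b f))) Inter-dim

    -- Expand d + 1 indicator vectors of components in the d spanning vectors. Evaluation at the
    -- representatives recovers the coefficients of a relation, so the coordinate matrix has trivial
    -- kernel, against `wide-kernel`.
    dimension-bound : ∀ {W d} → (∀ k → W (basis k)) → HasDim W d → ¬ (d < n)
    dimension-bound {W} {d} inW (v , _ , _ , span) d<n = wide-kernel d A trivial
      where
      ι : Fin (suc d) → Fin n
      ι k = Fin.inject≤ k d<n
      A : Fin (suc d) → Fin d → Carrier
      A k = proj₁ (span (basis (ι k)) (inW (ι k)))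
      expand : ∀ k i → basis (ι k) i ≈ lincomb d (A k) v i
      expand k = proj₂ (span (basis (ι k)) (inW (ι k)))
      trivial : TrivialKernel (suc d) d A
      trivial x h k = begin
        x k                                                       ≈⟨ *-identityʳ (x k) ⟨
        x k ⊛ 1#                                                  ≈⟨ *-cong ≈-refl (component-self b (rep-root (ι k))) ⟨
        x k ⊛ basis (ι k) i                                       ≈⟨ sum-single (suc d) (λ s → x s ⊛ basis (ι s) i) k other ⟨
        Σ′ (suc d) (λ s → x s ⊛ basis (ι s) i)                    ≈⟨ sum-cong (suc d) (λ s → *-cong (≈-refl {x s}) (expand s i)) ⟩
        Σ′ (suc d) (λ s → x s ⊛ Σ′ d (λ j → A s j ⊛ v j i))       ≈⟨ sum-cong (suc d) (λ s → ≈-sym (sum-scaleˡ d (λ j → A s j ⊛ v j i) (x s))) ⟩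
        Σ′ (suc d) (λ s → Σ′ d (λ j → x s ⊛ (A s j ⊛ v j i)))     ≈⟨ sum-swap (suc d) d (λ s j → x s ⊛ (A s j ⊛ v j i)) ⟩
        Σ′ d (λ j → Σ′ (suc d) (λ s → x s ⊛ (A s j ⊛ v j i)))     ≈⟨ sum-zero d vanish ⟩
        0#                                                        ∎
        where
        i = rep (ι k)
        other : ∀ s → s ≢ k → x s ⊛ basis (ι s) i ≈ 0#
        other s ne = ≈-trans (*-cong ≈-refl (component-other b λ e →
          ne (Finₚ.inject≤-injective d<n d<n s k (Unique-lookup-injective (reps-unique b) (trans (≡-sym e) (rep-root (ι k))))))) (zeroʳ (x s))
        vanish : ∀ j → Σ′ (suc d) (λ s → x s ⊛ (A s j ⊛ v j i)) ≈ 0#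
        vanish j = begin
          Σ′ (suc d) (λ s → x s ⊛ (A s j ⊛ v j i))   ≈⟨ sum-cong (suc d) (λ s → ≈-sym (*-assoc (x s) (A s j) (v j i))) ⟩
          Σ′ (suc d) (λ s → (x s ⊛ A s j) ⊛ v j i)   ≈⟨ sum-scaleʳ (suc d) (λ s → x s ⊛ A s j) (v j i) ⟩
          Σ′ (suc d) (λ s → x s ⊛ A s j) ⊛ v j i     ≈⟨ *-cong (h j) ≈-refl ⟩
          0# ⊛ v j i                                 ≈⟨ zeroˡ _ ⟩
          0#                                         ∎

-- Restrictions

Unique-map-on : ∀ {A B : Set} (f : A → B) {xs : List A} → Unique xs →
  (∀ {x y} → x ∈ xs → y ∈ xs → f x ≡ f y → x ≡ y) → Unique (map f xs)
Unique-map-on f [] h = []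
Unique-map-on f {x ∷ xs} (nx ∷ u) h = All.tabulate apart ∷ Unique-map-on f u (λ i j → h (there i) (there j))
  where
  apart : ∀ {z} → z ∈ map f xs → f x ≢ z
  apart i e with ∈-map⁻ f i
  ... | y , j , refl = All.lookup nx j (h (here refl) (there j) e)

length-filter-split : ∀ {A : Set} {P : A → Set} (P? : Decidable P) xs →
  length (filter P? xs) + length (filter (¬? ∘ P?) xs) ≡ length xs
length-filter-split P? [] = refl
length-filter-split P? (x ∷ xs) with P? x
... | yes _ = cong suc (length-filter-split P? xs)
... | no _ = trans (ℕₚ.+-suc _ _) (cong suc (length-filter-split P? xs))

length-filter-tabulate : ∀ {A : Set} n (f : Fin n → A) (P : A → Bool) →
  length (filter (λ x → P x Bool.≟ true) (tabulate f)) ≡ # (P ∘ f)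
length-filter-tabulate zero f P = refl
length-filter-tabulate (suc n) f P with P (f zero)
... | true = cong suc (length-filter-tabulate n (f ∘ suc) P)
... | false = length-filter-tabulate n (f ∘ suc) P

mkEdge : ∀ {ℓ} → Fin ℓ → Fin ℓ → Edge ℓ
mkEdge u w = if does (u Fin.<? w) then (u , w) else (w , u)

mkEdge-< : ∀ {ℓ} {u w : Fin ℓ} → u Fin.< w → mkEdge u w ≡ (u , w)
mkEdge-< {u = u} {w} l rewrite dec-true (u Fin.<? w) l = refl

mkEdge-> : ∀ {ℓ} {u w : Fin ℓ} → w Fin.< u → mkEdge u w ≡ (w , u)
mkEdge-> {u = u} {w} l rewrite dec-false (u Fin.<? w) (λ l′ → <-irrefl refl (<-trans l l′)) = refl

mkEdge-cases : ∀ {ℓ} (u w : Fin ℓ) → mkEdge u w ≡ (u , w) ⊎ mkEdge u w ≡ (w , u)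
mkEdge-cases u w with does (u Fin.<? w)
... | true = inj₁ refl
... | false = inj₂ refl

mkEdge-sym : ∀ {ℓ} (u w : Fin ℓ) → mkEdge u w ≡ mkEdge w u
mkEdge-sym u w with Finₚ.<-cmp u w
... | tri< l _ _ = trans (mkEdge-< l) (≡-sym (mkEdge-> l))
... | tri≈ _ refl _ = refl
... | tri> _ _ l = trans (mkEdge-> l) (≡-sym (mkEdge-< l))

mkEdge-injective : ∀ {ℓ} {u w p q : Fin ℓ} → mkEdge u w ≡ mkEdge p q → (u ≡ p × w ≡ q) ⊎ (u ≡ q × w ≡ p)
mkEdge-injective {u = u} {w} {p} {q} e with mkEdge-cases u w | mkEdge-cases p q
... | inj₁ a | inj₁ b with trans (≡-sym a) (trans e b)
...   | refl = inj₁ (refl , refl)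
mkEdge-injective {u = u} {w} {p} {q} e | inj₁ a | inj₂ b with trans (≡-sym a) (trans e b)
...   | refl = inj₂ (refl , refl)
mkEdge-injective {u = u} {w} {p} {q} e | inj₂ a | inj₁ b with trans (≡-sym a) (trans e b)
...   | refl = inj₂ (refl , refl)
mkEdge-injective {u = u} {w} {p} {q} e | inj₂ a | inj₂ b with trans (≡-sym a) (trans e b)
...   | refl = inj₁ (refl , refl)

module Restriction {c ℓ′ : Level} (K : Field c ℓ′) {ℓ : ℕ} (u v : Fin ℓ) (u<v : u Fin.< v)
  (P : List (Edge ℓ)) (P-unique : Unique P) (ordered : ∀ {a b} → (a , b) ∈ P → a Fin.< b) (H∉P : (u , v) ∉ P) where
  open Field K hiding (zero) renaming (refl to ≈-refl; sym to ≈-sym; trans to ≈-trans; reflexive to ≈-reflexive; _+_ to _⊕_; _*_ to _⊛_; setoid to ≈-setoid)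
  open LinAlg K ℓ
  open Linear K ℓ using (-≈0⇒≈; ≈⇒-≈0; indicator)
  open import Data.List.Membership.DecPropositional (_≟ₑ_ {ℓ}) using (_∈?_)

  private
    H : Edge ℓ
    H = (u , v)

  u≢v : u ≢ v
  u≢v e = <-irrefl (cong toℕ e) u<v

  -- Contracting v to u: restricted to H, the hyperplane of K only depends on `key K`.
  contract : Fin ℓ → Fin ℓ
  contract x = if does (x ≟ᶠ v) then u else x

  contract-v : contract v ≡ u
  contract-v rewrite dec-true (v ≟ᶠ v) refl = refl

  contract-other : ∀ {x} → x ≢ v → contract x ≡ x
  contract-other {x} ne rewrite dec-false (x ≟ᶠ v) ne = refl

  key : Edge ℓ → Edge ℓ
  key (a , b) = mkEdge (contract a) (contract b)

  key-mkEdge : ∀ p q → key (mkEdge p q) ≡ mkEdge (contract p) (contract q)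
  key-mkEdge p q with mkEdge-cases p q
  ... | inj₁ e = cong key e
  ... | inj₂ e = trans (cong key e) (mkEdge-sym (contract q) (contract p))

  ∈H-mkEdge⁻ : ∀ {x : Vec} {p q} → x ∈H mkEdge p q → x p ≈ x q
  ∈H-mkEdge⁻ {x} {p} {q} h with mkEdge-cases p q
  ... | inj₁ e = -≈0⇒≈ (subst (x ∈H_) e h)
  ... | inj₂ e = ≈-sym (-≈0⇒≈ (subst (x ∈H_) e h))

  ∈H-mkEdge⁺ : ∀ {x : Vec} {p q} → x p ≈ x q → x ∈H mkEdge p q
  ∈H-mkEdge⁺ {x} {p} {q} h with mkEdge-cases p q
  ... | inj₁ e = subst (x ∈H_) (≡-sym e) (≈⇒-≈0 h)
  ... | inj₂ e = subst (x ∈H_) (≡-sym e) (≈⇒-≈0 (≈-sym h))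

  contract-value : ∀ {x : Vec} → x ∈H H → ∀ a → x (contract a) ≈ x a
  contract-value {x} h a = case a ≟ᶠ v of λ
    { (yes refl) → ≈-trans (≈-reflexive (cong x contract-v)) (-≈0⇒≈ h)
    ; (no ne) → ≈-reflexive (cong x (contract-other ne)) }

  key⇒same : ∀ {e f} → key e ≡ key f → SameRestr H e f
  key⇒same {e} {f} eq x = (λ { (p , h) → half {e} {f} eq p h , h }) , (λ { (p , h) → half {f} {e} (≡-sym eq) p h , h })
    where
    half : ∀ {e f} → key e ≡ key f → x ∈H e → x ∈H H → x ∈H f
    half {a , b} {c , d} eq p h = ≈⇒-≈0 (≈-trans (≈-sym (contract-value {x} h c)) (≈-trans (∈H-mkEdge⁻ {x} (subst (x ∈H_) eq
      (∈H-mkEdge⁺ {x} (≈-trans (contract-value {x} h a) (≈-trans (-≈0⇒≈ p) (≈-sym (contract-value {x} h b))))))) (contract-value {x} h d)))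

  contract-≢ : ∀ {a b} → a Fin.< b → (a , b) ≢ H → contract a ≢ contract b
  contract-≢ {a} {b} l ne e = cases (a ≟ᶠ v) (b ≟ᶠ v)
    where
    cases : Dec (a ≡ v) → Dec (b ≡ v) → ⊥
    cases (yes refl) (yes refl) = <-irrefl refl l
    cases (yes refl) (no bv) = <-irrefl refl (<-trans u<v (subst (v Fin.<_) (trans (≡-sym (contract-other bv)) (trans (≡-sym e) contract-v)) l))
    cases (no av) (yes refl) = ne (cong (_, v) (trans (≡-sym (contract-other av)) (trans e contract-v)))
    cases (no av) (no bv) = <-irrefl (cong toℕ (trans (≡-sym (contract-other av)) (trans e (contract-other bv)))) l

  -- For each z the indicator of the vertices contracted to z lies in H. If z is not an end of the
  -- contracted edge pq, the vector also lies in the hyperplane of ab, hence in that of cd; so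
  -- neither r nor s is such a z.
  same⇒key : ∀ {a b c d} → a Fin.< b → (a , b) ≢ H → c Fin.< d → (c , d) ≢ H → SameRestr H (a , b) (c , d) → key (a , b) ≡ key (c , d)
  same⇒key {a} {b} {c} {d} ab abH cd cdH same = cases (r ≟ᶠ p) (r ≟ᶠ q) (s ≟ᶠ p) (s ≟ᶠ q)
    where
    p = contract a
    q = contract b
    r = contract c
    s = contract d
    test : Fin ℓ → Vec
    test z x = indicator (does (contract x ≟ᶠ z))
    hit : ∀ z x → contract x ≡ z → test z x ≈ 1#
    hit z x e = ≈-reflexive (cong indicator (dec-true (contract x ≟ᶠ z) e))
    miss : ∀ z x → contract x ≢ z → test z x ≈ 0#
    miss z x ne = ≈-reflexive (cong indicator (dec-false (contract x ≟ᶠ z) ne))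
    testH : ∀ z → test z ∈H H
    testH z = ≈⇒-≈0 (≈-reflexive (cong (λ t → indicator (does (t ≟ᶠ z))) (trans (contract-other u≢v) (≡-sym contract-v))))
    forces : ∀ z → z ≢ p → z ≢ q → test z c ≈ test z d
    forces z zp zq = -≈0⇒≈ (proj₁ (proj₁ (same (test z)) (≈⇒-≈0 (≈-trans (miss z a (zp ∘ ≡-sym)) (≈-sym (miss z b (zq ∘ ≡-sym)))) , testH z)))
    r≢s : r ≢ s
    r≢s = contract-≢ cd cdH
    bad-r : r ≢ p → r ≢ q → ⊥
    bad-r rp rq = 1≉0 (≈-trans (≈-sym (hit r c refl)) (≈-trans (forces r rp rq) (miss r d (r≢s ∘ ≡-sym))))
    bad-s : s ≢ p → s ≢ q → ⊥
    bad-s sp sq = 1≉0 (≈-trans (≈-sym (hit s d refl)) (≈-trans (≈-sym (forces s sp sq)) (miss s c r≢s)))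
    cases : Dec (r ≡ p) → Dec (r ≡ q) → Dec (s ≡ p) → Dec (s ≡ q) → mkEdge p q ≡ mkEdge r s
    cases (no rp) (no rq) _ _ = ⊥-elim (bad-r rp rq)
    cases _ _ (no sp) (no sq) = ⊥-elim (bad-s sp sq)
    cases (yes rp) _ _ (yes sq) = cong₂ mkEdge (≡-sym rp) (≡-sym sq)
    cases _ (yes rq) (yes sp) _ = trans (mkEdge-sym p q) (cong₂ mkEdge (≡-sym rq) (≡-sym sp))
    cases (yes rp) (no _) (yes sp) (no _) = ⊥-elim (r≢s (trans rp (≡-sym sp)))
    cases (no _) (yes rq) (no _) (yes sq) = ⊥-elim (r≢s (trans rq (≡-sym sq)))

  common : Fin ℓ → Bool
  common w = does (mkEdge u w ∈? P) ∧ does (mkEdge v w ∈? P)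

  common⁻ : ∀ {w} → common w ≡ true → mkEdge u w ∈ P × mkEdge v w ∈ P
  common⁻ {w} h = let (p , q) = ∧-true⁻ {does (mkEdge u w ∈? P)} h in does⁻ (mkEdge u w ∈? P) p , does⁻ (mkEdge v w ∈? P) q

  common⁺ : ∀ {w} → mkEdge u w ∈ P → mkEdge v w ∈ P → common w ≡ true
  common⁺ {w} p q = ∧-true⁺ (does⁺ (mkEdge u w ∈? P) p) (does⁺ (mkEdge v w ∈? P) q)

  mkEdge∈P⇒≢ : ∀ {p q} → mkEdge p q ∈ P → p ≢ q
  mkEdge∈P⇒≢ {p} i refl with mkEdge-cases p p
  ... | inj₁ e = <-irrefl refl (ordered (subst (_∈ P) e i))
  ... | inj₂ e = <-irrefl refl (ordered (subst (_∈ P) e i))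

  -- One of the two edges of every triangle over H, the other one representing the same restriction.
  duplicates : List (Edge ℓ)
  duplicates = map (mkEdge v) (filter (λ w → common w Bool.≟ true) (allFin ℓ))

  dup⁻ : ∀ {e} → e ∈ duplicates → ∃ λ w → e ≡ mkEdge v w × common w ≡ true
  dup⁻ i with ∈-map⁻ (mkEdge v) i
  ... | w , j , refl = w , refl , proj₂ (∈-filter⁻ (λ w → common w Bool.≟ true) {xs = allFin ℓ} j)

  dup⁺ : ∀ {w} → common w ≡ true → mkEdge v w ∈ duplicates
  dup⁺ {w} h = ∈-map⁺ (mkEdge v) (∈-filter⁺ (λ w → common w Bool.≟ true) (∈-allFin w) h)

  canonical : List (Edge ℓ)
  canonical = filter (λ e → ¬? (e ∈? duplicates)) P

  canonical⁻ : ∀ {e} → e ∈ canonical → e ∈ P × e ∉ duplicates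
  canonical⁻ = ∈-filter⁻ (λ e → ¬? (e ∈? duplicates)) {xs = P}

  length-canonical : # common + length canonical ≡ length P
  length-canonical = trans (cong (_+ length canonical) (trans (≡-sym size) same-size)) (length-filter-split (_∈? duplicates) P)
    where
    size : length duplicates ≡ # common
    size = trans (Listₚ.length-map (mkEdge v) (filter (λ w → common w Bool.≟ true) (allFin ℓ))) (length-filter-tabulate ℓ (λ i → i) common)
    mk-inj : ∀ {x y} → mkEdge v x ≡ mkEdge v y → x ≡ y
    mk-inj e with mkEdge-injective e
    ... | inj₁ (_ , h) = h
    ... | inj₂ (h , h′) = trans h′ h
    same-size : length duplicates ≡ length (filter (_∈? duplicates) P)
    same-size = Unique-length (map⁺ mk-inj (filter⁺ (λ w → common w Bool.≟ true) (allFin⁺ ℓ))) (filter⁺ (_∈? duplicates) P-unique)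
      (λ i → ∈-filter⁺ (_∈? duplicates) (let (w , e , h) = dup⁻ i in subst (_∈ P) (≡-sym e) (proj₂ (common⁻ h))) i)
      (λ i → proj₂ (∈-filter⁻ (_∈? duplicates) {xs = P} i))

  shape : ∀ {a b} → (a , b) ∈ P → key (a , b) ≡ (a , b) ⊎ (∃ λ w → (a , b) ≡ mkEdge v w × w ≢ u × key (a , b) ≡ mkEdge u w)
  shape {a} {b} i = cases (a ≟ᶠ v) (b ≟ᶠ v)
    where
    cases : Dec (a ≡ v) → Dec (b ≡ v) → _
    cases (yes refl) (yes refl) = ⊥-elim (<-irrefl refl (ordered i))
    cases (yes refl) (no bv) = inj₂ (b , ≡-sym (mkEdge-< (ordered i)) , (λ { refl → <-irrefl refl (<-trans u<v (ordered i)) }) ,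
      cong₂ mkEdge contract-v (contract-other bv))
    cases (no av) (yes refl) = inj₂ (a , ≡-sym (mkEdge-> (ordered i)) , (λ { refl → H∉P i }) ,
      trans (cong₂ mkEdge (contract-other av) contract-v) (mkEdge-sym a u))
    cases (no av) (no bv) = inj₁ (trans (cong₂ mkEdge (contract-other av) (contract-other bv)) (mkEdge-< (ordered i)))

  -- Distinct edges of P share a key only as a pair from u and v to a common w, and then the edge at
  -- v is among the `duplicates`.
  key-injective : ∀ {e f} → e ∈ canonical → f ∈ canonical → key e ≡ key f → e ≡ f
  key-injective i j eq with canonical⁻ i | canonical⁻ j
  ... | iP , i∉ | jP , j∉ with shape iP | shape jP
  ... | inj₁ ke | inj₁ kf = trans (≡-sym ke) (trans eq kf)
  ... | inj₁ ke | inj₂ (w , f≡ , _ , kf) = ⊥-elim (j∉ (subst (_∈ duplicates) (≡-sym f≡)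
        (dup⁺ (common⁺ (subst (_∈ P) (trans (≡-sym ke) (trans eq kf)) iP) (subst (_∈ P) f≡ jP)))))
  ... | inj₂ (w , e≡ , _ , ke) | inj₁ kf = ⊥-elim (i∉ (subst (_∈ duplicates) (≡-sym e≡)
        (dup⁺ (common⁺ (subst (_∈ P) (trans (≡-sym kf) (trans (≡-sym eq) ke)) jP) (subst (_∈ P) e≡ iP)))))
  ... | inj₂ (w , e≡ , wu , ke) | inj₂ (w′ , f≡ , _ , kf) with mkEdge-injective (trans (≡-sym ke) (trans eq kf))
  ...   | inj₁ (_ , refl) = trans e≡ (≡-sym f≡)
  ...   | inj₂ (_ , h) = ⊥-elim (wu h)

  canonical-cover : ∀ {e} → e ∈ P → ∃ λ f → f ∈ canonical × key e ≡ key f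
  canonical-cover {e} i with e ∈? duplicates
  ... | no ∉ = e , ∈-filter⁺ (λ e → ¬? (e ∈? duplicates)) i ∉ , refl
  ... | yes j with dup⁻ j
  ... | w , refl , h = mkEdge u w , ∈-filter⁺ (λ e → ¬? (e ∈? duplicates)) (proj₁ (common⁻ h)) not-dup ,
      trans (key-mkEdge v w) (trans (cong (λ t → mkEdge t (contract w)) (trans contract-v (≡-sym (contract-other u≢v)))) (≡-sym (key-mkEdge u w)))
    where
    not-dup : mkEdge u w ∉ duplicates
    not-dup k with dup⁻ k
    ... | w′ , eq , h′ with mkEdge-injective eq
    ...   | inj₁ (uv , _) = u≢v uv
    ...   | inj₂ (refl , _) = mkEdge∈P⇒≢ (proj₁ (common⁻ h′)) refl

  private
    A′ : List (Edge ℓ)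
    A′ = filter (λ e → ¬? (e ≟ₑ H)) (P ++ (H ∷ []))

  A′⁺ : ∀ {e} → e ∈ P → e ∈ A′
  A′⁺ {e} i = ∈-filter⁺ (λ e → ¬? (e ≟ₑ H)) (∈-++⁺ˡ i) (λ { refl → H∉P i })

  A′⁻ : ∀ {e} → e ∈ A′ → e ∈ P
  A′⁻ {e} i with ∈-filter⁻ (λ e → ¬? (e ≟ₑ H)) {xs = P ++ (H ∷ [])} i
  ... | j , ne with ∈-++⁻ P j
  ...   | inj₁ k = k
  ...   | inj₂ (here e) = ⊥-elim (ne e)

  same⇒key-P : ∀ {e f} → e ∈ P → f ∈ P → SameRestr H e f → key e ≡ key f
  same⇒key-P i j = same⇒key (ordered i) (λ { refl → H∉P i }) (ordered j) (λ { refl → H∉P j })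

  canonical-size : RestrSize (P ++ (H ∷ [])) H (length canonical)
  canonical-size = canonical , refl , All.tabulate (λ i → A′⁺ (proj₁ (canonical⁻ i))) , apart canonical id (filter⁺ _ P-unique) ,
      λ e i → let (f , j , eq) = canonical-cover (A′⁻ i) in f , j , key⇒same {e} {f} eq
    where
    apart : ∀ xs → (∀ {e} → e ∈ xs → e ∈ canonical) → Unique xs → AllPairs (λ e f → ¬ SameRestr H e f) xs
    apart [] h [] = []
    apart (x ∷ xs) h (nx ∷ un) = All.tabulate (λ {f} j same → All.lookup nx j
        (key-injective (h (here refl)) (h (there j)) (same⇒key-P (proj₁ (canonical⁻ (h (here refl)))) (proj₁ (canonical⁻ (h (there j)))) same)))
      ∷ apart xs (h ∘ there) un

  -- The representatives in `RestrSize` are arbitrary, but `key` maps them and `canonical`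
  -- injectively onto the same set.
  size-canonical : ∀ {m} → RestrSize (P ++ (H ∷ [])) H m → m ≡ length canonical
  size-canonical (rs , refl , inA , distinct , cover) = trans (≡-sym (Listₚ.length-map key rs))
    (trans (Unique-length (AllPairsₚ.map⁺ (AllPairs.map (λ {e} {f} ns eq → ns (key⇒same {e} {f} eq)) distinct))
      (Unique-map-on key (filter⁺ _ P-unique) key-injective) to from) (Listₚ.length-map key canonical))
    where
    to : ∀ {k} → k ∈ map key rs → k ∈ map key canonical
    to i with ∈-map⁻ key i
    ... | e , j , refl with canonical-cover (A′⁻ (All.lookup inA j))
    ...   | f , l , eq = subst (_∈ map key canonical) (≡-sym eq) (∈-map⁺ key l)
    from : ∀ {k} → k ∈ map key canonical → k ∈ map key rs
    from i with ∈-map⁻ key i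
    ... | e , j , refl with cover e (A′⁺ (proj₁ (canonical⁻ j)))
    ...   | f , l , same = subst (_∈ map key rs) (≡-sym (same⇒key-P (proj₁ (canonical⁻ j)) (A′⁻ (All.lookup inA l)) same)) (∈-map⁺ key l)

  restriction-count : ∀ {m} → RestrSize (P ++ (H ∷ [])) H m → length P ∸ m ≡ # common
  restriction-count h = trans (cong (length P ∸_) (size-canonical h)) (trans (cong (_∸ length canonical) (≡-sym length-canonical)) (ℕₚ.m+n∸n≡m _ (length canonical)))

-- MAT-partitions and labellings

pairs≡ : ∀ {A B : Set} (xs : List A) (ys : List B) → concatMap (λ x → map (λ y → (x , y)) ys) xs ≡ cartesianProduct xs ys
pairs≡ [] ys = refl
pairs≡ (x ∷ xs) ys = cong (map (x ,_) ys ++_) (pairs≡ xs ys)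

module _ {ℓ} (G : SimpleGraph ℓ) where
  ∈edges⁻ : ∀ {a b} → (a , b) ∈ edges G → a Fin.< b × EdgeRel G a b
  ∈edges⁻ i = proj₂ (∈-filter⁻ _ {xs = concatMap (λ i → map (λ j → (i , j)) (allFin ℓ)) (allFin ℓ)} i)

  ∈edges⁺ : ∀ {a b} → a Fin.< b → EdgeRel G a b → (a , b) ∈ edges G
  ∈edges⁺ {a} {b} l e = ∈-filter⁺ _ (subst ((a , b) ∈_) (≡-sym (pairs≡ (allFin ℓ) (allFin ℓ))) (∈-cartesianProduct⁺ (∈-allFin a) (∈-allFin b))) (l , e)

  mkEdge∈edges : ∀ {a b} → EdgeRel G a b → mkEdge a b ∈ edges G
  mkEdge∈edges {a} {b} e with Finₚ.<-cmp a b
  ... | tri< l _ _ = subst (_∈ edges G) (≡-sym (mkEdge-< l)) (∈edges⁺ l e)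
  ... | tri≈ _ h _ = ⊥-elim (edge-≢ G e h)
  ... | tri> _ _ l = subst (_∈ edges G) (≡-sym (mkEdge-> l)) (∈edges⁺ l (edge-sym G e))

  edges∋mkEdge : ∀ {a b} → mkEdge a b ∈ edges G → EdgeRel G a b
  edges∋mkEdge {a} {b} i with mkEdge-cases a b
  ... | inj₁ e = proj₂ (∈edges⁻ (subst (_∈ edges G) e i))
  ... | inj₂ e = edge-sym G (proj₂ (∈edges⁻ (subst (_∈ edges G) e i)))

  edges-unique : Unique (edges G)
  edges-unique = filter⁺ _ (subst Unique (≡-sym (pairs≡ (allFin ℓ) (allFin ℓ))) (cartesianProduct⁺ (allFin⁺ ℓ) (allFin⁺ ℓ)))

Unique-++⁻ : ∀ {A : Set} (xs : List A) {ys} → Unique (xs ++ ys) → Unique xs × Unique ys × (∀ {x} → x ∈ xs → x ∉ ys)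
Unique-++⁻ [] u = [] , u , λ ()
Unique-++⁻ (x ∷ xs) (nx ∷ u) with Unique-++⁻ xs u
... | ux , uy , dis = All.tabulate (λ i → All.lookup nx (∈-++⁺ˡ i)) ∷ ux , uy ,
  λ { (here refl) j → All.lookup nx (∈-++⁺ʳ xs j) refl ; (there i) j → dis i j }

-- From MAT-partitions to labellings

module FromPartition {c ℓ′ : Level} (K : Field c ℓ′) {ℓ : ℕ} where
  open LinAlg K ℓ
  open Linear K ℓ
  open import Data.List.Membership.DecPropositional (_≟ₑ_ {ℓ}) using (_∈?_)

  blockIndex : List (List (Edge ℓ)) → Edge ℓ → ℕ
  blockIndex [] e = 0
  blockIndex (b ∷ bs) e = if does (e ∈? b) then 0 else suc (blockIndex bs e)

  blockIndex-here : ∀ {b bs e} → e ∈ b → blockIndex (b ∷ bs) e ≡ 0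
  blockIndex-here {b} {bs} {e} i rewrite dec-true (e ∈? b) i = refl

  blockIndex-there : ∀ {b bs e} → e ∉ b → blockIndex (b ∷ bs) e ≡ suc (blockIndex bs e)
  blockIndex-there {b} {bs} {e} i rewrite dec-false (e ∈? b) i = refl

  -- The conditions at the block of e, with the block and its predecessors described only through
  -- `blockIndex`. The offset k and the list `prev` account for blocks already passed in the
  -- recursion.
  record Block (prev : List (Edge ℓ)) (k : ℕ) (π : List (List (Edge ℓ))) (e : Edge ℓ) : Set (c Level.⊔ ℓ′) where
    field
      before block : List (Edge ℓ)
      e∈block : e ∈ block
      mp1 : MP1 block
      mp2 : MP2 before block
      mp3 : MP3 before block (k + blockIndex π e)
      before-unique : Unique before
      before⁻ : ∀ {f} → f ∈ before → f ∈ prev ⊎ (f ∈ concat π × blockIndex π f < blockIndex π e)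
      before⁺ : ∀ {f} → f ∈ prev ⊎ (f ∈ concat π × blockIndex π f < blockIndex π e) → f ∈ before
      block⁻ : ∀ {f} → f ∈ block → f ∈ concat π
      block⁺ : ∀ {f} → f ∈ concat π → blockIndex π f ≡ blockIndex π e → f ∈ block

  findBlock : ∀ π prev k → MATConds prev k π → Unique (prev ++ concat π) → ∀ {e} → e ∈ concat π → Block prev k π e
  findBlock (b ∷ bs) prev k (m1 , m2 , m3 , ms) un {e} i with e ∈? b
  ... | yes e∈b = record
    { before = prev ; block = b ; e∈block = e∈b ; mp1 = m1 ; mp2 = m2
    ; mp3 = subst (MP3 prev b) (trans (≡-sym (ℕₚ.+-identityʳ k)) (cong (k +_) (≡-sym (blockIndex-here {b} {bs} e∈b)))) m3
    ; before-unique = proj₁ (Unique-++⁻ prev un)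
    ; before⁻ = inj₁
    ; before⁺ = λ { (inj₁ j) → j ; (inj₂ (_ , l)) → case subst (_ <_) (blockIndex-here {b} {bs} e∈b) l of λ () }
    ; block⁻ = ∈-++⁺ˡ
    ; block⁺ = λ {f} _ eq → inFirst f (trans eq (blockIndex-here {b} {bs} e∈b)) }
    where
    inFirst : ∀ f → blockIndex (b ∷ bs) f ≡ 0 → f ∈ b
    inFirst f eq = case f ∈? b of λ { (yes j) → j ; (no ∉) → case trans (≡-sym (blockIndex-there {b} {bs} ∉)) eq of λ () }
  ... | no e∉b = record
    { before = R.before ; block = R.block ; e∈block = R.e∈block ; mp1 = R.mp1 ; mp2 = R.mp2
    ; mp3 = subst (MP3 R.before R.block) (trans (≡-sym (ℕₚ.+-suc k _)) (cong (k +_) (≡-sym (blockIndex-there {b} {bs} e∉b)))) R.mp3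
    ; before-unique = R.before-unique
    ; before⁻ = λ j → down⁻ (R.before⁻ j)
    ; before⁺ = λ j → R.before⁺ (down⁺ j)
    ; block⁻ = λ j → ∈-++⁺ʳ b (R.block⁻ j)
    ; block⁺ = λ {f} j eq → case f ∈? b of λ
        { (yes f∈b) → case trans (≡-sym (blockIndex-here {b} {bs} f∈b)) (trans eq (blockIndex-there {b} {bs} e∉b)) of λ ()
        ; (no f∉b) → R.block⁺ (later f∉b j) (ℕₚ.suc-injective (trans (≡-sym (blockIndex-there {b} {bs} f∉b)) (trans eq (blockIndex-there {b} {bs} e∉b)))) } }
    where
    later : ∀ {f} → f ∉ b → f ∈ b ++ concat bs → f ∈ concat bs
    later ∉ j with ∈-++⁻ b j
    ... | inj₁ h = ⊥-elim (∉ h)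
    ... | inj₂ h = h
    module R = Block (findBlock bs (prev ++ b) (suc k) ms (subst Unique (≡-sym (Listₚ.++-assoc prev b (concat bs))) un) (later e∉b i))
    disjoint : ∀ {f} → f ∈ concat bs → f ∉ b
    disjoint j h = proj₂ (proj₂ (Unique-++⁻ b (proj₁ (proj₂ (Unique-++⁻ prev un))))) h j
    down⁻ : ∀ {f} → f ∈ prev ++ b ⊎ (f ∈ concat bs × blockIndex bs f < blockIndex bs e) →
      f ∈ prev ⊎ (f ∈ b ++ concat bs × blockIndex (b ∷ bs) f < blockIndex (b ∷ bs) e)
    down⁻ (inj₁ j) with ∈-++⁻ prev j
    ... | inj₁ h = inj₁ h
    ... | inj₂ h = inj₂ (∈-++⁺ˡ h , subst₂ _<_ (≡-sym (blockIndex-here {b} {bs} h)) (≡-sym (blockIndex-there {b} {bs} e∉b)) (s≤s z≤n))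
    down⁻ (inj₂ (j , l)) = inj₂ (∈-++⁺ʳ b j , subst₂ _<_ (≡-sym (blockIndex-there {b} {bs} (disjoint j))) (≡-sym (blockIndex-there {b} {bs} e∉b)) (s≤s l))
    down⁺ : ∀ {f} → f ∈ prev ⊎ (f ∈ b ++ concat bs × blockIndex (b ∷ bs) f < blockIndex (b ∷ bs) e) →
      f ∈ prev ++ b ⊎ (f ∈ concat bs × blockIndex bs f < blockIndex bs e)
    down⁺ (inj₁ j) = inj₁ (∈-++⁺ˡ j)
    down⁺ {f} (inj₂ (j , l)) = case f ∈? b of λ
      { (yes h) → inj₁ (∈-++⁺ʳ prev h)
      ; (no ∉) → inj₂ (later ∉ j , ℕ.s≤s⁻¹ (subst₂ _<_ (blockIndex-there {b} {bs} ∉) (blockIndex-there {b} {bs} e∉b) l)) }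

  same-root-edge : ∀ (b : List (Edge ℓ)) {x y} → root b x ≡ root b y → ∀ w → Inter b w → w ∈H mkEdge x y
  same-root-edge b {x} {y} e w h with mkEdge-cases x y
  ... | inj₁ m = subst (w ∈H_) (≡-sym m) (≈⇒-≈0 (same-root (level w) b (Inter⁻ b h) e))
  ... | inj₂ m = subst (w ∈H_) (≡-sym m) (≈⇒-≈0 (same-root (level w) b (Inter⁻ b h) (≡-sym e)))

  root-mkEdge : ∀ (b : List (Edge ℓ)) {x y} → mkEdge x y ∈ b → root b x ≡ root b y
  root-mkEdge b {x} {y} i with mkEdge-cases x y
  ... | inj₁ m = root-edge b (subst (_∈ b) m i)
  ... | inj₂ m = ≡-sym (root-edge b (subst (_∈ b) m i))

  sameComponent : List (Edge ℓ) → Fin ℓ → Fin ℓ → Bool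
  sameComponent b a x = does (root b x ≟ᶠ root b a)

  sameComponent-cong : ∀ b a {x y} → root b x ≡ root b y → sameComponent b a x ≡ sameComponent b a y
  sameComponent-cong b a e = cong (λ t → does (t ≟ᶠ root b a)) e

  sameComponent-≢ : ∀ b a {y} → root b a ≢ root b y → sameComponent b a a ≢ sameComponent b a y
  sameComponent-≢ b a {y} ne e = ne (≡-sym (does⁻ (root b y ≟ᶠ root b a) (trans (≡-sym e) (does⁺ (root b a ≟ᶠ root b a) refl))))

  -- An edge whose ends are joined by the rest of its block would make the rank too small.
  block-acyclic : ∀ xs ys {a b} → MP1 (xs ++ mkEdge a b ∷ ys) → root (xs ++ ys) a ≢ root (xs ++ ys) b
  block-acyclic xs ys {a} {b} (len≤ , dim) e = dimension-bound b′ inBlock dim (ℕₚ.+-cancelʳ-< (length blk) _ _ (≤-trans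
      (≤-reflexive (cong suc (ℕₚ.m∸n+n≡m len≤))) (≤-trans (s≤s (reps-length b′)) (≤-reflexive (trans (≡-sym (ℕₚ.+-suc _ _)) (cong (length (reps b′) +_) (≡-sym len)))))))
    where
    b′ = xs ++ ys
    blk = xs ++ mkEdge a b ∷ ys
    len : length blk ≡ suc (length b′)
    len = trans (Listₚ.length-++ xs) (trans (ℕₚ.+-suc (length xs) (length ys)) (cong suc (≡-sym (Listₚ.length-++ xs))))
    constant : ∀ {s u v} → (u , v) ∈ blk → root b′ u ≡ root b′ v
    constant i with ∈-++⁻ xs i
    ... | inj₁ j = root-edge b′ (∈-++⁺ˡ j)
    ... | inj₂ (there j) = root-edge b′ (∈-++⁺ʳ xs j)
    ... | inj₂ (here h) with mkEdge-cases a b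
    ...   | inj₁ m with trans h m
    ...     | refl = e
    constant i | inj₂ (here h) | inj₂ m with trans h m
    ...     | refl = ≡-sym e
    inBlock : ∀ k → Inter blk (basis b′ k)
    inBlock k = Inter⁺ blk λ {u} {v} i → component-values b′ (constant {u} i)

  labelling : (G : SimpleGraph ℓ) (π : List (List (Edge ℓ))) → concat π ↭ edges G → MATConds [] 0 π → MATLabelling G
  labelling G π π↭ conds = record
    { lab = lab
    ; lab-sym = λ a b → cong (blockIndex π) (mkEdge-sym a b)
    ; count = λ {a} {b} e → count {a} {b} e
    ; separate = λ {c} {d} {a} {b} cd ab l → let open Block (blk cd) in
        sameComponent block a , (λ x y xy eq → sameComponent-cong block a (root-mkEdge block (block⁺ (∈π xy) eq))) ,
        -- Equal roots would place the intersection of the block inside the hyperplane of the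
        -- earlier edge ab, against (MP2).
        sameComponent-≢ block a λ e → mp2 (mkEdge a b , before⁺ (inj₂ (∈π ab , l)) , same-root-edge block e)
    ; acyclic = acyclic }
    where
    lab : Fin ℓ → Fin ℓ → ℕ
    lab a b = blockIndex π (mkEdge a b)
    lab-sym′ : ∀ a b → lab a b ≡ lab b a
    lab-sym′ a b = cong (blockIndex π) (mkEdge-sym a b)
    ∈π : ∀ {a b} → EdgeRel G a b → mkEdge a b ∈ concat π
    ∈π e = ∈-resp-↭ (↭-sym π↭) (mkEdge∈edges G e)
    π⊆ : ∀ {e} → e ∈ concat π → e ∈ edges G
    π⊆ = ∈-resp-↭ π↭
    blk : ∀ {a b} → EdgeRel G a b → Block [] 0 π (mkEdge a b)
    blk e = findBlock π [] 0 conds (Unique-resp-↭ (↭-sym π↭) (edges-unique G)) (∈π e)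
    count< : ∀ {a b} → a Fin.< b → EdgeRel G a b → # (lower G lab a b) ≡ lab a b
    count< {a} {b} a<b ab = trans (#-ext to from) (trans (≡-sym (R.restriction-count (proj₁ (proj₂ sized)))) (proj₂ (proj₂ sized)))
      where
      open Block (blk ab)
      before-π : ∀ {f} → f ∈ before → f ∈ concat π × blockIndex π f < lab a b
      before-π i with before⁻ i
      ... | inj₂ h = h
      H∉ : (a , b) ∉ before
      H∉ i = <-irrefl (cong (blockIndex π) (≡-sym (mkEdge-< a<b))) (proj₂ (before-π i))
      module R = Restriction K a b a<b before before-unique (λ i → proj₁ (∈edges⁻ G (π⊆ (proj₁ (before-π i))))) H∉
      sized = mp3 (a , b) (subst (_∈ block) (mkEdge-< a<b) e∈block)
      to : lower G lab a b ⊆ R.common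
      to w h with lower⁻ G lab h
      ... | aw , bw , l , l′ = R.common⁺ (before⁺ (inj₂ (∈π aw , l))) (before⁺ (inj₂ (∈π bw , l′)))
      from : R.common ⊆ lower G lab a b
      from w h with R.common⁻ h
      ... | p , q = lower⁺ G lab (edges∋mkEdge G (π⊆ (proj₁ (before-π p)))) (edges∋mkEdge G (π⊆ (proj₁ (before-π q))))
                      (proj₂ (before-π p)) (proj₂ (before-π q))
    count : ∀ {a b} → EdgeRel G a b → # (lower G lab a b) ≡ lab a b
    count {a} {b} e with Finₚ.<-cmp a b
    ... | tri< l _ _ = count< l e
    ... | tri≈ _ h _ = ⊥-elim (edge-≢ G e h)
    ... | tri> _ _ l = trans (#-ext (lower-sym G lab lab-sym′ a b) (lower-sym G lab lab-sym′ b a))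
            (trans (count< l (edge-sym G e)) (lab-sym′ b a))
    acyclic : ∀ {a b} → EdgeRel G a b → Σ (Fin ℓ → Bool) λ f → (∀ x y → EdgeRel G x y → lab x y ≡ lab a b →
        ¬ (x ≡ a × y ≡ b) → ¬ (x ≡ b × y ≡ a) → f x ≡ f y) × f a ≢ f b
    acyclic {a} {b} ab with ∈-∃++ (Block.e∈block (blk ab))
    ... | xs , ys , split = sameComponent (xs ++ ys) a , con ,
        sameComponent-≢ (xs ++ ys) a (block-acyclic xs ys (subst MP1 split mp1))
      where
      open Block (blk ab)
      con : ∀ x y → EdgeRel G x y → lab x y ≡ lab a b → ¬ (x ≡ a × y ≡ b) → ¬ (x ≡ b × y ≡ a) →
        sameComponent (xs ++ ys) a x ≡ sameComponent (xs ++ ys) a y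
      con x y xy eq o o′ = sameComponent-cong (xs ++ ys) a (root-mkEdge (xs ++ ys) rest)
        where
        rest : mkEdge x y ∈ xs ++ ys
        rest with ∈-++⁻ xs (subst (mkEdge x y ∈_) split (block⁺ (∈π xy) eq))
        ... | inj₁ j = ∈-++⁺ˡ j
        ... | inj₂ (there j) = ∈-++⁺ʳ xs j
        ... | inj₂ (here h) with mkEdge-injective h
        ...   | inj₁ p = ⊥-elim (o p)
        ...   | inj₂ p = ⊥-elim (o′ p)

  matFree⇒labelling : (G : SimpleGraph ℓ) → MATFree (edges G) → MATLabelling G
  matFree⇒labelling G (inj₂ (π , Level.lift (_ , π↭) , conds)) = labelling G π π↭ conds
  matFree⇒labelling G (inj₁ (Level.lift empty)) = record
    { lab = λ _ _ → 0 ; lab-sym = λ _ _ → refl ; count = λ e → none e ; separate = λ e → none e ; acyclic = λ e → none e }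
    where
    none : ∀ {a} {A : Set a} {x y} → EdgeRel G x y → A
    none e with subst (_ ∈_) empty (mkEdge∈edges G e)
    ... | ()

-- From labellings to MAT-partitions

filter-<-step : ∀ {A : Set} (f : A → ℕ) k xs →
  filter (λ x → f x ℕ.<? k) xs ++ filter (λ x → f x ℕ.≟ k) xs ↭ filter (λ x → f x ℕ.<? suc k) xs
filter-<-step f k [] = ↭-refl
filter-<-step f k (x ∷ xs) with ℕₚ.<-cmp (f x) k
... | tri< l ne _ rewrite Listₚ.filter-accept (λ x → f x ℕ.<? k) {xs = xs} l | Listₚ.filter-reject (λ x → f x ℕ.≟ k) {xs = xs} ne
      | Listₚ.filter-accept (λ x → f x ℕ.<? suc k) {xs = xs} (≤-trans l (n≤1+n k)) = prep x (filter-<-step f k xs)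
... | tri≈ ¬l e _ rewrite Listₚ.filter-reject (λ x → f x ℕ.<? k) {xs = xs} ¬l | Listₚ.filter-accept (λ x → f x ℕ.≟ k) {xs = xs} e
      | Listₚ.filter-accept (λ x → f x ℕ.<? suc k) {xs = xs} (s≤s (≤-reflexive e)) =
        ↭-trans (shift x (filter (λ x → f x ℕ.<? k) xs) _) (prep x (filter-<-step f k xs))
... | tri> ¬l ne g rewrite Listₚ.filter-reject (λ x → f x ℕ.<? k) {xs = xs} ¬l | Listₚ.filter-reject (λ x → f x ℕ.≟ k) {xs = xs} ne
      | Listₚ.filter-reject (λ x → f x ℕ.<? suc k) {xs = xs} (λ l → <-irrefl refl (≤-trans l g)) = filter-<-step f k xs

maximum-on : ∀ {A : Set} (f : A → ℕ) x xs → ∃ λ e → e ∈ x ∷ xs × (∀ {y} → y ∈ x ∷ xs → f y ≤ f e)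
maximum-on f x [] = x , here refl , λ { (here refl) → ≤-refl }
maximum-on f x (y ∷ ys) with maximum-on f y ys
... | e , i , m with ℕₚ.≤-total (f x) (f e)
...   | inj₁ le = e , there i , λ { (here refl) → le ; (there j) → m j }
...   | inj₂ ge = x , here refl , λ { (here refl) → ≤-refl ; (there j) → ≤-trans (m j) ge }

module ToPartition {c ℓ′ : Level} (K : Field c ℓ′) {ℓ : ℕ} (G : SimpleGraph ℓ) (L : MATLabelling G) (desc : Descending L) where
  open LinAlg K ℓ
  open Field K using (_≈_; 1#; 0#; 1≉0) renaming (refl to ≈-refl; sym to ≈-sym; trans to ≈-trans; reflexive to ≈-reflexive)
  open Linear K ℓ
  open MATLabelling L

  label : Edge ℓ → ℕ
  label (a , b) = lab a b

  block : ℕ → List (Edge ℓ)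
  block k = filter (λ e → label e ℕ.≟ k) (edges G)

  below : ℕ → List (Edge ℓ)
  below k = filter (λ e → label e ℕ.<? k) (edges G)

  blocks : ℕ → ℕ → List (List (Edge ℓ))
  blocks k zero = []
  blocks k (suc r) = block k ∷ blocks (suc k) r

  block⁻ : ∀ {k e} → e ∈ block k → e ∈ edges G × label e ≡ k
  block⁻ {k} = ∈-filter⁻ (λ e → label e ℕ.≟ k) {xs = edges G}

  block⁺ : ∀ {k e} → e ∈ edges G → label e ≡ k → e ∈ block k
  block⁺ {k} = ∈-filter⁺ (λ e → label e ℕ.≟ k)

  below⁻ : ∀ {k e} → e ∈ below k → e ∈ edges G × label e < k
  below⁻ {k} = ∈-filter⁻ (λ e → label e ℕ.<? k) {xs = edges G}

  below⁺ : ∀ {k e} → e ∈ edges G → label e < k → e ∈ below k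
  below⁺ {k} = ∈-filter⁺ (λ e → label e ℕ.<? k)

  concat-blocks : ∀ r k → below k ++ concat (blocks k r) ↭ below (r + k)
  concat-blocks zero k rewrite Listₚ.++-identityʳ (below k) = ↭-refl
  concat-blocks (suc r) k = subst₂ _↭_ (Listₚ.++-assoc (below k) (block k) _) (cong below (ℕₚ.+-suc r k))
    (↭-trans (++⁺ʳ (concat (blocks (suc k) r)) (filter-<-step label k (edges G))) (concat-blocks r (suc k)))

  -- The colouring of `acyclic` for the first edge is constant on all other edges of the class, so
  -- these cannot join its ends.
  block-forest : ∀ {k} b → Unique b → (∀ {e} → e ∈ b → e ∈ edges G × label e ≡ k) → Forest b
  block-forest [] _ _ = zero
  block-forest {k} ((u , v) ∷ b) (n ∷ un) h = separated , block-forest b un (h ∘ there)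
    where
    u<v = proj₁ (∈edges⁻ G (proj₁ (h (here refl))))
    uv = proj₂ (∈edges⁻ G (proj₁ (h (here refl))))
    separated : root b u ≢ root b v
    separated e with acyclic uv
    ... | f , con , ne = ne (same-root {R = λ x y → f x ≡ f y} (record { refl = refl ; sym = ≡-sym ; trans = trans }) b
        (λ {x} {y} i → let (x<y , xy) = ∈edges⁻ G (proj₁ (h (there i))) in
          con x y xy (trans (proj₂ (h (there i))) (≡-sym (proj₂ (h (here refl)))))
            (λ { (refl , refl) → All.lookup n i refl }) (λ { (refl , refl) → <-irrefl refl (<-trans u<v x<y) })) e)

  -- The colouring of `separate`, read as a 0/1 vector, lies in the intersection of the block but
  -- not in the earlier hyperplane. The edge cd witnesses that label k occurs, as `separate` refers
  -- to the class of an edge.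
  mp2 : ∀ {k prev c d} → EdgeRel G c d → lab c d ≡ k → (∀ {e} → e ∈ prev → e ∈ edges G × label e < k) → MP2 prev (block k)
  mp2 {k} cd refl h ((p , q) , i , contains) with separate cd (proj₂ (∈edges⁻ G (proj₁ (h i)))) (proj₂ (h i))
  ... | f , con , ne = distinguish (f p) (f q) ne (-≈0⇒≈ (contains (indicator ∘ f)
      (Inter⁺ (block k) λ j → ≈-reflexive (cong indicator (con _ _ (proj₂ (∈edges⁻ G (proj₁ (block⁻ j)))) (proj₂ (block⁻ j)))))))
    where
    distinguish : ∀ s t → s ≢ t → ¬ (indicator s ≈ indicator t)
    distinguish true true n _ = n refl
    distinguish true false _ e = 1≉0 e
    distinguish false true _ e = 1≉0 (≈-sym e)
    distinguish false false n _ = n refl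

  mp3 : ∀ {k prev} → Unique prev → (∀ {e} → e ∈ prev → e ∈ edges G × label e < k) → (∀ {e} → e ∈ edges G → label e < k → e ∈ prev) →
    MP3 prev (block k) k
  mp3 {k} {prev} un h⁻ h⁺ (u , v) i = length R.canonical , R.canonical-size ,
      trans (R.restriction-count R.canonical-size) (trans (#-ext to from) (trans (count uv) k≡))
    where
    k≡ : lab u v ≡ k
    k≡ = proj₂ (block⁻ i)
    u<v = proj₁ (∈edges⁻ G (proj₁ (block⁻ i)))
    uv = proj₂ (∈edges⁻ G (proj₁ (block⁻ i)))
    module R = Restriction K u v u<v prev un (λ j → proj₁ (∈edges⁻ G (proj₁ (h⁻ j)))) (λ j → <-irrefl k≡ (proj₂ (h⁻ j)))
    label-mkEdge : ∀ a b → label (mkEdge a b) ≡ lab a b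
    label-mkEdge a b with mkEdge-cases a b
    ... | inj₁ e = cong label e
    ... | inj₂ e = trans (cong label e) (lab-sym b a)
    prev⁻ : ∀ {a b} → mkEdge a b ∈ prev → EdgeRel G a b × lab a b < lab u v
    prev⁻ {a} {b} j = edges∋mkEdge G (proj₁ (h⁻ j)) , subst₂ _<_ (label-mkEdge a b) (≡-sym k≡) (proj₂ (h⁻ j))
    prev⁺ : ∀ {a b} → EdgeRel G a b → lab a b < lab u v → mkEdge a b ∈ prev
    prev⁺ {a} {b} e l = h⁺ (mkEdge∈edges G e) (subst₂ _<_ (≡-sym (label-mkEdge a b)) k≡ l)
    to : R.common ⊆ lower G lab u v
    to w h = let (p , q) = R.common⁻ h in lower⁺ G lab (proj₁ (prev⁻ p)) (proj₁ (prev⁻ q)) (proj₂ (prev⁻ p)) (proj₂ (prev⁻ q))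
    from : lower G lab u v ⊆ R.common
    from w h = let (uw , vw , l , l′) = lower⁻ G lab h in R.common⁺ (prev⁺ uw l) (prev⁺ vw l′)

  HasLabel : ℕ → Set
  HasLabel k = ∃ λ c → ∃ λ d → EdgeRel G c d × lab c d ≡ k

  -- `MATConds` builds `prev` by concatenation, whereas `below` keeps the order of `edges G`; the
  -- two agree only up to permutation.
  conditions : ∀ r k prev → prev ↭ below k → (∀ j → j < r + k → HasLabel j) → MATConds prev k (blocks k r)
  conditions zero k prev p h = _
  conditions (suc r) k prev p h =
    forest-rank (block k) (block-forest (block k) (filter⁺ _ (edges-unique G)) block⁻) ,
    (let (_ , _ , cd , e) = h k (s≤s (ℕₚ.m≤n+m k r)) in mp2 cd e prev⁻) ,
    mp3 (Unique-resp-↭ (↭-sym p) (filter⁺ _ (edges-unique G))) prev⁻ (λ i l → ∈-resp-↭ (↭-sym p) (below⁺ i l)) ,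
    conditions r (suc k) (prev ++ block k) (↭-trans (++⁺ʳ (block k) p) (filter-<-step label k (edges G)))
      (λ j l → h j (subst (j <_) (ℕₚ.+-suc r k) l))
    where
    prev⁻ : ∀ {e} → e ∈ prev → e ∈ edges G × label e < k
    prev⁻ i = below⁻ (∈-resp-↭ p i)

  lower-labels : ∀ p j → j ≤ p → HasLabel p → HasLabel j
  lower-labels p j le h with ℕₚ.m≤n⇒m<n∨m≡n le
  ... | inj₂ refl = h
  lower-labels (suc p) j le (_ , _ , e , eq) | inj₁ (s≤s l) = lower-labels p j l (desc e eq)

  label-edge : ∀ {c d k} → EdgeRel G c d → lab c d ≡ k → block k ≢ []
  label-edge {c} {d} {k} e eq empty with Finₚ.<-cmp c d
  ... | tri< l _ _ = case subst ((c , d) ∈_) empty (block⁺ (∈edges⁺ G l e) eq) of λ ()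
  ... | tri≈ _ h _ = edge-≢ G e h
  ... | tri> _ _ l = case subst ((d , c) ∈_) empty (block⁺ (∈edges⁺ G l (edge-sym G e)) (trans (lab-sym d c) eq)) of λ ()

  blocks-nonempty : ∀ r k → (∀ j → j < r + k → HasLabel j) → All (λ b → b ≢ []) (blocks k r)
  blocks-nonempty zero k h = []
  blocks-nonempty (suc r) k h = (let (_ , _ , e , eq) = h k (s≤s (ℕₚ.m≤n+m k r)) in label-edge e eq) ∷
    blocks-nonempty r (suc k) (λ j l → h j (subst (j <_) (ℕₚ.+-suc r k) l))

  matFree : MATFree (edges G)
  matFree = byEdges (edges G) refl
    where
    byEdges : ∀ es → edges G ≡ es → MATFree (edges G)
    byEdges [] eq = inj₁ (Level.lift eq)
    byEdges (e₀ ∷ es) eq with maximum-on label e₀ es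
    ... | (c , d) , i , max = inj₂ (blocks 0 n , Level.lift (blocks-nonempty n 0 labels , partition) ,
        conditions n 0 [] (subst ([] ↭_) (≡-sym below0) ↭-refl) labels)
      where
      -- Labels count from 0, so there is one block more than the largest label.
      n = suc (lab c d)
      below0 : below 0 ≡ []
      below0 = Listₚ.filter-none (λ e → label e ℕ.<? 0) {xs = edges G} (All.tabulate λ _ ())
      labels : ∀ j → j < n + 0 → HasLabel j
      labels j l = lower-labels (lab c d) j (ℕ.s≤s⁻¹ (subst (j <_) (ℕₚ.+-identityʳ n) l))
        (c , d , proj₂ (∈edges⁻ G (subst ((c , d) ∈_) (≡-sym eq) i)) , refl)
      all-below : below (n + 0) ≡ edges G
      all-below = Listₚ.filter-all (λ e → label e ℕ.<? (n + 0)) (All.tabulate λ j → s≤s (≤-trans (max (subst (_ ∈_) eq j)) (≤-reflexive (≡-sym (ℕₚ.+-identityʳ _)))))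
      partition : concat (blocks 0 n) ↭ edges G
      partition = subst₂ _↭_ (cong (_++ concat (blocks 0 n)) below0) all-below (concat-blocks n 0)

theorem2p10 : ∀ {c ℓ′ : Level} (K : Field c ℓ′) {ℓ} (G : SimpleGraph ℓ) →
    GraphicMATFree K G ⇔ StronglyChordal G
theorem2p10 K G = mk⇔
  (λ free → labelling⇒stronglyChordal G (FromPartition.matFree⇒labelling K G free))
  (λ sc → let (L , desc) = stronglyChordal⇒labelling G sc in ToPartition.matFree K G L desc)
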